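{- Let $n\ge 1$, let $m=\lceil n/2\rceil$, and let $x,k_1,\ldots,k_m$ be integers with $k_1<k_2<\cdots<k_m\le x$. Then the number of halved monotone triangles with $n$ rows, bottom row $(k_1,\ldots,k_m)$ and no entry exceeding $x$ is equal to $$\left(\prod_{1\le p<q\le (n+1)/2} E_{k_p}\,(E^{ -1}_{k_p}+E^{ -1}_{k_q}-\mathrm{id})\,(E^{ -1}_{k_p}+E_{k_q}-\mathrm{id})\right)\prod_{1\le i<j\le (n+1)/2}\frac{(k_j-k_i)(2x+1-k_i-k_j)}{(j-i)(j+i-1)}$$ if $n$ is odd, and to $$\left(\prod_{1\le p<q\le n/2} E_{k_p}\,(E^{ -1}_{k_p}+E^{ -1}_{k_q}-\mathrm{id})\,(E^{ -1}_{k_p}+E_{k_q}-\mathrm{id})\right)\prod_{1\le i<j\le n/2}\frac{(k_j-k_i)(2x+2-k_i-k_j)}{(j-i)(j+i)}\prod_{i=1}^{n/2}\frac{x+1-k_i}{i}$$ if $n$ is even.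
   Context: A halved monotone triangle with $n$ rows is a triangular array of integers $(a_{i,j})_{1\le i\le n,\,1\le j\le\lceil i/2\rceil}$ such that $a_{i+1,j}\le a_{i,j}$, $a_{i,j}\le a_{i+1,j+1}$ and $a_{i,j}<a_{i,j+1}$ whenever the entries involved are defined; its bottom row is $(a_{n,1},\ldots,a_{n,\lceil n/2\rceil})$. $E_y$ denotes the shift operator $E_y p(y)=p(y+1)$ acting on polynomials (here in the variables $k_1,\ldots,k_m$, with $x$ treated as a parameter), $E_y^{ -1}p(y)=p(y-1)$, and $\mathrm{id}$ is the identity. A product of operators means their composition (the shift operators in different variables commute). The operator is applied to the displayed polynomial in $k_1,\ldots,k_m$ and the result is evaluated at the given integers. -}

module Defs where

open import Data.Nat as ℕ using (ℕ; zero; suc; ⌈_/2⌉)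
open import Data.Integer as ℤ using (ℤ; +_)
open import Data.Rational as ℚ using (ℚ)
open import Data.Fin as Fin using (Fin; toℕ)
open import Data.List as List using (List; []; _∷_; allFin; filter; concatMap; map; foldr; tabulate; length)
open import Data.Maybe using (Maybe; just; nothing)
open import Data.Product using (_×_; _,_)
open import Relation.Nullary.Decidable using (does)
open import Data.Bool using (if_then_else_)
open import Relation.Binary.PropositionalEquality using (_≡_)

-- Halved monotone triangles
--
-- A triangle with n rows is represented as the list of its rows, from
-- the top row (i = 1) to the bottom row (i = n); each row is the list
-- (a_{i,1}, ..., a_{i,⌈i/2⌉}).  Indices in `at`/`entry` are 0-based:
-- entry T i j = a_{i+1,j+1} if defined, and nothing otherwise.

at : {A : Set} → List A → ℕ → Maybe A
at []       _       = nothing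
at (a ∷ as) zero    = just a
at (a ∷ as) (suc i) = at as i

entry : List (List ℤ) → ℕ → ℕ → Maybe ℤ
entry T i j with at T i
... | just r  = at r j
... | nothing = nothing

record IsHalvedMonotoneTriangle (n : ℕ) (T : List (List ℤ)) : Set where
  field
    numRows   : length T ≡ n
    rowLength : ∀ i r → at T i ≡ just r → length r ≡ ⌈ suc i /2⌉
    ineq₁ : ∀ i j a b → entry T (suc i) j ≡ just a → entry T i j ≡ just b → a ℤ.≤ b
    ineq₂ : ∀ i j a b → entry T i j ≡ just a → entry T (suc i) (suc j) ≡ just b → a ℤ.≤ b
    ineq₃ : ∀ i j a b → entry T i j ≡ just a → entry T i (suc j) ≡ just b → a ℤ.< b

BottomRow : ℕ → List (List ℤ) → List ℤ → Set
BottomRow n T row = at T (n ℕ.∸ 1) ≡ just row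

EntriesAtMost : ℤ → List (List ℤ) → Set
EntriesAtMost x T = ∀ i j a → entry T i j ≡ just a → a ℤ.≤ x

Fn : ℕ → Set
Fn m = (Fin m → ℤ) → ℚ

Op : ℕ → Set
Op m = Fn m → Fn m

shiftAt : ∀ {m} → Fin m → ℤ → (Fin m → ℤ) → (Fin m → ℤ)
shiftAt p c k i = if does (i Fin.≟ p) then k i ℤ.+ c else k i

E : ∀ {m} → Fin m → Op m
E p f k = f (shiftAt p (+ 1) k)

E⁻¹ : ∀ {m} → Fin m → Op m
E⁻¹ p f k = f (shiftAt p (ℤ.- (+ 1)) k)

idOp : ∀ {m} → Op m
idOp f = f

_⊕_ : ∀ {m} → Op m → Op m → Op m
(A ⊕ B) f k = A f k ℚ.+ B f k

_⊖_ : ∀ {m} → Op m → Op m → Op m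
(A ⊖ B) f k = A f k ℚ.- B f k

_∘ₒ_ : ∀ {m} → Op m → Op m → Op m
(A ∘ₒ B) f = A (B f)

infixl 6 _⊕_ _⊖_
infixr 9 _∘ₒ_

pairs : (m : ℕ) → List (Fin m × Fin m)
pairs m = concatMap (λ p → map (p ,_) (filter (λ q → p Fin.<? q) (allFin m))) (allFin m)

factorOp : ∀ {m} → Fin m × Fin m → Op m
factorOp (p , q) = E p ∘ₒ (E⁻¹ p ⊕ E⁻¹ q ⊖ idOp) ∘ₒ (E⁻¹ p ⊕ E q ⊖ idOp)

theOperator : (m : ℕ) → Op m
theOperator m = foldr (λ pq A → factorOp pq ∘ₒ A) idOp (pairs m)

-- total division ℤ by ℕ into ℚ (division by 0 gives 0; only used with
-- positive denominators)
_/′_ : ℤ → ℕ → ℚ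
z /′ zero  = ℚ.0ℚ
z /′ suc d = z ℚ./ suc d

prodℚ : List ℚ → ℚ
prodℚ = foldr ℚ._*_ ℚ.1ℚ

ι : ℕ → ℤ
ι n = + n

-- index i : Fin m corresponds to the 1-based index toℕ i + 1
-- ∏_{1≤i<j≤m} (k_j-k_i)(2x+1-k_i-k_j) / ((j-i)(j+i-1))
polyOdd : (m : ℕ) → ℤ → Fn m
polyOdd m x k = prodℚ (map (λ { (i , j) →
    ((k j ℤ.- k i) ℤ.* (ι 2 ℤ.* x ℤ.+ ι 1 ℤ.- k i ℤ.- k j))
      /′ ((toℕ j ℕ.∸ toℕ i) ℕ.* (toℕ j ℕ.+ toℕ i ℕ.+ 1)) }) (pairs m))

polyEven : (m : ℕ) → ℤ → Fn m
polyEven m x k =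
  prodℚ (map (λ { (i , j) →
    ((k j ℤ.- k i) ℤ.* (ι 2 ℤ.* x ℤ.+ ι 2 ℤ.- k i ℤ.- k j))
      /′ ((toℕ j ℕ.∸ toℕ i) ℕ.* (toℕ j ℕ.+ toℕ i ℕ.+ 2)) }) (pairs m))
  ℚ.* prodℚ (map (λ i → (x ℤ.+ ι 1 ℤ.- k i) /′ (toℕ i ℕ.+ 1)) (allFin m))

{-# OPTIONS --safe #-}

-- Up to constants, the displayed products are determinants: for odd n of even polynomials e_j in
-- x + 1/2 - k of degree 2 j, for even n of odd polynomials o_j in x + 1 - k of degree 2 j + 1, where
-- e_{j+1}(k) - e_{j+1}(k - 1) = o_j(k) and o_j(k) - o_j(k + 1) = e_j(k).  Hence the claimed formula for
-- n - 1 rows is a product of difference operators applied to a function g = V G, where V is the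
-- operator of the theorem and G an antisymmetric determinant.
--
-- Deleting the bottom row k leaves a strictly increasing row l that interlaces with k.  The sum over l
-- telescopes, and the only obstruction, l_i = l_{i+1} = c, disappears because
-- E_p⁻¹ E_q⁻¹ + id - E_p⁻¹ turns the factor V_{pq} into an operator symmetric in p and q, so that it
-- kills V G on k_p = k_q.  What remains are the evaluations of g that omit one of the bounds.  For odd n
-- they add up to V applied to the determinant expanded along its constant column e_0, since
-- V_{pq} = E_p⁻¹ on functions not depending on k_q and V_{pq} = id on functions not depending on k_p.
-- For even n all but one of them vanish, because V is invariant under E_q ↔ E_q⁻¹ for the last index
-- q and G is odd about x + 1 in its last variable.
module Submission where

open import Defs
open import Data.Nat as ℕ using (ℕ; zero; suc; pred; _!; _%_; ⌈_/2⌉; ⌊_/2⌋)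
import Data.Nat.Properties as ℕ
open import Data.Integer as ℤ using (ℤ; +_; 0ℤ; 1ℤ; -1ℤ)
import Data.Integer.Properties as ℤ
open import Data.Rational as ℚ using (ℚ; 0ℚ; 1ℚ; _+_; _*_; _-_; -_)
import Data.Rational.Properties as ℚ
import Data.Rational.Unnormalised as ℚᵘ
import Data.Rational.Unnormalised.Properties as ℚᵘ
open import Data.Fin as Fin using (Fin; zero; suc)
open import Data.List as List using (List; []; _∷_; _++_; length; tabulate; concatMap; allFin; filter; foldr)
import Data.List.Properties as List
open import Data.List.Membership.Propositional using (_∈_; find; lose)
open import Data.List.Membership.Propositional.Properties using (∈-map⁺; ∈-map⁻; ∈-concatMap⁺; ∈-concatMap⁻)
open import Data.List.Relation.Unary.Any using (here; there)
open import Data.List.Relation.Unary.All as All using ([]; _∷_)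
open import Data.List.Relation.Unary.AllPairs using ([]; _∷_)
open import Data.List.Relation.Unary.Unique.Propositional using (Unique)
import Data.List.Relation.Unary.Unique.Propositional.Properties as Unique
open import Data.Maybe using (just)
open import Data.Maybe.Properties using (just-injective)
open import Data.Vec as Vec using (Vec; []; _∷_; lookup; removeAt)
import Data.Vec.Properties as Vec
open import Data.Unit using (⊤)
open import Data.Bool using (true; false)
open import Data.Product as Product using (Σ; _×_; _,_; proj₁; proj₂)
open import Data.Sum as Sum using (_⊎_; inj₁; inj₂)
open import Data.Empty using (⊥; ⊥-elim)
open import Function using (_∘_; const)
open import Function.Bundles using (_⇔_; mk⇔; Equivalence)
open import Level using (0ℓ)
open import Relation.Nullary using (yes; no)
open import Relation.Nullary.Decidable using (does; dec⇒maybe)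
open import Relation.Binary.PropositionalEquality
open import Data.Nat.Tactic.RingSolver using () renaming (solve-∀ to ℕ-solve-∀)
open import Data.Integer.Tactic.RingSolver using () renaming (solve-∀ to ℤ-solve-∀)
open import Tactic.RingSolver using (solve-∀)
open import Tactic.RingSolver.Core.AlmostCommutativeRing using (AlmostCommutativeRing; fromCommutativeRing)
open ≡-Reasoning

-- Strictness of the row l makes the summation non-rectangular: the lower bound of the next entry is
-- u as long as l < u, but u + 1 for l = u. Telescoping over one entry therefore leaves, besides the
-- two end values, a correction at l = u, and `Contractible` is the condition that makes the values
-- around u collapse. The sums are nested, so the condition is also needed with the earlier entries
-- fixed; hence its closure under slices.
--
-- Operators are kept as syntax. The three properties of V (symmetry after contraction, collapse
-- when a variable is absent, invariance under reflection) all describe how a linear change of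
-- variables acts on the exponents of the shifts, so each reduces to `mapSh` and the commutativity
-- of composition.
--
-- The two parities use opposite differences. Backward differences leave k_i - 1 at the lower ends,
-- which is the shift that V produces when an index is deleted. The other direction leaves k_i
-- itself at the lower ends and x + 1 at the last upper end, which is a zero of the odd columns.

private
  variable
    X : Set
    m n : ℕ

ℚ-ring : AlmostCommutativeRing 0ℓ 0ℓ
ℚ-ring = fromCommutativeRing ℚ.+-*-commutativeRing (λ p → dec⇒maybe (0ℚ ℚ.≟ p))

≡-neg⇒≡0 : ∀ p → p ≡ - p → p ≡ 0ℚ
≡-neg⇒≡0 p p≡-p = begin
  p                    ≡⟨ halves p ⟩
  ℚ.½ * (p + p)        ≡⟨ cong (λ q → ℚ.½ * (p + q)) p≡-p ⟩
  ℚ.½ * (p - p)        ≡⟨ cong (ℚ.½ *_) (ℚ.+-inverseʳ p) ⟩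
  ℚ.½ * 0ℚ             ≡⟨⟩
  0ℚ                   ∎
  where
  halves : ∀ p → p ≡ ℚ.½ * (p + p)
  halves = solve-∀ ℚ-ring

*-cancelˡ-≢0 : ∀ {p q r} → p ≢ 0ℚ → p * q ≡ p * r → q ≡ r
*-cancelˡ-≢0 {p} {q} {r} p≢0 pq≡pr = begin
  q                   ≡⟨ expand q ⟩
  ℚ.1/ p * (p * q)    ≡⟨ cong (ℚ.1/ p *_) pq≡pr ⟩
  ℚ.1/ p * (p * r)    ≡⟨ sym (expand r) ⟩
  r                   ∎
  where
  instance
    p-nonZero : ℚ.NonZero p
    p-nonZero = ℚ.≢-nonZero p≢0
  expand : ∀ s → s ≡ ℚ.1/ p * (p * s)
  expand s = begin
    s                   ≡⟨ sym (ℚ.*-identityˡ s) ⟩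
    1ℚ * s              ≡⟨ cong (_* s) (sym (ℚ.*-inverseˡ p)) ⟩
    ℚ.1/ p * p * s      ≡⟨ ℚ.*-assoc (ℚ.1/ p) p s ⟩
    ℚ.1/ p * (p * s)    ∎

-- Alternating sums and determinants

altSum : (Fin n → ℚ) → ℚ
altSum {zero}  t = 0ℚ
altSum {suc n} t = t zero - altSum (t ∘ suc)

altSum-cong : {s t : Fin n → ℚ} → (∀ j → s j ≡ t j) → altSum s ≡ altSum t
altSum-cong {zero}  s≗t = refl
altSum-cong {suc n} s≗t = cong₂ _-_ (s≗t zero) (altSum-cong (s≗t ∘ suc))

altSum-0 : ∀ n → altSum {n} (const 0ℚ) ≡ 0ℚ
altSum-0 zero    = refl
altSum-0 (suc n) = cong (λ s → 0ℚ - s) (altSum-0 n)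

altSum-neg : (t : Fin n → ℚ) → altSum (-_ ∘ t) ≡ - altSum t
altSum-neg {zero}  t = refl
altSum-neg {suc n} t = trans (cong (λ s → - t zero - s) (altSum-neg (t ∘ suc)))
                             (sym (ℚ.neg-distrib-+ (t zero) _))

altSum-+ : (s t : Fin n → ℚ) → altSum (λ j → s j + t j) ≡ altSum s + altSum t
altSum-+ {zero}  s t = refl
altSum-+ {suc n} s t = trans (cong (λ r → s zero + t zero - r) (altSum-+ (s ∘ suc) (t ∘ suc)))
                             (regroup (s zero) (t zero) _ _)
  where
  regroup : ∀ a b c d → a + b - (c + d) ≡ (a - c) + (b - d)
  regroup = solve-∀ ℚ-ring

altSum-sub : (s t : Fin n → ℚ) → altSum (λ j → s j - t j) ≡ altSum s - altSum t
altSum-sub s t = trans (altSum-+ s (-_ ∘ t)) (cong (λ r → altSum s + r) (altSum-neg t))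

altSum-*ˡ : (c : ℚ) (t : Fin n → ℚ) → altSum (λ j → c * t j) ≡ c * altSum t
altSum-*ˡ {zero}  c t = sym (ℚ.*-zeroʳ c)
altSum-*ˡ {suc n} c t = trans (cong (λ s → c * t zero - s) (altSum-*ˡ c (t ∘ suc)))
                              (distrib c (t zero) _)
  where
  distrib : ∀ a b c → a * b - a * c ≡ a * (b - c)
  distrib = solve-∀ ℚ-ring

prodV : (X → ℚ) → Vec X n → ℚ
prodV φ []      = 1ℚ
prodV φ (a ∷ v) = φ a * prodV φ v

x*[y*z]≡y*[x*z] : ∀ x y z → x * (y * z) ≡ y * (x * z)
x*[y*z]≡y*[x*z] = solve-∀ ℚ-ring

prodV-removeAt : (φ : X → ℚ) (v : Vec X (suc n)) (j : Fin (suc n)) →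
                 prodV φ v ≡ φ (lookup v j) * prodV φ (removeAt v j)
prodV-removeAt φ (a ∷ v)         zero    = refl
prodV-removeAt φ (a ∷ v@(_ ∷ _)) (suc j) =
  trans (cong (φ a *_) (prodV-removeAt φ v j)) (x*[y*z]≡y*[x*z] (φ a) (φ (lookup v j)) (prodV φ (removeAt v j)))

prodV-map : {Y : Set} (φ : Y → ℚ) (w : X → Y) (v : Vec X n) →
            prodV φ (Vec.map w v) ≡ prodV (φ ∘ w) v
prodV-map φ w []      = refl
prodV-map φ w (a ∷ v) = cong (φ (w a) *_) (prodV-map φ w v)

swapAt : Fin (pred m) → Vec X m → Vec X m
swapAt {suc (suc m)} zero    (a ∷ b ∷ v) = b ∷ a ∷ v
swapAt {suc (suc m)} (suc i) (a ∷ v)     = a ∷ swapAt i v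

-- Stated for adjacent transpositions: the arguments compare neighbouring entries, and this form
-- passes directly to the function obtained by fixing the first entry.
Antisymmetric : (Vec X m → ℚ) → Set
Antisymmetric {m = m} g = (i : Fin (pred m)) → ∀ v → g (swapAt i v) ≡ - g v

antisym-slice : {g : Vec X (suc m) → ℚ} → Antisymmetric g → ∀ a → Antisymmetric (g ∘ (a ∷_))
antisym-slice {m = suc m} anti a i v = anti (suc i) (a ∷ v)

-- Laplace expansion along a column with entries φ, the complementary minors being given by g.
laplace : (X → ℚ) → (Vec X m → ℚ) → Vec X (suc m) → ℚ
laplace φ g v = altSum (λ j → φ (lookup v j) * g (removeAt v j))

laplace-factor : (c : ℚ) (φ : X → ℚ) (g : Vec X m → ℚ) (v : Vec X (suc m)) {s : Fin (suc m) → ℚ} →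
                 (∀ j → s j ≡ c * (φ (lookup v j) * g (removeAt v j))) → altSum s ≡ c * laplace φ g v
laplace-factor c φ g v s≗ = trans (altSum-cong s≗) (altSum-*ˡ c (λ j → φ (lookup v j) * g (removeAt v j)))

laplace-∷ : (φ : X → ℚ) (g : Vec X (suc m) → ℚ) → ∀ a v →
            laplace φ g (a ∷ v) ≡ φ a * g v - laplace φ (g ∘ (a ∷_)) v
laplace-∷ φ g a (b ∷ v) = refl

laplace-cong : {φ ψ : X → ℚ} {g h : Vec X m → ℚ} → (∀ a → φ a ≡ ψ a) → (∀ v → g v ≡ h v) →
               ∀ v → laplace φ g v ≡ laplace ψ h v
laplace-cong φ≗ψ g≗h v = altSum-cong (λ j → cong₂ _*_ (φ≗ψ (lookup v j)) (g≗h (removeAt v j)))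

-- A swap of the first two entries exchanges the first two terms, which carry opposite signs, and
-- swaps the leading entries of every other minor. A later swap acts inside the minor of the first
-- term and inside the expansion of the slice, so `laplace-∷` reduces it to a shorter vector.
laplace-antisym : (φ : X → ℚ) {g : Vec X m → ℚ} → Antisymmetric g → Antisymmetric (laplace φ g)
laplace-antisym {m = suc m} φ {g} anti zero (a ∷ b ∷ v) = begin
  φ b * g (a ∷ v) - (φ a * g (b ∷ v) - altSum (minors b a))
    ≡⟨ cong (λ s → φ b * g (a ∷ v) - (φ a * g (b ∷ v) - s))
            (trans (altSum-cong (swapped v)) (altSum-neg (minors a b))) ⟩
  φ b * g (a ∷ v) - (φ a * g (b ∷ v) - (- altSum (minors a b)))
    ≡⟨ regroup (φ b * g (a ∷ v)) (φ a * g (b ∷ v)) (altSum (minors a b)) ⟩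
  - (φ a * g (b ∷ v) - (φ b * g (a ∷ v) - altSum (minors a b)))
    ∎
  where
  minors : ∀ c d → Fin m → ℚ
  minors c d j = φ (lookup v j) * g (removeAt (c ∷ d ∷ v) (suc (suc j)))
  swapped : ∀ v (j : Fin m) → φ (lookup v j) * g (removeAt (b ∷ a ∷ v) (suc (suc j)))
                            ≡ - (φ (lookup v j) * g (removeAt (a ∷ b ∷ v) (suc (suc j))))
  swapped v@(_ ∷ _) j = trans (cong (φ (lookup v j) *_) (anti zero (a ∷ b ∷ removeAt v j)))
                              (sym (ℚ.neg-distribʳ-* (φ (lookup v j)) _))
  regroup : ∀ p q r → p - (q - (- r)) ≡ - (q - (p - r))
  regroup = solve-∀ ℚ-ring
laplace-antisym {m = suc (suc m)} φ {g} anti (suc i) (a ∷ v) = begin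
  laplace φ g (a ∷ swapAt i v)
    ≡⟨ laplace-∷ φ g a (swapAt i v) ⟩
  φ a * g (swapAt i v) - laplace φ (g ∘ (a ∷_)) (swapAt i v)
    ≡⟨ cong₂ (λ s t → φ a * s - t) (anti i v) (laplace-antisym φ (antisym-slice anti a) i v) ⟩
  φ a * (- g v) - (- laplace φ (g ∘ (a ∷_)) v)
    ≡⟨ regroup (φ a) (g v) _ ⟩
  - (φ a * g v - laplace φ (g ∘ (a ∷_)) v)
    ≡⟨ cong -_ (sym (laplace-∷ φ g a v)) ⟩
  - laplace φ g (a ∷ v)
    ∎
  where
  regroup : ∀ p q r → p * (- q) - (- r) ≡ - (p * q - r)
  regroup = solve-∀ ℚ-ring

-- Vandermonde products and determinants of Newton polynomials.

vandermonde : Vec ℚ m → ℚ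
vandermonde []      = 1ℚ
vandermonde (a ∷ v) = prodV (_- a) v * vandermonde v

prodV-swapAt : (φ : X → ℚ) (i : Fin (pred m)) (v : Vec X m) → prodV φ (swapAt i v) ≡ prodV φ v
prodV-swapAt {m = suc (suc m)} φ zero    (a ∷ b ∷ v) = x*[y*z]≡y*[x*z] (φ b) (φ a) _
prodV-swapAt {m = suc (suc m)} φ (suc i) (a ∷ v)     = cong (φ a *_) (prodV-swapAt φ i v)

vandermonde-antisym : Antisymmetric {m = m} vandermonde
vandermonde-antisym {suc (suc m)} zero (a ∷ b ∷ v) =
  regroup a b (prodV (_- a) v) (prodV (_- b) v) (vandermonde v)
  where
  regroup : ∀ a b p q r → (a - b) * q * (p * r) ≡ - ((b - a) * p * (q * r))
  regroup = solve-∀ ℚ-ring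
vandermonde-antisym {suc (suc m)} (suc i) (a ∷ v) =
  trans (cong₂ _*_ (prodV-swapAt (_- a) i v) (vandermonde-antisym i v))
        (sym (ℚ.neg-distribʳ-* (prodV (_- a) v) _))

-- The Laplace expansion of a determinant with two equal columns; it is killed by every
-- difference b - a of two of the points, because the column (y - a) vanishes at a.
laplace-vandermonde-1 : (v : Vec ℚ (suc (suc m))) → laplace (const 1ℚ) vandermonde v ≡ 0ℚ
laplace-vandermonde-1 (a ∷ b ∷ [])        = refl
laplace-vandermonde-1 {suc m} (a ∷ b ∷ v) with a ℚ.≟ b
... | yes refl = ≡-neg⇒≡0 _ (laplace-antisym (const 1ℚ) vandermonde-antisym zero (a ∷ a ∷ v))
... | no  a≢b  = *-cancelˡ-≢0 b-a≢0 (trans killed (sym (ℚ.*-zeroʳ (b - a))))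
  where
  b-a≢0 : b - a ≢ 0ℚ
  b-a≢0 b-a≡0 = a≢b (trans (sym (trans (cong (λ r → a + r) b-a≡0) (ℚ.+-identityʳ a))) (cancel a b))
    where
    cancel : ∀ a b → a + (b - a) ≡ b
    cancel = solve-∀ ℚ-ring

  -- The term of `c` itself is zero. In every other term y - c completes the product of the
  -- differences to `c`, which comes out as a common factor and leaves the same expansion on the
  -- shorter vector `u`.
  vanishing : ∀ c (u : Vec ℚ (suc (suc m))) → laplace (_- c) vandermonde (c ∷ u) ≡ 0ℚ
  vanishing c u = begin
    laplace (_- c) vandermonde (c ∷ u)
      ≡⟨ laplace-∷ (_- c) vandermonde c u ⟩
    (c - c) * vandermonde u - laplace (_- c) (vandermonde ∘ (c ∷_)) u
      ≡⟨ cong₂ (λ s t → s * vandermonde u - t) (ℚ.+-inverseʳ c)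
               (laplace-factor (prodV (_- c) u) (const 1ℚ) vandermonde u factor) ⟩
    0ℚ * vandermonde u - prodV (_- c) u * laplace (const 1ℚ) vandermonde u
      ≡⟨ cong₂ (λ s t → s - prodV (_- c) u * t) (ℚ.*-zeroˡ (vandermonde u)) (laplace-vandermonde-1 u) ⟩
    0ℚ - prodV (_- c) u * 0ℚ
      ≡⟨ cong (λ s → 0ℚ - s) (ℚ.*-zeroʳ (prodV (_- c) u)) ⟩
    0ℚ
      ∎
    where
    factor : ∀ j → (lookup u j - c) * (prodV (_- c) (removeAt u j) * vandermonde (removeAt u j))
                 ≡ prodV (_- c) u * (1ℚ * vandermonde (removeAt u j))
    factor j = trans (sym (ℚ.*-assoc (lookup u j - c) _ _))
                     (cong₂ _*_ (sym (prodV-removeAt (_- c) u j)) (sym (ℚ.*-identityˡ _)))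

  killed : (b - a) * laplace (const 1ℚ) vandermonde (a ∷ b ∷ v) ≡ 0ℚ
  killed = begin
    (b - a) * laplace (const 1ℚ) vandermonde (a ∷ b ∷ v)
      ≡⟨ sym (altSum-*ˡ (b - a) (λ j → 1ℚ * minor j)) ⟩
    altSum (λ j → (b - a) * (1ℚ * minor j))
      ≡⟨ altSum-cong (λ j → split a b (lookup (a ∷ b ∷ v) j) (minor j)) ⟩
    altSum (λ j → (lookup (a ∷ b ∷ v) j - a) * minor j - (lookup (a ∷ b ∷ v) j - b) * minor j)
      ≡⟨ altSum-sub (λ j → (lookup (a ∷ b ∷ v) j - a) * minor j)
                    (λ j → (lookup (a ∷ b ∷ v) j - b) * minor j) ⟩
    laplace (_- a) vandermonde (a ∷ b ∷ v) - laplace (_- b) vandermonde (a ∷ b ∷ v)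
      ≡⟨ cong₂ _-_ (vanishing a (b ∷ v))
               (trans (laplace-antisym (_- b) vandermonde-antisym zero (b ∷ a ∷ v))
                      (cong -_ (vanishing b (a ∷ v)))) ⟩
    0ℚ
      ∎
    where
    minor : Fin (suc (suc (suc m))) → ℚ
    minor j = vandermonde (removeAt (a ∷ b ∷ v) j)
    split : ∀ a b y t → (b - a) * (1ℚ * t) ≡ (y - a) * t - (y - b) * t
    split = solve-∀ ℚ-ring

-- This is `laplace-vandermonde-1` for `c ∷ v`: the first term is `vandermonde v`, and the minors of
-- the other terms still contain `c`, which contributes the product of the differences to `c`.
vandermonde-expansion : (c : ℚ) (v : Vec ℚ (suc m)) →
  laplace (const 1ℚ) (λ u → prodV (_- c) u * vandermonde u) v ≡ vandermonde v
vandermonde-expansion c v = sym (p-q≡0⇒p≡q _ _ (begin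
  vandermonde v - laplace (const 1ℚ) (vandermonde ∘ (c ∷_)) v
    ≡⟨ cong (_- laplace (const 1ℚ) (vandermonde ∘ (c ∷_)) v) (sym (ℚ.*-identityˡ (vandermonde v))) ⟩
  1ℚ * vandermonde v - laplace (const 1ℚ) (vandermonde ∘ (c ∷_)) v
    ≡⟨ sym (laplace-∷ (const 1ℚ) vandermonde c v) ⟩
  laplace (const 1ℚ) vandermonde (c ∷ v)
    ≡⟨ laplace-vandermonde-1 (c ∷ v) ⟩
  0ℚ
    ∎))
  where
  p-q≡0⇒p≡q : ∀ p q → p - q ≡ 0ℚ → p ≡ q
  p-q≡0⇒p≡q p q p-q≡0 = trans (restore p q) (trans (cong (_+ q) p-q≡0) (ℚ.+-identityˡ q))
    where
    restore : ∀ p q → p ≡ p - q + q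
    restore = solve-∀ ℚ-ring

-- The determinant of the matrix (φ j (v i)).
det : (ℕ → X → ℚ) → Vec X m → ℚ
det {m = zero}  φ v = 1ℚ
det {m = suc m} φ v = laplace (φ 0) (det (φ ∘ suc)) v

det-antisym : (φ : ℕ → X → ℚ) → Antisymmetric (det {m = m} φ)
det-antisym {m = suc m} φ = laplace-antisym (φ 0) (det-antisym (φ ∘ suc))

det-cong : {φ ψ : ℕ → X → ℚ} → (∀ j a → φ j a ≡ ψ j a) → (v : Vec X m) → det φ v ≡ det ψ v
det-cong {m = zero}  φ≗ψ v = refl
det-cong {m = suc m} φ≗ψ v = laplace-cong (φ≗ψ 0) (det-cong (φ≗ψ ∘ suc)) v

det-rowScale : (ψ : X → ℚ) (φ : ℕ → X → ℚ) (v : Vec X m) →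
               det (λ j a → ψ a * φ j a) v ≡ prodV ψ v * det φ v
det-rowScale {m = zero}  ψ φ [] = refl
det-rowScale {m = suc m} ψ φ v  = laplace-factor (prodV ψ v) (φ 0) (det (φ ∘ suc)) v term
  where
  regroup : ∀ p q r s → p * q * (r * s) ≡ p * r * (q * s)
  regroup = solve-∀ ℚ-ring
  term : ∀ j → ψ (lookup v j) * φ 0 (lookup v j) * det (λ i a → ψ a * φ (suc i) a) (removeAt v j)
             ≡ prodV ψ v * (φ 0 (lookup v j) * det (φ ∘ suc) (removeAt v j))
  term j = begin
    ψ (lookup v j) * φ 0 (lookup v j) * det (λ i a → ψ a * φ (suc i) a) (removeAt v j)
      ≡⟨ cong (ψ (lookup v j) * φ 0 (lookup v j) *_) (det-rowScale ψ (φ ∘ suc) (removeAt v j)) ⟩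
    ψ (lookup v j) * φ 0 (lookup v j) * (prodV ψ (removeAt v j) * det (φ ∘ suc) (removeAt v j))
      ≡⟨ regroup (ψ (lookup v j)) _ _ _ ⟩
    ψ (lookup v j) * prodV ψ (removeAt v j) * (φ 0 (lookup v j) * det (φ ∘ suc) (removeAt v j))
      ≡⟨ cong (_* (φ 0 (lookup v j) * det (φ ∘ suc) (removeAt v j))) (sym (prodV-removeAt ψ v j)) ⟩
    prodV ψ v * (φ 0 (lookup v j) * det (φ ∘ suc) (removeAt v j))
      ∎

prodℕ : ℕ → (ℕ → ℚ) → ℚ
prodℕ zero    α = 1ℚ
prodℕ (suc m) α = α 0 * prodℕ m (α ∘ suc)

det-columnScale : (α : ℕ → ℚ) (φ : ℕ → X → ℚ) (v : Vec X m) →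
                  det (λ j a → α j * φ j a) v ≡ prodℕ m α * det φ v
det-columnScale {m = zero}  α φ v = refl
det-columnScale {m = suc m} α φ v = laplace-factor (prodℕ (suc m) α) (φ 0) (det (φ ∘ suc)) v term
  where
  regroup : ∀ p q r s → p * q * (r * s) ≡ p * r * (q * s)
  regroup = solve-∀ ℚ-ring
  term : ∀ j → α 0 * φ 0 (lookup v j) * det (λ i a → α (suc i) * φ (suc i) a) (removeAt v j)
             ≡ prodℕ (suc m) α * (φ 0 (lookup v j) * det (φ ∘ suc) (removeAt v j))
  term j = trans (cong (α 0 * φ 0 (lookup v j) *_) (det-columnScale (α ∘ suc) (φ ∘ suc) (removeAt v j)))
                 (regroup (α 0) _ _ _)

newton : (ℕ → ℚ) → ℕ → ℚ → ℚ
newton c zero    y = 1ℚ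
newton c (suc j) y = (y - c 0) * newton (c ∘ suc) j y

newton-last : ∀ c j y → newton c (suc j) y ≡ newton c j y * (y - c j)
newton-last c zero    y = ℚ.*-comm (y - c 0) 1ℚ
newton-last c (suc j) y = trans (cong ((y - c 0) *_) (newton-last (c ∘ suc) j y))
                                (sym (ℚ.*-assoc (y - c 0) _ _))

map-removeAt : {Y : Set} (w : X → Y) (v : Vec X (suc m)) (j : Fin (suc m)) →
               Vec.map w (removeAt v j) ≡ removeAt (Vec.map w v) j
map-removeAt w (a ∷ v)         zero    = refl
map-removeAt w (a ∷ v@(_ ∷ _)) (suc j) = cong (w a ∷_) (map-removeAt w v j)

-- The nodes drop out one by one. All columns but the first share the factor y - c 0, which leaves
-- the minors as a row factor; `vandermonde-expansion` then adds up the minors along the constant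
-- first column.
det-newton : (c : ℕ → ℚ) (w : X → ℚ) (v : Vec X m) →
             det (λ j a → newton c j (w a)) v ≡ vandermonde (Vec.map w v)
det-newton {m = zero}  c w [] = refl
det-newton {m = suc m} c w v  = begin
  det (λ j a → newton c j (w a)) v
    ≡⟨ altSum-cong (λ j → cong (1ℚ *_) (minor (removeAt v j))) ⟩
  altSum (λ j → 1ℚ * reduced (Vec.map w (removeAt v j)))
    ≡⟨ altSum-cong (λ j → cong (λ u → 1ℚ * reduced u) (map-removeAt w v j)) ⟩
  laplace (const 1ℚ) reduced (Vec.map w v)
    ≡⟨ vandermonde-expansion (c 0) (Vec.map w v) ⟩
  vandermonde (Vec.map w v)
    ∎
  where
  reduced : Vec ℚ m → ℚ
  reduced u = prodV (_- c 0) u * vandermonde u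
  minor : ∀ u → det (λ j a → newton c (suc j) (w a)) u ≡ reduced (Vec.map w u)
  minor u = trans (det-rowScale (λ a → w a - c 0) (λ j a → newton (c ∘ suc) j (w a)) u)
                  (cong₂ _*_ (sym (prodV-map (_- c 0) w u)) (det-newton (c ∘ suc) w u))

-- Shift operators

infixl 6 _⊹_
_⊹_ : Vec ℤ m → Vec ℤ m → Vec ℤ m
_⊹_ = Vec.zipWith ℤ._+_

0s : Vec ℤ m
0s = Vec.replicate _ 0ℤ

⊹-assoc : (u v w : Vec ℤ m) → u ⊹ v ⊹ w ≡ u ⊹ (v ⊹ w)
⊹-assoc = Vec.zipWith-assoc ℤ.+-assoc

⊹-comm : (u v : Vec ℤ m) → u ⊹ v ≡ v ⊹ u
⊹-comm = Vec.zipWith-comm ℤ.+-comm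

⊹-identityʳ : (v : Vec ℤ m) → v ⊹ 0s ≡ v
⊹-identityʳ = Vec.zipWith-identityʳ ℤ.+-identityʳ

infixl 6 _⊞_
infixr 7 _⊡_
infix  8 ⊟_

-- Laurent polynomials in the shift operators; _⊡_ is composition.
data Shifts (m : ℕ) : Set where
  one     : Shifts m
  sh      : Vec ℤ m → Shifts m
  _⊞_ _⊡_ : Shifts m → Shifts m → Shifts m
  ⊟_      : Shifts m → Shifts m

⟦_⟧ : Shifts m → (Vec ℤ m → ℚ) → Vec ℤ m → ℚ
⟦ one ⟧   f v = f v
⟦ sh w ⟧  f v = f (v ⊹ w)
⟦ A ⊞ B ⟧ f v = ⟦ A ⟧ f v + ⟦ B ⟧ f v
⟦ A ⊡ B ⟧ f v = ⟦ A ⟧ (⟦ B ⟧ f) v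
⟦ ⊟ A ⟧   f v = - ⟦ A ⟧ f v

⟦⟧-cong : (A : Shifts m) {f g : Vec ℤ m → ℚ} → (∀ v → f v ≡ g v) → ∀ v → ⟦ A ⟧ f v ≡ ⟦ A ⟧ g v
⟦⟧-cong one     f≗g v = f≗g v
⟦⟧-cong (sh w)  f≗g v = f≗g (v ⊹ w)
⟦⟧-cong (A ⊞ B) f≗g v = cong₂ _+_ (⟦⟧-cong A f≗g v) (⟦⟧-cong B f≗g v)
⟦⟧-cong (A ⊡ B) f≗g v = ⟦⟧-cong A (⟦⟧-cong B f≗g) v
⟦⟧-cong (⊟ A)   f≗g v = cong -_ (⟦⟧-cong A f≗g v)

⟦⟧-+ : (A : Shifts m) (f g : Vec ℤ m → ℚ) → ∀ v → ⟦ A ⟧ (λ u → f u + g u) v ≡ ⟦ A ⟧ f v + ⟦ A ⟧ g v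
⟦⟧-+ one     f g v = refl
⟦⟧-+ (sh w)  f g v = refl
⟦⟧-+ (A ⊞ B) f g v = trans (cong₂ _+_ (⟦⟧-+ A f g v) (⟦⟧-+ B f g v)) (interchange (⟦ A ⟧ f v) _ _ _)
  where
  interchange : ∀ a b c d → a + b + (c + d) ≡ a + c + (b + d)
  interchange = solve-∀ ℚ-ring
⟦⟧-+ (A ⊡ B) f g v = trans (⟦⟧-cong A (⟦⟧-+ B f g) v) (⟦⟧-+ A (⟦ B ⟧ f) (⟦ B ⟧ g) v)
⟦⟧-+ (⊟ A)   f g v = trans (cong -_ (⟦⟧-+ A f g v)) (ℚ.neg-distrib-+ (⟦ A ⟧ f v) (⟦ A ⟧ g v))

⟦⟧-*ˡ : (A : Shifts m) (c : ℚ) (f : Vec ℤ m → ℚ) → ∀ v → ⟦ A ⟧ (λ u → c * f u) v ≡ c * ⟦ A ⟧ f v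
⟦⟧-*ˡ one     c f v = refl
⟦⟧-*ˡ (sh w)  c f v = refl
⟦⟧-*ˡ (A ⊞ B) c f v = trans (cong₂ _+_ (⟦⟧-*ˡ A c f v) (⟦⟧-*ˡ B c f v)) (sym (ℚ.*-distribˡ-+ c (⟦ A ⟧ f v) (⟦ B ⟧ f v)))
⟦⟧-*ˡ (A ⊡ B) c f v = trans (⟦⟧-cong A (⟦⟧-*ˡ B c f) v) (⟦⟧-*ˡ A c (⟦ B ⟧ f) v)
⟦⟧-*ˡ (⊟ A)   c f v = trans (cong -_ (⟦⟧-*ˡ A c f v)) (ℚ.neg-distribʳ-* c (⟦ A ⟧ f v))

⟦⟧-neg : (A : Shifts m) (f : Vec ℤ m → ℚ) → ∀ v → ⟦ A ⟧ (λ u → - f u) v ≡ - ⟦ A ⟧ f v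
⟦⟧-neg one     f v = refl
⟦⟧-neg (sh w)  f v = refl
⟦⟧-neg (A ⊞ B) f v = trans (cong₂ _+_ (⟦⟧-neg A f v) (⟦⟧-neg B f v)) (sym (ℚ.neg-distrib-+ (⟦ A ⟧ f v) (⟦ B ⟧ f v)))
⟦⟧-neg (A ⊡ B) f v = trans (⟦⟧-cong A (⟦⟧-neg B f) v) (⟦⟧-neg A (⟦ B ⟧ f) v)
⟦⟧-neg (⊟ A)   f v = cong -_ (⟦⟧-neg A f v)

⟦⟧-sub : (A : Shifts m) (f g : Vec ℤ m → ℚ) → ∀ v → ⟦ A ⟧ (λ u → f u - g u) v ≡ ⟦ A ⟧ f v - ⟦ A ⟧ g v
⟦⟧-sub A f g v = trans (⟦⟧-+ A f (-_ ∘ g) v) (cong (λ r → ⟦ A ⟧ f v + r) (⟦⟧-neg A g v))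

⟦⟧-0 : (A : Shifts m) → ∀ v → ⟦ A ⟧ (const 0ℚ) v ≡ 0ℚ
⟦⟧-0 A v = ≡-neg⇒≡0 _ (⟦⟧-neg A (const 0ℚ) v)

⟦⟧-altSum : (A : Shifts m) (t : Fin n → Vec ℤ m → ℚ) → ∀ v →
            ⟦ A ⟧ (λ u → altSum (λ j → t j u)) v ≡ altSum (λ j → ⟦ A ⟧ (t j) v)
⟦⟧-altSum {n = zero}  A t v = ⟦⟧-0 A v
⟦⟧-altSum {n = suc n} A t v =
  trans (⟦⟧-sub A (t zero) (λ u → altSum (λ j → t (suc j) u)) v)
        (cong (λ r → ⟦ A ⟧ (t zero) v - r) (⟦⟧-altSum A (t ∘ suc) v))

-- Swapping, deleting, inserting and reflecting variables all act on an operator through its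
-- exponents in this way.
mapSh : (Vec ℤ m → Vec ℤ n) → Shifts m → Shifts n
mapSh τ one     = one
mapSh τ (sh w)  = sh (τ w)
mapSh τ (A ⊞ B) = mapSh τ A ⊞ mapSh τ B
mapSh τ (A ⊡ B) = mapSh τ A ⊡ mapSh τ B
mapSh τ (⊟ A)   = ⊟ mapSh τ A

-- The operator pulled back along an affine map τ with linear part τ₀.
mapSh-hom : (τ τ₀ : Vec ℤ m → Vec ℤ n) → (∀ v w → τ (v ⊹ w) ≡ τ v ⊹ τ₀ w) →
            (A : Shifts m) (f : Vec ℤ n → ℚ) → ∀ v → ⟦ A ⟧ (f ∘ τ) v ≡ ⟦ mapSh τ₀ A ⟧ f (τ v)
mapSh-hom τ τ₀ affine one     f v = refl
mapSh-hom τ τ₀ affine (sh w)  f v = cong f (affine v w)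
mapSh-hom τ τ₀ affine (A ⊞ B) f v = cong₂ _+_ (mapSh-hom τ τ₀ affine A f v) (mapSh-hom τ τ₀ affine B f v)
mapSh-hom τ τ₀ affine (A ⊡ B) f v =
  trans (⟦⟧-cong A (mapSh-hom τ τ₀ affine B f) v) (mapSh-hom τ τ₀ affine A (⟦ mapSh τ₀ B ⟧ f) v)
mapSh-hom τ τ₀ affine (⊟ A)   f v = cong -_ (mapSh-hom τ τ₀ affine A f v)

mapSh-cong : {σ τ : Vec ℤ m → Vec ℤ n} → (∀ w → σ w ≡ τ w) → (A : Shifts m) → mapSh σ A ≡ mapSh τ A
mapSh-cong σ≗τ one     = refl
mapSh-cong σ≗τ (sh w)  = cong sh (σ≗τ w)
mapSh-cong σ≗τ (A ⊞ B) = cong₂ _⊞_ (mapSh-cong σ≗τ A) (mapSh-cong σ≗τ B)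
mapSh-cong σ≗τ (A ⊡ B) = cong₂ _⊡_ (mapSh-cong σ≗τ A) (mapSh-cong σ≗τ B)
mapSh-cong σ≗τ (⊟ A)   = cong ⊟_ (mapSh-cong σ≗τ A)

mapSh-∘ : {l : ℕ} (σ : Vec ℤ m → Vec ℤ n) (τ : Vec ℤ l → Vec ℤ m) (A : Shifts l) →
          mapSh σ (mapSh τ A) ≡ mapSh (σ ∘ τ) A
mapSh-∘ σ τ one     = refl
mapSh-∘ σ τ (sh w)  = refl
mapSh-∘ σ τ (A ⊞ B) = cong₂ _⊞_ (mapSh-∘ σ τ A) (mapSh-∘ σ τ B)
mapSh-∘ σ τ (A ⊡ B) = cong₂ _⊡_ (mapSh-∘ σ τ A) (mapSh-∘ σ τ B)
mapSh-∘ σ τ (⊟ A)   = cong ⊟_ (mapSh-∘ σ τ A)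

mapSh-id : (A : Shifts m) → mapSh (λ w → w) A ≡ A
mapSh-id one     = refl
mapSh-id (sh w)  = refl
mapSh-id (A ⊞ B) = cong₂ _⊞_ (mapSh-id A) (mapSh-id B)
mapSh-id (A ⊡ B) = cong₂ _⊡_ (mapSh-id A) (mapSh-id B)
mapSh-id (⊟ A)   = cong ⊟_ (mapSh-id A)

mapSh-square : {k l : ℕ} {σ : Vec ℤ m → Vec ℤ n} {τ : Vec ℤ l → Vec ℤ m}
               {σ₁ : Vec ℤ k → Vec ℤ n} {τ₁ : Vec ℤ l → Vec ℤ k} →
               (∀ w → σ (τ w) ≡ σ₁ (τ₁ w)) →
               (A : Shifts l) → mapSh σ (mapSh τ A) ≡ mapSh σ₁ (mapSh τ₁ A)
mapSh-square {σ = σ} {τ} {σ₁} {τ₁} comm A =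
  trans (mapSh-∘ σ τ A) (trans (mapSh-cong comm A) (sym (mapSh-∘ σ₁ τ₁ A)))

-- A translation is affine with linear part the identity, so pulling back along it leaves the
-- operator itself unchanged.
⟦⟧-shift : (A : Shifts m) (w : Vec ℤ m) (f : Vec ℤ m → ℚ) → ∀ v →
           ⟦ A ⟧ (λ u → f (u ⊹ w)) v ≡ ⟦ A ⟧ f (v ⊹ w)
⟦⟧-shift A w f v = trans (mapSh-hom (_⊹ w) (λ u → u) translate A f v)
                         (cong (λ B → ⟦ B ⟧ f (v ⊹ w)) (mapSh-id A))
  where
  translate : ∀ u u₁ → u ⊹ u₁ ⊹ w ≡ u ⊹ w ⊹ u₁
  translate u u₁ = trans (⊹-assoc u u₁ w) (trans (cong (u ⊹_) (⊹-comm u₁ w)) (sym (⊹-assoc u w u₁)))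

infix 4 _≈_
-- A record, so that unification can read the two operators off the type of a proof; the interpreted
-- equation does not determine them.
record _≈_ (A B : Shifts m) : Set where
  constructor mk≈
  field ⟦≈⟧ : ∀ f v → ⟦ A ⟧ f v ≡ ⟦ B ⟧ f v
open _≈_

≈-reflexive : {A B : Shifts m} → A ≡ B → A ≈ B
≈-reflexive refl = mk≈ (λ _ _ → refl)

≈-refl : {A : Shifts m} → A ≈ A
≈-refl = ≈-reflexive refl

≈-sym : {A B : Shifts m} → A ≈ B → B ≈ A
≈-sym A≈B = mk≈ (λ f v → sym (⟦≈⟧ A≈B f v))

≈-trans : {A B C : Shifts m} → A ≈ B → B ≈ C → A ≈ C
≈-trans A≈B B≈C = mk≈ (λ f v → trans (⟦≈⟧ A≈B f v) (⟦≈⟧ B≈C f v))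

⊡-cong : {A A₁ B B₁ : Shifts m} → A ≈ A₁ → B ≈ B₁ → A ⊡ B ≈ A₁ ⊡ B₁
⊡-cong {A = A} {B₁ = B₁} A≈A₁ B≈B₁ =
  mk≈ (λ f v → trans (⟦⟧-cong A (⟦≈⟧ B≈B₁ f) v) (⟦≈⟧ A≈A₁ (⟦ B₁ ⟧ f) v))

⊡-one : {A B C : Shifts m} → A ≈ one → B ≈ C → A ⊡ B ≈ C
⊡-one {B = B} A≈one B≈C = mk≈ (λ f v → trans (⟦≈⟧ A≈one (⟦ B ⟧ f) v) (⟦≈⟧ B≈C f v))

⊡-comm : (A B : Shifts m) → A ⊡ B ≈ B ⊡ A
⊡-comm A B = mk≈ (comm A B)
  where
  comm : (A B : Shifts m) → ∀ f v → ⟦ A ⟧ (⟦ B ⟧ f) v ≡ ⟦ B ⟧ (⟦ A ⟧ f) v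
  comm one     B f v = refl
  comm (sh w)  B f v = sym (⟦⟧-shift B w f v)
  comm (A ⊞ C) B f v = trans (cong₂ _+_ (comm A B f v) (comm C B f v)) (sym (⟦⟧-+ B (⟦ A ⟧ f) (⟦ C ⟧ f) v))
  comm (A ⊡ C) B f v = trans (⟦⟧-cong A (comm C B f) v) (comm A B (⟦ C ⟧ f) v)
  comm (⊟ A)   B f v = trans (cong -_ (comm A B f v)) (sym (⟦⟧-neg B (⟦ A ⟧ f) v))

⊡-assoc : (A B C : Shifts m) → (A ⊡ B) ⊡ C ≈ A ⊡ (B ⊡ C)
⊡-assoc A B C = mk≈ (λ _ _ → refl)

⊡-swap : (A B C : Shifts m) → A ⊡ (B ⊡ C) ≈ B ⊡ (A ⊡ C)
⊡-swap A B C = mk≈ (λ f v → ⟦≈⟧ (⊡-comm A B) (⟦ C ⟧ f) v)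

lift : Shifts m → Shifts (suc m)
lift = mapSh (0ℤ ∷_)

lift-slice : (A : Shifts m) (f : Vec ℤ (suc m) → ℚ) → ∀ a v → ⟦ lift A ⟧ f (a ∷ v) ≡ ⟦ A ⟧ (f ∘ (a ∷_)) v
lift-slice A f a v =
  sym (mapSh-hom (a ∷_) (0ℤ ∷_) (λ v w → cong (_∷ (v ⊹ w)) (sym (ℤ.+-identityʳ a))) A f v)

lift-cong : {A B : Shifts m} → A ≈ B → lift A ≈ lift B
lift-cong {A = A} {B} A≈B = mk≈ λ where
  f (a ∷ v) → trans (lift-slice A f a v) (trans (⟦≈⟧ A≈B _ v) (sym (lift-slice B f a v)))

insert₁ : ℤ → Vec ℤ (suc m) → Vec ℤ (suc (suc m))
insert₁ b (a ∷ v) = a ∷ b ∷ v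

skip : Shifts (suc m) → Shifts (suc (suc m))
skip = mapSh (insert₁ 0ℤ)

skip-slice : (A : Shifts (suc m)) (f : Vec ℤ (suc (suc m)) → ℚ) → ∀ a b v →
             ⟦ skip A ⟧ f (a ∷ b ∷ v) ≡ ⟦ A ⟧ (f ∘ insert₁ b) (a ∷ v)
skip-slice A f a b v = sym (mapSh-hom (insert₁ b) (insert₁ 0ℤ) affine A f (a ∷ v))
  where
  affine : ∀ v w → insert₁ b (v ⊹ w) ≡ insert₁ b v ⊹ insert₁ 0ℤ w
  affine (x ∷ v) (y ∷ w) = cong (λ c → x ℤ.+ y ∷ c ∷ v ⊹ w) (sym (ℤ.+-identityʳ b))

skip-cong : {A B : Shifts (suc m)} → A ≈ B → skip A ≈ skip B
skip-cong {A = A} {B} A≈B = mk≈ λ where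
  f (a ∷ b ∷ v) → trans (skip-slice A f a b v) (trans (⟦≈⟧ A≈B _ (a ∷ v)) (sym (skip-slice B f a b v)))

-- The factors V_{pq} and their product.

trinomial : Vec ℤ m → Vec ℤ m → Shifts m
trinomial u v = sh u ⊞ sh v ⊞ ⊟ one

trinomial-comm : (u v : Vec ℤ m) → trinomial u v ≈ trinomial v u
trinomial-comm u v = mk≈ (λ f w → cong (_- f w) (ℚ.+-comm (f (w ⊹ u)) (f (w ⊹ v))))

-- E_p (E_p⁻¹ + E_q⁻¹ - id) (E_p⁻¹ + E_q - id), with p, p⁻, q, q⁻ the four shift vectors.
pairSh : (p p⁻ q q⁻ : Vec ℤ m) → Shifts m
pairSh p p⁻ q q⁻ = sh p ⊡ (trinomial p⁻ q⁻ ⊡ trinomial p⁻ q)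

pair₀₁ : Shifts (suc (suc m))
pair₀₁ = pairSh (1ℤ ∷ 0ℤ ∷ 0s) (-1ℤ ∷ 0ℤ ∷ 0s) (0ℤ ∷ 1ℤ ∷ 0s) (0ℤ ∷ -1ℤ ∷ 0s)

row : ∀ m → Shifts (suc m)
row zero    = one
row (suc m) = pair₀₁ ⊡ skip (row m)

-- The operator of the theorem, split as (pairs containing the first index) ⊡ (the others).
𝒱 : ∀ m → Shifts m
𝒱 zero    = one
𝒱 (suc m) = row m ⊡ lift (𝒱 m)

mapSh-pair₀₁ : (τ : Vec ℤ (suc (suc m)) → Vec ℤ (suc (suc n))) →
               (∀ a b → τ (a ∷ b ∷ 0s) ≡ a ∷ b ∷ 0s) → mapSh τ pair₀₁ ≡ pair₀₁
mapSh-pair₀₁ τ fix rewrite fix 1ℤ 0ℤ | fix -1ℤ 0ℤ | fix 0ℤ 1ℤ | fix 0ℤ -1ℤ = refl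

swapAt-⊹ : (i : Fin (pred m)) (v w : Vec ℤ m) → swapAt i (v ⊹ w) ≡ swapAt i v ⊹ swapAt i w
swapAt-⊹ {suc (suc m)} zero    (a ∷ b ∷ v) (c ∷ d ∷ w) = refl
swapAt-⊹ {suc (suc m)} (suc i) (a ∷ v)     (c ∷ w)     = cong (a ℤ.+ c ∷_) (swapAt-⊹ i v w)

swapAt-0s : (i : Fin (pred m)) → swapAt i (0s {m}) ≡ 0s
swapAt-0s {suc (suc m)} zero    = refl
swapAt-0s {suc (suc m)} (suc i) = cong (0ℤ ∷_) (swapAt-0s i)

-- The row is a product with one factor for each later index, and a swap of two later indices
-- permutes these commuting factors. The index `suc i` keeps the first variable in place.
row-swapAt : ∀ m (i : Fin (pred m)) → mapSh (swapAt (Fin.suc i)) (row (suc (pred m))) ≈ row (suc (pred m))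
row-swapAt (suc (suc m)) zero =
  ≈-trans (≈-reflexive (cong (λ A → skip pair₀₁ ⊡ (pair₀₁ ⊡ A)) (fixed (row m))))
          (⊡-swap (skip pair₀₁) pair₀₁ (skip (skip (row m))))
  where
  fixed : (A : Shifts (suc m)) → mapSh (swapAt (suc zero)) (skip (skip A)) ≡ skip (skip A)
  fixed A = trans (cong (mapSh (swapAt (suc zero))) (mapSh-∘ _ _ A))
           (trans (mapSh-∘ _ _ A) (trans (mapSh-cong (λ { (a ∷ v) → refl }) A) (sym (mapSh-∘ _ _ A))))
row-swapAt (suc (suc m)) (suc i) =
  ⊡-cong (≈-reflexive (mapSh-pair₀₁ (swapAt (suc (suc i))) (λ a b → cong (λ v → a ∷ b ∷ v) (swapAt-0s i))))
         (≈-trans (≈-reflexive (mapSh-square (λ { (a ∷ v) → refl }) (row (suc m))))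
                  (skip-cong (row-swapAt (suc m) i)))

⟦⟧-antisym : (A : Shifts m) (i : Fin (pred m)) → mapSh (swapAt i) A ≈ A →
             (g : Vec ℤ m → ℚ) → (∀ v → g (swapAt i v) ≡ - g v) →
             ∀ v → ⟦ A ⟧ g (swapAt i v) ≡ - ⟦ A ⟧ g v
⟦⟧-antisym A i invariant g anti v = begin
  ⟦ A ⟧ g (swapAt i v)                    ≡⟨ sym (⟦≈⟧ invariant g (swapAt i v)) ⟩
  ⟦ mapSh (swapAt i) A ⟧ g (swapAt i v)   ≡⟨ sym (mapSh-hom (swapAt i) (swapAt i) (swapAt-⊹ i) A g v) ⟩
  ⟦ A ⟧ (g ∘ swapAt i) v                  ≡⟨ ⟦⟧-cong A anti v ⟩
  ⟦ A ⟧ (λ u → - g u) v                   ≡⟨ ⟦⟧-neg A g v ⟩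
  - ⟦ A ⟧ g v                             ∎

-- The condition under which two consecutive entries l_i = l_{i+1} of an interlacing row can be
-- summed as if they were independent.
Contractible : (Vec ℤ m → ℚ) → Set
Contractible {zero}        g = ⊤
Contractible {suc zero}    g = ⊤
Contractible {suc (suc m)} g =
  (∀ c v → g (c ℤ.+ -1ℤ ∷ c ℤ.+ -1ℤ ∷ v) + g (c ∷ c ∷ v) - g (c ℤ.+ -1ℤ ∷ c ∷ v) ≡ 0ℚ) ×
  (∀ a → Contractible (g ∘ (a ∷_)))

contractible-cong : {g h : Vec ℤ m → ℚ} → (∀ v → g v ≡ h v) → Contractible g → Contractible h
contractible-cong {zero}        g≗h _ = _
contractible-cong {suc zero}    g≗h _ = _
contractible-cong {suc (suc m)} g≗h (contract , slices) =
  (λ c v → trans (sym (cong₂ _-_ (cong₂ _+_ (g≗h _) (g≗h _)) (g≗h _))) (contract c v)) ,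
  (λ a → contractible-cong (g≗h ∘ (a ∷_)) (slices a))

contractible-slice : {g : Vec ℤ (suc m) → ℚ} → Contractible g → ∀ a → Contractible (g ∘ (a ∷_))
contractible-slice {zero}  _ a = _
contractible-slice {suc m} (_ , slices) a = slices a

-- The contraction (E_p⁻¹ E_q⁻¹ + id - E_p⁻¹) V_{pq}, with the factor E_p of V_{pq} multiplied into
-- the first bracket: (E_q⁻¹ + E_p - id) (E_p⁻¹ + E_q⁻¹ - id) (E_p⁻¹ + E_q - id). Exchanging p and q
-- exchanges the outer brackets and fixes the middle one.
symmetricPair : Shifts (suc (suc m))
symmetricPair = trinomial (0ℤ ∷ -1ℤ ∷ 0s) (1ℤ ∷ 0ℤ ∷ 0s)
              ⊡ (trinomial (-1ℤ ∷ 0ℤ ∷ 0s) (0ℤ ∷ -1ℤ ∷ 0s) ⊡ trinomial (-1ℤ ∷ 0ℤ ∷ 0s) (0ℤ ∷ 1ℤ ∷ 0s))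

symmetricPair-swap : mapSh (swapAt zero) (symmetricPair {m}) ≈ symmetricPair
symmetricPair-swap =
  ≈-trans (⊡-cong ≈-refl (⊡-cong (trinomial-comm _ _) ≈-refl))
 (≈-trans (⊡-swap _ _ _)
 (≈-trans (⊡-cong ≈-refl (⊡-comm _ _))
          (⊡-swap _ _ _)))

contraction : (f : Vec ℤ (suc (suc m)) → ℚ) → ∀ c v →
  let g = ⟦ pair₀₁ ⟧ f in
  g (c ℤ.+ -1ℤ ∷ c ℤ.+ -1ℤ ∷ v) + g (c ∷ c ∷ v) - g (c ℤ.+ -1ℤ ∷ c ∷ v) ≡ ⟦ symmetricPair ⟧ f (c ∷ c ∷ v)
contraction f c v = cong₂ _-_
  (cong₂ (λ a b → h (a ∷ b ∷ v ⊹ 0s) + h (c ℤ.+ 1ℤ ∷ c ℤ.+ 0ℤ ∷ v ⊹ 0s))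
         restore (ℤ.+-identityʳ (c ℤ.+ -1ℤ)))
  (trans (cong₂ (λ a b → h (a ∷ b ∷ v ⊹ 0s)) (trans restore (ℤ.+-identityʳ c)) (ℤ.+-identityʳ c))
         (cong (λ w → h (c ∷ c ∷ w)) (⊹-identityʳ v)))
  where
  h : Vec ℤ (suc (suc _)) → ℚ
  h = ⟦ trinomial (-1ℤ ∷ 0ℤ ∷ 0s) (0ℤ ∷ -1ℤ ∷ 0s) ⊡ trinomial (-1ℤ ∷ 0ℤ ∷ 0s) (0ℤ ∷ 1ℤ ∷ 0s) ⟧ f
  restore : c ℤ.+ -1ℤ ℤ.+ 1ℤ ≡ c ℤ.+ 0ℤ
  restore = ℤ.+-assoc c -1ℤ 1ℤ

-- For the first two entries, `rest` holds all factors other than the one of this pair. The swap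
-- exchanges its parts `skip (row m)` and `lift (row m)`, so the contracted operator is symmetric,
-- and on the diagonal its value at an antisymmetric function equals its own negative. For a slice,
-- the row of the first index is applied to `g` first: this preserves antisymmetry in the later
-- variables, on which `𝒱 (suc m)` then acts.
𝒱-contractible : (g : Vec ℤ m → ℚ) → Antisymmetric g → Contractible (⟦ 𝒱 m ⟧ g)
𝒱-contractible {zero}        g anti = _
𝒱-contractible {suc zero}    g anti = _
𝒱-contractible {suc (suc m)} g anti = contract , λ a → contractible-cong (slice a)
  (𝒱-contractible (⟦ row (suc m) ⟧ g ∘ (a ∷_))
    (λ i v → ⟦⟧-antisym (row (suc m)) (suc i) (row-swapAt (suc m) i) g (anti (suc i)) (a ∷ v)))
  where
  rest : Shifts (suc (suc m))
  rest = skip (row m) ⊡ (lift (row m) ⊡ lift (lift (𝒱 m)))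
  factored : symmetricPair ⊡ rest ≈ mapSh (swapAt zero) (symmetricPair ⊡ rest)
  factored = ≈-sym (⊡-cong symmetricPair-swap (≈-trans
    (≈-reflexive (cong₂ _⊡_ (trans (mapSh-∘ _ _ (row m)) (mapSh-cong (λ { (a ∷ v) → refl }) (row m)))
                (cong₂ _⊡_ (trans (mapSh-∘ _ _ (row m)) (mapSh-cong (λ { (a ∷ v) → refl }) (row m)))
                           (trans (cong (mapSh (swapAt zero)) (mapSh-∘ _ _ (𝒱 m)))
                                  (trans (mapSh-∘ _ _ (𝒱 m)) (sym (mapSh-∘ _ _ (𝒱 m))))))))
    (⊡-swap (lift (row m)) (skip (row m)) (lift (lift (𝒱 m))))))
  contract : ∀ c v → _
  contract c v = begin
    _ ≡⟨ contraction (⟦ rest ⟧ g) c v ⟩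
    ⟦ symmetricPair ⊡ rest ⟧ g (c ∷ c ∷ v)
      ≡⟨ ≡-neg⇒≡0 _ (⟦⟧-antisym (symmetricPair ⊡ rest) zero (≈-sym factored) g (anti zero) (c ∷ c ∷ v)) ⟩
    0ℚ ∎
  slice : ∀ a v → ⟦ 𝒱 (suc m) ⟧ (⟦ row (suc m) ⟧ g ∘ (a ∷_)) v ≡ ⟦ 𝒱 (suc (suc m)) ⟧ g (a ∷ v)
  slice a v = sym (trans (⟦≈⟧ (⊡-comm (row (suc m)) (lift (𝒱 (suc m)))) g (a ∷ v))
                         (lift-slice (𝒱 (suc m)) (⟦ row (suc m) ⟧ g) a v))

-- Functions that do not depend on one of the variables.

removeAt-⊹ : (j : Fin (suc m)) (v w : Vec ℤ (suc m)) → removeAt (v ⊹ w) j ≡ removeAt v j ⊹ removeAt w j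
removeAt-⊹ zero    (a ∷ v)         (b ∷ w)         = refl
removeAt-⊹ (suc j) (a ∷ v@(_ ∷ _)) (b ∷ w@(_ ∷ _)) = cong (a ℤ.+ b ∷_) (removeAt-⊹ j v w)

removeAt-0s : (j : Fin (suc m)) → removeAt 0s j ≡ 0s {m}
removeAt-0s zero            = refl
removeAt-0s {suc m} (suc j) = cong (0ℤ ∷_) (removeAt-0s j)

-- -1 in the positions before j.
below : Fin (suc m) → Vec ℤ m
below zero            = 0s
below {suc m} (suc j) = -1ℤ ∷ below j

sh-0s : sh 0s ≈ one {m}
sh-0s = mk≈ (λ f v → cong f (⊹-identityʳ v))

sh-⊡-sh : (u v : Vec ℤ m) → sh u ⊡ sh v ≈ sh (u ⊹ v)
sh-⊡-sh u v = mk≈ (λ f w → cong f (⊹-assoc w u v))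

sh-inverse : {u v : Vec ℤ m} → u ⊹ v ≡ 0s → sh u ⊡ sh v ≈ one
sh-inverse {u = u} {v} u⊹v≡0s =
  ≈-trans (sh-⊡-sh u v) (≈-trans (≈-reflexive (cong sh u⊹v≡0s)) sh-0s)

trinomial-0s : (v : Vec ℤ m) → trinomial 0s v ≈ sh v
trinomial-0s v = mk≈ λ f w →
  trans (cong (λ u → f u + f (w ⊹ v) - f w) (⊹-identityʳ w)) (cancel (f w) (f (w ⊹ v)))
  where
  cancel : ∀ a b → a + b - a ≡ b
  cancel = solve-∀ ℚ-ring

-- With E_p replaced by the identity, the two brackets become E_q⁻¹ and E_q.
pairSh-0s-p : {q q⁻ : Vec ℤ m} → q⁻ ⊹ q ≡ 0s → pairSh 0s 0s q q⁻ ≈ one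
pairSh-0s-p {q = q} {q⁻} q⁻⊹q≡0s =
  ⊡-one sh-0s (≈-trans (⊡-cong (trinomial-0s q⁻) (trinomial-0s q)) (sh-inverse q⁻⊹q≡0s))

-- With E_q replaced by the identity, both brackets become E_p⁻¹, and one of them cancels the
-- leading E_p.
pairSh-0s-q : {p p⁻ : Vec ℤ m} → p ⊹ p⁻ ≡ 0s → pairSh p p⁻ 0s 0s ≈ sh p⁻
pairSh-0s-q {p⁻ = p⁻} p⊹p⁻≡0s =
  ≈-trans (≈-sym (⊡-assoc _ _ _))
          (⊡-one (≈-trans (⊡-cong ≈-refl p⁻-only) (sh-inverse p⊹p⁻≡0s)) p⁻-only)
  where
  p⁻-only : trinomial p⁻ 0s ≈ sh p⁻
  p⁻-only = ≈-trans (trinomial-comm p⁻ 0s) (trinomial-0s p⁻)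

row-removeAt-zero : ∀ m → mapSh (λ v → removeAt v zero) (row m) ≈ one
row-removeAt-zero zero    = ≈-refl
row-removeAt-zero (suc m) =
  ⊡-one (pairSh-0s-p (cong (0ℤ ∷_) (⊹-identityʳ 0s)))
         (≈-trans (≈-reflexive (mapSh-square (λ { (a ∷ v) → refl }) (row m)))
                  (lift-cong (row-removeAt-zero m)))

row-removeAt-suc : ∀ m (j : Fin (suc m)) →
                   mapSh (λ v → removeAt v (suc j)) (row (suc m)) ≈ sh (-1ℤ ∷ 0s) ⊡ row m
row-removeAt-suc m zero =
  ⊡-cong (pairSh-0s-q (cong (0ℤ ∷_) (⊹-identityʳ 0s)))
         (≈-reflexive (trans (mapSh-∘ _ _ (row m))
                             (trans (mapSh-cong (λ { (a ∷ v) → refl }) (row m)) (mapSh-id (row m)))))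
row-removeAt-suc (suc m) (suc j) =
  ≈-trans (⊡-cong (≈-reflexive (mapSh-pair₀₁ (λ v → removeAt v (suc (suc j)))
                                             (λ a b → cong (λ v → a ∷ b ∷ v) (removeAt-0s j))))
                  (≈-trans (≈-reflexive (mapSh-square (λ { (a ∷ b ∷ v) → refl }) (row (suc m))))
                           (skip-cong (row-removeAt-suc m j))))
          (⊡-swap pair₀₁ (sh (-1ℤ ∷ 0s)) (skip (row m)))

-- Each pair (p, j) with p < j leaves E_p⁻¹ and each pair (j, q) leaves nothing; the shifts
-- collected from the rows before j make up `below j`.
𝒱-removeAt : ∀ m (j : Fin (suc m)) → mapSh (λ v → removeAt v j) (𝒱 (suc m)) ≈ sh (below j) ⊡ 𝒱 m
𝒱-removeAt m zero =
  ≈-trans (⊡-cong (row-removeAt-zero m)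
                  (≈-reflexive (trans (mapSh-∘ _ _ (𝒱 m)) (mapSh-id (𝒱 m)))))
          (⊡-cong (≈-sym sh-0s) ≈-refl)
𝒱-removeAt (suc m) (suc j) =
  ≈-trans (⊡-cong (row-removeAt-suc m j)
                  (≈-trans (≈-reflexive (mapSh-square (λ { (a ∷ v) → refl }) (𝒱 (suc m))))
                           (lift-cong (𝒱-removeAt m j))))
 (≈-trans (⊡-swap (sh (-1ℤ ∷ 0s) ⊡ row m) (sh (0ℤ ∷ below j)) (lift (𝒱 m)))
          (mk≈ λ f v → ⟦≈⟧ merge (⟦ row m ⊡ lift (𝒱 m) ⟧ f) v))
  where
  merge : sh (0ℤ ∷ below j) ⊡ sh (-1ℤ ∷ 0s) ≈ sh (-1ℤ ∷ below j)
  merge = ≈-trans (sh-⊡-sh (0ℤ ∷ below j) (-1ℤ ∷ 0s))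
                  (≈-reflexive (cong (λ v → sh (-1ℤ ∷ v)) (⊹-identityʳ (below j))))

-- Each term is independent of the omitted variable, so `𝒱-removeAt` applies to it. On the left
-- stands an expansion along a column of ones, on the right the expression to which an interlacing
-- sum telescopes.
𝒱-laplace : (g : Vec ℤ m → ℚ) (v : Vec ℤ (suc m)) →
  ⟦ 𝒱 (suc m) ⟧ (λ u → altSum (λ j → g (removeAt u j))) v ≡
  altSum (λ j → ⟦ 𝒱 m ⟧ g (removeAt v j ⊹ below j))
𝒱-laplace {m} g v = trans (⟦⟧-altSum (𝒱 (suc m)) (λ j u → g (removeAt u j)) v) (altSum-cong λ j →
  trans (mapSh-hom (λ u → removeAt u j) (λ u → removeAt u j) (removeAt-⊹ j) (𝒱 (suc m)) g v)
        (⟦≈⟧ (𝒱-removeAt m j) g (removeAt v j)))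

-- Reflection of the last variable.

negLast : Vec ℤ (suc m) → Vec ℤ (suc m)
negLast (a ∷ [])        = ℤ.- a ∷ []
negLast (a ∷ v@(_ ∷ _)) = a ∷ negLast v

reflectLast : ℤ → Vec ℤ (suc m) → Vec ℤ (suc m)
reflectLast c (a ∷ [])        = c ℤ.- a ∷ []
reflectLast c (a ∷ v@(_ ∷ _)) = a ∷ reflectLast c v

reflectLast-⊹ : (c : ℤ) (v w : Vec ℤ (suc m)) → reflectLast c (v ⊹ w) ≡ reflectLast c v ⊹ negLast w
reflectLast-⊹ c (a ∷ []) (b ∷ []) =
  cong (_∷ []) (trans (cong (λ d → c ℤ.+ d) (ℤ.neg-distrib-+ a b)) (sym (ℤ.+-assoc c (ℤ.- a) (ℤ.- b))))
reflectLast-⊹ c (a ∷ v@(_ ∷ _)) (b ∷ w@(_ ∷ _)) = cong (a ℤ.+ b ∷_) (reflectLast-⊹ c v w)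

negLast-0s : negLast 0s ≡ 0s {suc m}
negLast-0s {zero}  = refl
negLast-0s {suc m} = cong (0ℤ ∷_) negLast-0s

-- Inverting E_q exchanges the two brackets of V_{pq}, which commute. The last index occurs only in
-- the role of q, so the unsymmetric factor E_p is not touched.
row-negLast : ∀ m → mapSh negLast (row (suc m)) ≈ row (suc m)
row-negLast zero    = ⊡-cong (⊡-cong (≈-refl {A = sh (1ℤ ∷ 0ℤ ∷ [])}) (⊡-comm _ _)) ≈-refl
row-negLast (suc m) =
  ⊡-cong (≈-reflexive (mapSh-pair₀₁ negLast (λ a b → cong (λ v → a ∷ b ∷ v) negLast-0s)))
         (≈-trans (≈-reflexive (mapSh-square (λ { (a ∷ b ∷ v) → refl }) (row (suc m))))
                  (skip-cong (row-negLast m)))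

𝒱-negLast : ∀ m → mapSh negLast (𝒱 (suc m)) ≈ 𝒱 (suc m)
𝒱-negLast zero    = ≈-refl
𝒱-negLast (suc m) =
  ⊡-cong (row-negLast m)
         (≈-trans (≈-reflexive (mapSh-square (λ { (a ∷ v) → refl }) (𝒱 (suc m))))
                  (lift-cong (𝒱-negLast m)))

OddInLast : ℤ → (Vec ℤ m → ℚ) → Set
OddInLast {zero}  c g = ⊤
OddInLast {suc m} c g = ∀ v → g (reflectLast c v) ≡ - g v

𝒱-oddInLast : (c : ℤ) (g : Vec ℤ (suc m) → ℚ) → OddInLast c g → OddInLast c (⟦ 𝒱 (suc m) ⟧ g)
𝒱-oddInLast {m} c g odd v = begin
  ⟦ 𝒱 (suc m) ⟧ g (reflectLast c v)                 ≡⟨ sym (⟦≈⟧ (𝒱-negLast m) g (reflectLast c v)) ⟩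
  ⟦ mapSh negLast (𝒱 (suc m)) ⟧ g (reflectLast c v)
    ≡⟨ sym (mapSh-hom (reflectLast c) negLast (reflectLast-⊹ c) (𝒱 (suc m)) g v) ⟩
  ⟦ 𝒱 (suc m) ⟧ (g ∘ reflectLast c) v               ≡⟨ ⟦⟧-cong (𝒱 (suc m)) odd v ⟩
  ⟦ 𝒱 (suc m) ⟧ (λ u → - g u) v                     ≡⟨ ⟦⟧-neg (𝒱 (suc m)) g v ⟩
  - ⟦ 𝒱 (suc m) ⟧ g v                               ∎

-- Sums over interlacing rows

removeAt-∷ : (a : X) (v : Vec X (suc m)) (j : Fin (suc m)) → removeAt (a ∷ v) (suc j) ≡ a ∷ removeAt v j
removeAt-∷ a (b ∷ v) j = refl

-- The product of id - E_i^d over all variables: backward differences for d = -1, negated forward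
-- differences for d = 1.
differences : ℤ → ∀ m → Shifts m
differences d zero    = one
differences d (suc m) = (one ⊞ ⊟ sh (d ∷ 0s)) ⊡ lift (differences d m)

differences-slice : ∀ d m (g : Vec ℤ (suc m) → ℚ) a v → ⟦ differences d (suc m) ⟧ g (a ∷ v) ≡
  ⟦ differences d m ⟧ (g ∘ (a ∷_)) v - ⟦ differences d m ⟧ (g ∘ (a ℤ.+ d ∷_)) v
differences-slice d m g a v = cong₂ _-_ (lift-slice (differences d m) g a v)
  (trans (cong (λ w → ⟦ lift (differences d m) ⟧ g (a ℤ.+ d ∷ w)) (⊹-identityʳ v))
         (lift-slice (differences d m) g (a ℤ.+ d) v))

-- In the term of position j, the variable at j occurs only in `φ` and the others only in the minor,
-- so the factor of each variable acts on just one of the two.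
differences-minor : ∀ d m (φ : ℤ → ℚ) (g : Vec ℤ m → ℚ) (j : Fin (suc m)) v →
  ⟦ differences d (suc m) ⟧ (λ u → φ (lookup u j) * g (removeAt u j)) v ≡
  (φ (lookup v j) - φ (lookup v j ℤ.+ d)) * ⟦ differences d m ⟧ g (removeAt v j)
differences-minor d m φ g zero (a ∷ v) = begin
  ⟦ differences d (suc m) ⟧ (λ u → φ (lookup u zero) * g (removeAt u zero)) (a ∷ v)
    ≡⟨ differences-slice d m (λ u → φ (lookup u zero) * g (removeAt u zero)) a v ⟩
  ⟦ differences d m ⟧ (λ u → φ a * g u) v - ⟦ differences d m ⟧ (λ u → φ (a ℤ.+ d) * g u) v
    ≡⟨ cong₂ _-_ (⟦⟧-*ˡ (differences d m) (φ a) g v) (⟦⟧-*ˡ (differences d m) (φ (a ℤ.+ d)) g v) ⟩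
  φ a * ⟦ differences d m ⟧ g v - φ (a ℤ.+ d) * ⟦ differences d m ⟧ g v
    ≡⟨ factor (φ a) (φ (a ℤ.+ d)) (⟦ differences d m ⟧ g v) ⟩
  (φ a - φ (a ℤ.+ d)) * ⟦ differences d m ⟧ g v
    ∎
  where
  factor : ∀ a b c → a * c - b * c ≡ (a - b) * c
  factor = solve-∀ ℚ-ring
differences-minor d (suc m) φ g (suc j) (a ∷ v) = begin
  ⟦ differences d (suc (suc m)) ⟧ (λ u → φ (lookup u (suc j)) * g (removeAt u (suc j))) (a ∷ v)
    ≡⟨ differences-slice d (suc m) (λ u → φ (lookup u (suc j)) * g (removeAt u (suc j))) a v ⟩
  slice a - slice (a ℤ.+ d)
    ≡⟨ cong₂ _-_ (reduce a) (reduce (a ℤ.+ d)) ⟩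
  c * ⟦ differences d m ⟧ (g ∘ (a ∷_)) v₁ - c * ⟦ differences d m ⟧ (g ∘ (a ℤ.+ d ∷_)) v₁
    ≡⟨ factor c (⟦ differences d m ⟧ (g ∘ (a ∷_)) v₁) (⟦ differences d m ⟧ (g ∘ (a ℤ.+ d ∷_)) v₁) ⟩
  c * (⟦ differences d m ⟧ (g ∘ (a ∷_)) v₁ - ⟦ differences d m ⟧ (g ∘ (a ℤ.+ d ∷_)) v₁)
    ≡⟨ cong (c *_) (sym (differences-slice d m g a v₁)) ⟩
  c * ⟦ differences d (suc m) ⟧ g (a ∷ v₁)
    ≡⟨ cong (λ u → c * ⟦ differences d (suc m) ⟧ g u) (sym (removeAt-∷ a v j)) ⟩
  c * ⟦ differences d (suc m) ⟧ g (removeAt (a ∷ v) (suc j))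
    ∎
  where
  c : ℚ
  c = φ (lookup v j) - φ (lookup v j ℤ.+ d)
  v₁ : Vec ℤ m
  v₁ = removeAt v j
  slice : ℤ → ℚ
  slice b = ⟦ differences d (suc m) ⟧ (λ u → φ (lookup u j) * g (removeAt (b ∷ u) (suc j))) v
  reduce : ∀ b → slice b ≡ c * ⟦ differences d m ⟧ (g ∘ (b ∷_)) v₁
  reduce b = trans (⟦⟧-cong (differences d (suc m)) (λ u → cong (λ w → φ (lookup u j) * g w) (removeAt-∷ b u j)) v)
                   (differences-minor d m φ (g ∘ (b ∷_)) j v)
  factor : ∀ c a b → c * a - c * b ≡ c * (a - b)
  factor = solve-∀ ℚ-ring

differences-det : ∀ d m (φ : ℕ → ℤ → ℚ) v →
  ⟦ differences d m ⟧ (det φ) v ≡ det (λ j a → φ j a - φ j (a ℤ.+ d)) v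
differences-det d zero    φ v = refl
differences-det d (suc m) φ v =
  trans (⟦⟧-altSum (differences d (suc m)) (λ j u → φ 0 (lookup u j) * det (φ ∘ suc) (removeAt u j)) v)
        (altSum-cong λ j → trans (differences-minor d m (φ 0) (det (φ ∘ suc)) j v)
          (cong ((φ 0 (lookup v j) - φ 0 (lookup v j ℤ.+ d)) *_) (differences-det d m (φ ∘ suc) (removeAt v j))))

-- Integer intervals and rows between given bounds.

range : ℤ → ℕ → List ℤ
range b zero    = []
range b (suc n) = b ∷ range (b ℤ.+ 1ℤ) n

rangeTo : ℤ → ℤ → List ℤ
rangeTo b (+ n)      = range b (suc n)
rangeTo b ℤ.-[1+ _ ] = []

interval : ℤ → ℤ → List ℤ
interval b u = rangeTo b (u ℤ.- b)

i+j-i≡j : ∀ i j → i ℤ.+ j ℤ.- i ≡ j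
i+j-i≡j = ℤ-solve-∀

interval-+ : ∀ b n → interval b (b ℤ.+ + n) ≡ range b (suc n)
interval-+ b n rewrite i+j-i≡j b (+ n) = refl

interval-pred : ∀ b → interval b (b ℤ.+ -1ℤ) ≡ []
interval-pred b rewrite i+j-i≡j b -1ℤ = refl

≤⇒∃+ : ∀ {b u} → b ℤ.≤ u → Σ ℕ λ n → u ≡ b ℤ.+ + n
≤⇒∃+ {b} {u} b≤u = ℤ.∣ u ℤ.- b ∣ ,
  trans (restore b u) (cong (λ d → b ℤ.+ d) (sym (ℤ.0≤i⇒+∣i∣≡i (ℤ.i≤j⇒0≤j-i b≤u))))
  where
  restore : ∀ b u → u ≡ b ℤ.+ (u ℤ.- b)
  restore = ℤ-solve-∀

∈-range⁻ : ∀ {l} b n → l ∈ range b n → Σ ℕ λ i → i ℕ.< n × l ≡ b ℤ.+ + i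
∈-range⁻ b (suc n) (here l≡b) = 0 , ℕ.z<s , trans l≡b (sym (ℤ.+-identityʳ b))
∈-range⁻ b (suc n) (there l∈) with ∈-range⁻ (b ℤ.+ 1ℤ) n l∈
... | i , i<n , l≡ = suc i , ℕ.s<s i<n , trans l≡ (ℤ.+-assoc b 1ℤ (+ i))

∈-range⁺ : ∀ b i n → i ℕ.< n → b ℤ.+ + i ∈ range b n
∈-range⁺ b zero    (suc n) _   = here (ℤ.+-identityʳ b)
∈-range⁺ b (suc i) (suc n) i<n =
  there (subst (_∈ range (b ℤ.+ 1ℤ) n) (ℤ.+-assoc b 1ℤ (+ i)) (∈-range⁺ (b ℤ.+ 1ℤ) i n (ℕ.s<s⁻¹ i<n)))

∈-interval⁻ : ∀ {b u l} → l ∈ interval b u → b ℤ.≤ l × l ℤ.≤ u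
∈-interval⁻ {b} {u} {l} l∈ with go (u ℤ.- b) l∈
  where
  go : ∀ d → l ∈ rangeTo b d → b ℤ.≤ l × l ℤ.≤ b ℤ.+ d
  go (+ n) l∈ with ∈-range⁻ b (suc n) l∈
  ... | i , i≤n , refl = ℤ.i≤i+j b (+ i) , ℤ.+-monoʳ-≤ b (ℤ.+≤+ (ℕ.s≤s⁻¹ i≤n))
... | b≤l , l≤ = b≤l , subst (l ℤ.≤_) (restore b u) l≤
  where
  restore : ∀ b u → b ℤ.+ (u ℤ.- b) ≡ u
  restore = ℤ-solve-∀

∈-interval⁺ : ∀ {b u l} → b ℤ.≤ l → l ℤ.≤ u → l ∈ interval b u
∈-interval⁺ {b} b≤l l≤u with ≤⇒∃+ b≤l | ≤⇒∃+ l≤u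
... | i , refl | n , refl =
  subst (b ℤ.+ + i ∈_) (sym (trans (cong (interval b) (ℤ.+-assoc b (+ i) (+ n))) (interval-+ b (i ℕ.+ n))))
        (∈-range⁺ b i (suc (i ℕ.+ n)) (ℕ.s≤s (ℕ.m≤m+n i n)))

sumOver : List X → (X → ℚ) → ℚ
sumOver []       f = 0ℚ
sumOver (a ∷ as) f = f a + sumOver as f

sumOver-cong : (as : List X) {f g : X → ℚ} → (∀ a → f a ≡ g a) → sumOver as f ≡ sumOver as g
sumOver-cong []       f≗g = refl
sumOver-cong (a ∷ as) f≗g = cong₂ _+_ (f≗g a) (sumOver-cong as f≗g)

sumOver-cong-∈ : (as : List X) {f g : X → ℚ} → (∀ {a} → a ∈ as → f a ≡ g a) → sumOver as f ≡ sumOver as g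
sumOver-cong-∈ []       f≗g = refl
sumOver-cong-∈ (a ∷ as) f≗g = cong₂ _+_ (f≗g (here refl)) (sumOver-cong-∈ as (f≗g ∘ there))

sumOver-sub : (as : List X) (f g : X → ℚ) → sumOver as (λ a → f a - g a) ≡ sumOver as f - sumOver as g
sumOver-sub []       f g = refl
sumOver-sub (a ∷ as) f g = trans (cong (λ r → f a - g a + r) (sumOver-sub as f g)) (regroup (f a) (g a) _ _)
  where
  regroup : ∀ a b c d → a - b + (c - d) ≡ a + c - (b + d)
  regroup = solve-∀ ℚ-ring

-- The next entry has to exceed l, by strictness, and to be at least the entry u of the row below.
-- As l is at most u in the sums, the maximum differs from u only for l = u.
nextBound : ℤ → ℤ → ℤ
nextBound l u = (l ℤ.+ 1ℤ) ℤ.⊔ u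

-- A bottom row is read as the lower bound `b` of the first entry followed by the upper bounds `us`;
-- every upper bound enters the lower bound of the next entry. If the row above is as long as the
-- bottom row, x serves as the last upper bound.
interlacing : ℤ → Vec ℤ m → List (Vec ℤ m)
interlacing b []       = [] ∷ []
interlacing b (u ∷ us) = concatMap (λ l → List.map (l ∷_) (interlacing (nextBound l u) us)) (interval b u)

interlacingSum : ℤ → Vec ℤ m → (Vec ℤ m → ℚ) → ℚ
interlacingSum b []       f = f []
interlacingSum b (u ∷ us) f = sumOver (interval b u) (λ l → interlacingSum (nextBound l u) us (f ∘ (l ∷_)))

sumOver-++ : (as bs : List X) (f : X → ℚ) → sumOver (as ++ bs) f ≡ sumOver as f + sumOver bs f
sumOver-++ []       bs f = sym (ℚ.+-identityˡ _)
sumOver-++ (a ∷ as) bs f = trans (cong (λ r → f a + r) (sumOver-++ as bs f)) (sym (ℚ.+-assoc (f a) _ _))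

sumOver-concatMap : {Y : Set} (h : Y → List X) (as : List Y) (f : X → ℚ) →
                    sumOver (concatMap h as) f ≡ sumOver as (λ a → sumOver (h a) f)
sumOver-concatMap h []       f = refl
sumOver-concatMap h (a ∷ as) f =
  trans (sumOver-++ (h a) (concatMap h as) f) (cong (λ r → sumOver (h a) f + r) (sumOver-concatMap h as f))

sumOver-map : {Y : Set} (h : Y → X) (as : List Y) (f : X → ℚ) → sumOver (List.map h as) f ≡ sumOver as (f ∘ h)
sumOver-map h []       f = refl
sumOver-map h (a ∷ as) f = cong (λ r → f (h a) + r) (sumOver-map h as f)

sumOver-interlacing : ∀ b (us : Vec ℤ m) f → sumOver (interlacing b us) f ≡ interlacingSum b us f
sumOver-interlacing b []       f = ℚ.+-identityʳ (f [])
sumOver-interlacing b (u ∷ us) f =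
  trans (sumOver-concatMap _ (interval b u) f)
        (sumOver-cong (interval b u) λ l →
          trans (sumOver-map (l ∷_) (interlacing (nextBound l u) us) f)
                (sumOver-interlacing (nextBound l u) us (f ∘ (l ∷_))))

interlacingSum-cong : ∀ b (us : Vec ℤ m) {f g : Vec ℤ m → ℚ} → (∀ v → f v ≡ g v) →
                      interlacingSum b us f ≡ interlacingSum b us g
interlacingSum-cong b []       f≗g = f≗g []
interlacingSum-cong b (u ∷ us) f≗g =
  sumOver-cong (interval b u) (λ l → interlacingSum-cong (nextBound l u) us (f≗g ∘ (l ∷_)))

interlacingSum-sub : ∀ b (us : Vec ℤ m) (f g : Vec ℤ m → ℚ) →
  interlacingSum b us (λ v → f v - g v) ≡ interlacingSum b us f - interlacingSum b us g
interlacingSum-sub b []       f g = refl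
interlacingSum-sub b (u ∷ us) f g =
  trans (sumOver-cong (interval b u) (λ l → interlacingSum-sub (nextBound l u) us (f ∘ (l ∷_)) (g ∘ (l ∷_))))
        (sumOver-sub (interval b u) _ _)

-- Telescoping the interlacing sums.

interlacingSum-differences : ∀ d b u (us : Vec ℤ m) (g : Vec ℤ (suc m) → ℚ) →
  interlacingSum b (u ∷ us) (⟦ differences d (suc m) ⟧ g) ≡
  sumOver (interval b u) (λ l →
    interlacingSum (nextBound l u) us (⟦ differences d m ⟧ (g ∘ (l ∷_))) -
    interlacingSum (nextBound l u) us (⟦ differences d m ⟧ (g ∘ (l ℤ.+ d ∷_))))
interlacingSum-differences d b u us g = sumOver-cong (interval b u) λ l →
  trans (interlacingSum-cong (nextBound l u) us (differences-slice d _ g l))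
        (interlacingSum-sub (nextBound l u) us _ _)

telescope : ∀ (h : ℤ → ℚ) b n → sumOver (range b n) (λ l → h (l ℤ.+ 1ℤ) - h l) ≡ h (b ℤ.+ + n) - h b
telescope h b zero    = trans (sym (ℚ.+-inverseʳ (h b))) (cong (λ c → h c - h b) (sym (ℤ.+-identityʳ b)))
telescope h b (suc n) = begin
  h (b ℤ.+ 1ℤ) - h b + sumOver (range (b ℤ.+ 1ℤ) n) (λ l → h (l ℤ.+ 1ℤ) - h l)
    ≡⟨ cong (λ r → h (b ℤ.+ 1ℤ) - h b + r) (telescope h (b ℤ.+ 1ℤ) n) ⟩
  h (b ℤ.+ 1ℤ) - h b + (h (b ℤ.+ 1ℤ ℤ.+ + n) - h (b ℤ.+ 1ℤ))
    ≡⟨ cancel (h (b ℤ.+ 1ℤ)) (h b) (h (b ℤ.+ 1ℤ ℤ.+ + n)) ⟩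
  h (b ℤ.+ 1ℤ ℤ.+ + n) - h b
    ≡⟨ cong (λ c → h c - h b) (ℤ.+-assoc b 1ℤ (+ n)) ⟩
  h (b ℤ.+ + suc n) - h b
    ∎
  where
  cancel : ∀ p q r → p - q + (r - p) ≡ r - q
  cancel = solve-∀ ℚ-ring

-- The bound passed on to the next entry is u until l reaches u itself.
telescope-nextBound : ∀ (h : ℤ → ℤ → ℚ) b u → b ℤ.≤ u →
  sumOver (interval b u) (λ l → h (nextBound l u) (l ℤ.+ 1ℤ) - h (nextBound l u) l) ≡
  h u u - h u b + (h (u ℤ.+ 1ℤ) (u ℤ.+ 1ℤ) - h (u ℤ.+ 1ℤ) u)
telescope-nextBound h b u b≤u with ≤⇒∃+ b≤u
... | n , refl = trans (cong (λ as → sumOver as term) (interval-+ b n)) (go b n refl)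
  where
  term : ℤ → ℚ
  term l = h (nextBound l u) (l ℤ.+ 1ℤ) - h (nextBound l u) l
  go : ∀ c n → c ℤ.+ + n ≡ u →
       sumOver (range c (suc n)) term ≡ h u u - h u c + (h (u ℤ.+ 1ℤ) (u ℤ.+ 1ℤ) - h (u ℤ.+ 1ℤ) u)
  go c zero    c+0≡u with trans (sym c+0≡u) (ℤ.+-identityʳ c)
  ... | refl = begin
    term u + 0ℚ
      ≡⟨ cong (λ e → h e (u ℤ.+ 1ℤ) - h e u + 0ℚ) (ℤ.i≥j⇒i⊔j≡i (ℤ.i≤i+j u 1ℤ)) ⟩
    h (u ℤ.+ 1ℤ) (u ℤ.+ 1ℤ) - h (u ℤ.+ 1ℤ) u + 0ℚ
      ≡⟨ pad (h u u) (h (u ℤ.+ 1ℤ) (u ℤ.+ 1ℤ) - h (u ℤ.+ 1ℤ) u) ⟩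
    h u u - h u u + (h (u ℤ.+ 1ℤ) (u ℤ.+ 1ℤ) - h (u ℤ.+ 1ℤ) u)
      ∎
    where
    pad : ∀ p q → q + 0ℚ ≡ p - p + q
    pad = solve-∀ ℚ-ring
  go c (suc n) c+1+n≡u = begin
    term c + sumOver (range (c ℤ.+ 1ℤ) (suc n)) term
      ≡⟨ cong₂ _+_ (cong (λ e → h e (c ℤ.+ 1ℤ) - h e c) (ℤ.i≤j⇒i⊔j≡j c+1≤u))
                   (go (c ℤ.+ 1ℤ) n c+1+n) ⟩
    h u (c ℤ.+ 1ℤ) - h u c + (h u u - h u (c ℤ.+ 1ℤ) + (h (u ℤ.+ 1ℤ) (u ℤ.+ 1ℤ) - h (u ℤ.+ 1ℤ) u))
      ≡⟨ cancel (h u (c ℤ.+ 1ℤ)) (h u c) (h u u) _ ⟩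
    h u u - h u c + (h (u ℤ.+ 1ℤ) (u ℤ.+ 1ℤ) - h (u ℤ.+ 1ℤ) u)
      ∎
    where
    c+1+n : c ℤ.+ 1ℤ ℤ.+ + n ≡ u
    c+1+n = trans (ℤ.+-assoc c 1ℤ (+ n)) c+1+n≡u
    c+1≤u : c ℤ.+ 1ℤ ℤ.≤ u
    c+1≤u = subst (c ℤ.+ 1ℤ ℤ.≤_) c+1+n (ℤ.i≤i+j (c ℤ.+ 1ℤ) (+ n))
    cancel : ∀ p q r s → p - q + (r - p + s) ≡ r - q + s
    cancel = solve-∀ ℚ-ring

-- Strictness is written as u + 1 bounding the next entry from below, to match the lower bounds
-- handed down in `interlacing`.
Ascending : ℤ → Vec ℤ m → Set
Ascending b []       = ⊤
Ascending b (u ∷ us) = b ℤ.≤ u × Ascending (u ℤ.+ 1ℤ) us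

ascending-pred : ∀ {b} (us : Vec ℤ m) → Ascending (b ℤ.+ 1ℤ) us → Ascending b us
ascending-pred []       _               = _
ascending-pred (u ∷ us) (b+1≤u , asc)   = ℤ.≤-trans (ℤ.i≤i+j _ 1ℤ) b+1≤u , asc

ascending-nextBound : ∀ {u} l (us : Vec ℤ m) → l ℤ.≤ u → Ascending (u ℤ.+ 1ℤ) us → Ascending (nextBound l u) us
ascending-nextBound l []       l≤u _               = _
ascending-nextBound {u = u} l (w ∷ us) l≤u (u+1≤w , asc) =
  ℤ.⊔-lub (ℤ.≤-trans (ℤ.+-monoˡ-≤ 1ℤ l≤u) u+1≤w) (ℤ.≤-trans (ℤ.i≤i+j u 1ℤ) u+1≤w) , asc

-- A telescoped entry is either at its upper bound or, with a minus sign, one below its lower bound.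
-- The choices that survive have lower bounds before position j and upper bounds from j on, which
-- omits exactly the bound j and gives the sign (-1)^j.
omissionSum : (Vec ℤ m → ℚ) → Vec ℤ (suc m) → ℚ
omissionSum g v = altSum (λ j → g (removeAt v j ⊹ below j))

omissionSum-∷ : ∀ (g : Vec ℤ (suc m) → ℚ) b v →
                omissionSum g (b ∷ v) ≡ g (v ⊹ 0s) - omissionSum (g ∘ (b ℤ.+ -1ℤ ∷_)) v
omissionSum-∷ g b (_ ∷ v) = refl


-- The terms omitting the first bound of each of the three sums cancel down to g (u ∷ us). The terms
-- omitting a later bound start with (u - 1, u - 1), (u, u) and (u - 1, u), the combination that
-- contractibility kills.
omissionSum-contract : ∀ (g : Vec ℤ (suc m) → ℚ) → Contractible g → ∀ u us →
  omissionSum (g ∘ (u ℤ.+ -1ℤ ∷_)) (u ∷ us) + omissionSum (g ∘ (u ∷_)) (u ℤ.+ 1ℤ ∷ us)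
    - omissionSum (g ∘ (u ℤ.+ -1ℤ ∷_)) (u ℤ.+ 1ℤ ∷ us) ≡ g (u ∷ us)
omissionSum-contract g _ u [] = cancel (g (u ℤ.+ -1ℤ ∷ [])) (g (u ∷ []))
  where
  cancel : ∀ a b → a - 0ℚ + (b - 0ℚ) - (a - 0ℚ) ≡ b
  cancel = solve-∀ ℚ-ring
omissionSum-contract {suc m} g (contract , _) u us@(_ ∷ _) = begin
  omissionSum (g ∘ (u⁻ ∷_)) (u ∷ us) + omissionSum (g ∘ (u ∷_)) (u ℤ.+ 1ℤ ∷ us)
    - omissionSum (g ∘ (u⁻ ∷_)) (u ℤ.+ 1ℤ ∷ us)
    ≡⟨ cong (λ c → g (u⁻ ∷ us ⊹ 0s) - omissionSum (λ v → g (u⁻ ∷ u⁻ ∷ v)) us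
                 + (g (u ∷ us ⊹ 0s) - omissionSum (λ v → g (u ∷ c ∷ v)) us)
                 - (g (u⁻ ∷ us ⊹ 0s) - omissionSum (λ v → g (u⁻ ∷ c ∷ v)) us)) (restore u) ⟩
  g (u⁻ ∷ us ⊹ 0s) - s u⁻ u⁻ + (g (u ∷ us ⊹ 0s) - s u u) - (g (u⁻ ∷ us ⊹ 0s) - s u⁻ u)
    ≡⟨ regroup (g (u⁻ ∷ us ⊹ 0s)) (g (u ∷ us ⊹ 0s)) (s u⁻ u⁻) (s u u) (s u⁻ u) ⟩
  g (u ∷ us ⊹ 0s) - (s u⁻ u⁻ + s u u - s u⁻ u)
    ≡⟨ cong₂ _-_ (cong (λ v → g (u ∷ v)) (⊹-identityʳ us)) cancels ⟩
  g (u ∷ us) - 0ℚ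
    ≡⟨ ℚ.+-identityʳ (g (u ∷ us)) ⟩
  g (u ∷ us)
    ∎
  where
  u⁻ : ℤ
  u⁻ = u ℤ.+ -1ℤ
  restore : ∀ u → u ℤ.+ 1ℤ ℤ.+ -1ℤ ≡ u
  restore = ℤ-solve-∀
  t : ℤ → ℤ → Fin (suc m) → ℚ
  t a b j = g (a ∷ b ∷ removeAt us j ⊹ below j)
  s : ℤ → ℤ → ℚ
  s a b = omissionSum (λ v → g (a ∷ b ∷ v)) us
  regroup : ∀ p q r s t → p - r + (q - s) - (p - t) ≡ q - (r + s - t)
  regroup = solve-∀ ℚ-ring
  cancels : s u⁻ u⁻ + s u u - s u⁻ u ≡ 0ℚ
  cancels = begin
    altSum (t u⁻ u⁻) + altSum (t u u) - altSum (t u⁻ u)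
      ≡⟨ cong (_- altSum (t u⁻ u)) (sym (altSum-+ (t u⁻ u⁻) (t u u))) ⟩
    altSum (λ j → t u⁻ u⁻ j + t u u j) - altSum (t u⁻ u)
      ≡⟨ sym (altSum-sub (λ j → t u⁻ u⁻ j + t u u j) (t u⁻ u)) ⟩
    altSum (λ j → t u⁻ u⁻ j + t u u j - t u⁻ u j)
      ≡⟨ altSum-cong (λ j → contract u (removeAt us j ⊹ below j)) ⟩
    altSum {suc m} (const 0ℚ)
      ≡⟨ altSum-0 (suc m) ⟩
    0ℚ
      ∎

-- For a fixed first entry the inner sum is an omission sum starting at `nextBound l u`, and its
-- increments in the first entry telescope. The values around u collapse to the term that omits `b`;
-- the value at the lower end supplies all terms that keep `b`.
interlacingSum-omission : ∀ (g : Vec ℤ m → ℚ) → Contractible g → ∀ b us → Ascending b us →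
  interlacingSum b us (⟦ differences -1ℤ m ⟧ g) ≡ omissionSum g (b ∷ us)
interlacingSum-omission g _ b [] _ = sym (ℚ.+-identityʳ (g []))
interlacingSum-omission {suc m} g contr b (u ∷ us) (b≤u , asc) = begin
  interlacingSum b (u ∷ us) (⟦ differences -1ℤ (suc m) ⟧ g)
    ≡⟨ interlacingSum-differences -1ℤ b u us g ⟩
  sumOver (interval b u) (λ l →
    interlacingSum (nextBound l u) us (⟦ differences -1ℤ m ⟧ (g ∘ (l ∷_))) -
    interlacingSum (nextBound l u) us (⟦ differences -1ℤ m ⟧ (g ∘ (l ℤ.+ -1ℤ ∷_))))
    ≡⟨ sumOver-cong-∈ (interval b u) (λ {l} l∈ → cong₂ _-_
         (trans (step l∈ l) (cong (λ a → omissionSum (g ∘ (a ∷_)) (nextBound l u ∷ us)) (sym (restore l))))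
         (step l∈ (l ℤ.+ -1ℤ))) ⟩
  sumOver (interval b u) (λ l → h (nextBound l u) (l ℤ.+ 1ℤ) - h (nextBound l u) l)
    ≡⟨ telescope-nextBound h b u b≤u ⟩
  h u u - h u b + (h (u ℤ.+ 1ℤ) (u ℤ.+ 1ℤ) - h (u ℤ.+ 1ℤ) u)
    ≡⟨ regroup (h u u) (h u b) (h (u ℤ.+ 1ℤ) (u ℤ.+ 1ℤ)) (h (u ℤ.+ 1ℤ) u) ⟩
  h u u + h (u ℤ.+ 1ℤ) (u ℤ.+ 1ℤ) - h (u ℤ.+ 1ℤ) u - h u b
    ≡⟨ cong (_- h u b) (trans
         (cong (λ a → h u u + omissionSum (g ∘ (a ∷_)) (u ℤ.+ 1ℤ ∷ us) - h (u ℤ.+ 1ℤ) u) (restore u))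
         (omissionSum-contract g contr u us)) ⟩
  g (u ∷ us) - h u b
    ≡⟨ cong (λ v → g v - h u b) (sym (⊹-identityʳ (u ∷ us))) ⟩
  g ((u ∷ us) ⊹ 0s) - h u b
    ≡⟨ sym (omissionSum-∷ g b (u ∷ us)) ⟩
  omissionSum g (b ∷ u ∷ us)
    ∎
  where
  -- The argument is lowered by one, so that the backward difference at l reads h c (l + 1) - h c l.
  h : ℤ → ℤ → ℚ
  h c l = omissionSum (g ∘ (l ℤ.+ -1ℤ ∷_)) (c ∷ us)
  restore : ∀ l → l ℤ.+ 1ℤ ℤ.+ -1ℤ ≡ l
  restore = ℤ-solve-∀
  regroup : ∀ p q r s → p - q + (r - s) ≡ p + r - s - q
  regroup = solve-∀ ℚ-ring
  step : ∀ {l} → l ∈ interval b u → ∀ a →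
         interlacingSum (nextBound l u) us (⟦ differences -1ℤ m ⟧ (g ∘ (a ∷_))) ≡
         omissionSum (g ∘ (a ∷_)) (nextBound l u ∷ us)
  step {l} l∈ a = interlacingSum-omission (g ∘ (a ∷_)) (contractible-slice {g = g} contr a) (nextBound l u) us
    (ascending-nextBound l us (proj₂ (∈-interval⁻ l∈)) asc)

-- The empty case b = x + 1 does occur: this is the bound passed on when the preceding entry already
-- equals x.
telescope-interval : ∀ (h : ℤ → ℚ) b x → b ℤ.≤ x ℤ.+ 1ℤ →
  sumOver (interval b x) (λ l → h (l ℤ.+ 1ℤ) - h l) ≡ h (x ℤ.+ 1ℤ) - h b
telescope-interval h b x b≤x+1 with ≤⇒∃+ b≤x+1
... | n , x+1≡b+n = trans (cong (λ as → sumOver as (λ l → h (l ℤ.+ 1ℤ) - h l)) (interval≡range n x+1≡b+n))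
                   (trans (telescope h b n) (cong (λ c → h c - h b) (sym x+1≡b+n)))
  where
  pred-+ : ∀ x → x ≡ x ℤ.+ 1ℤ ℤ.+ -1ℤ
  pred-+ = ℤ-solve-∀
  interval≡range : ∀ n → x ℤ.+ 1ℤ ≡ b ℤ.+ + n → interval b x ≡ range b n
  interval≡range zero eq = trans (cong (interval b)
    (trans (pred-+ x) (cong (λ c → c ℤ.+ -1ℤ) (trans eq (ℤ.+-identityʳ b))))) (interval-pred b)
  interval≡range (suc n) eq = trans (cong (interval b)
    (trans (pred-+ x) (trans (cong (λ c → c ℤ.+ -1ℤ) eq) (ℤ.+-assoc b (+ suc n) -1ℤ)))) (interval-+ b n)

-- Only lower ends survive. The upper end of the last entry gives a value at x + 1, which vanishes;
-- for an earlier entry the values at u and u + 1 form the contraction at u + 1.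
interlacingSum-lower : ∀ x (g : Vec ℤ (suc m) → ℚ) → Contractible g → (∀ v → g (v Vec.∷ʳ (x ℤ.+ 1ℤ)) ≡ 0ℚ) →
  ∀ b us → Ascending b (us Vec.∷ʳ (x ℤ.+ 1ℤ)) →
  interlacingSum b (us Vec.∷ʳ x) (⟦ differences 1ℤ (suc m) ⟧ g) ≡ g (b ∷ us)
interlacingSum-lower x g _ vanishing b [] (b≤x+1 , _) = begin
  interlacingSum b (x ∷ []) (⟦ differences 1ℤ 1 ⟧ g)
    ≡⟨ interlacingSum-differences 1ℤ b x [] g ⟩
  sumOver (interval b x) (λ l → g (l ∷ []) - g (l ℤ.+ 1ℤ ∷ []))
    ≡⟨ sumOver-cong (interval b x) (λ l → flip (g (l ∷ [])) (g (l ℤ.+ 1ℤ ∷ []))) ⟩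
  sumOver (interval b x) (λ l → - g (l ℤ.+ 1ℤ ∷ []) - - g (l ∷ []))
    ≡⟨ telescope-interval (λ l → - g (l ∷ [])) b x b≤x+1 ⟩
  - g (x ℤ.+ 1ℤ ∷ []) - - g (b ∷ [])
    ≡⟨ cong (λ r → - r - - g (b ∷ [])) (vanishing []) ⟩
  - 0ℚ - - g (b ∷ [])
    ≡⟨ simplify (g (b ∷ [])) ⟩
  g (b ∷ [])
    ∎
  where
  flip : ∀ p q → p - q ≡ - q - - p
  flip = solve-∀ ℚ-ring
  simplify : ∀ p → - 0ℚ - - p ≡ p
  simplify = solve-∀ ℚ-ring
interlacingSum-lower {suc m} x g contr@(contract , _) vanishing b (u ∷ us) (b≤u , asc) = begin
  interlacingSum b (u ∷ us′) (⟦ differences 1ℤ (suc (suc m)) ⟧ g)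
    ≡⟨ interlacingSum-differences 1ℤ b u us′ g ⟩
  sumOver (interval b u) (λ l →
    interlacingSum (nextBound l u) us′ (⟦ differences 1ℤ (suc m) ⟧ (g ∘ (l ∷_))) -
    interlacingSum (nextBound l u) us′ (⟦ differences 1ℤ (suc m) ⟧ (g ∘ (l ℤ.+ 1ℤ ∷_))))
    ≡⟨ sumOver-cong-∈ (interval b u) (λ {l} l∈ →
         trans (cong₂ _-_ (step l∈ l) (step l∈ (l ℤ.+ 1ℤ)))
               (flip (g (l ∷ nextBound l u ∷ us)) (g (l ℤ.+ 1ℤ ∷ nextBound l u ∷ us)))) ⟩
  sumOver (interval b u) (λ l → h (nextBound l u) (l ℤ.+ 1ℤ) - h (nextBound l u) l)
    ≡⟨ telescope-nextBound h b u b≤u ⟩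
  h u u - h u b + (h u⁺ u⁺ - h u⁺ u)
    ≡⟨ regroup (g (u ∷ u ∷ us)) (g (b ∷ u ∷ us)) (g (u⁺ ∷ u⁺ ∷ us)) (g (u ∷ u⁺ ∷ us)) ⟩
  g (b ∷ u ∷ us) - (g (u ∷ u ∷ us) + g (u⁺ ∷ u⁺ ∷ us) - g (u ∷ u⁺ ∷ us))
    ≡⟨ cong (λ r → g (b ∷ u ∷ us) - r)
            (subst (λ c → g (c ∷ c ∷ us) + g (u⁺ ∷ u⁺ ∷ us) - g (c ∷ u⁺ ∷ us) ≡ 0ℚ) (restore u) (contract u⁺ us)) ⟩
  g (b ∷ u ∷ us) - 0ℚ
    ≡⟨ ℚ.+-identityʳ (g (b ∷ u ∷ us)) ⟩
  g (b ∷ u ∷ us)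
    ∎
  where
  u⁺ : ℤ
  u⁺ = u ℤ.+ 1ℤ
  us′ : Vec ℤ (suc m)
  us′ = us Vec.∷ʳ x
  -- The sign turns g(l) - g(l + 1) into an increment of h, the form that `telescope-nextBound`
  -- sums.
  h : ℤ → ℤ → ℚ
  h c l = - g (l ∷ c ∷ us)
  restore : ∀ u → u ℤ.+ 1ℤ ℤ.+ -1ℤ ≡ u
  restore = ℤ-solve-∀
  flip : ∀ p q → p - q ≡ - q - - p
  flip = solve-∀ ℚ-ring
  regroup : ∀ p q r s → - p - - q + (- r - - s) ≡ q - (p + r - s)
  regroup = solve-∀ ℚ-ring
  step : ∀ {l} → l ∈ interval b u → ∀ a →
         interlacingSum (nextBound l u) us′ (⟦ differences 1ℤ (suc m) ⟧ (g ∘ (a ∷_))) ≡ g (a ∷ nextBound l u ∷ us)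
  step {l} l∈ a = interlacingSum-lower x (g ∘ (a ∷_)) (contractible-slice {g = g} contr a) (vanishing ∘ (a ∷_))
    (nextBound l u) us (ascending-nextBound l (us Vec.∷ʳ (x ℤ.+ 1ℤ)) (proj₂ (∈-interval⁻ l∈)) asc)

-- The two families of columns

fromℤ : ℤ → ℚ
fromℤ i = i ℚ./ 1

/-*-/ : ∀ i j a b → (i ℚ./ suc a) * (j ℚ./ suc b) ≡ (i ℤ.* j) ℚ./ (suc a ℕ.* suc b)
/-*-/ i j a b = ℚ.toℚᵘ-injective (begin-≃
  ℚ.toℚᵘ ((i ℚ./ suc a) * (j ℚ./ suc b))
    ≈⟨ ℚ.toℚᵘ-homo-* (i ℚ./ suc a) (j ℚ./ suc b) ⟩
  ℚ.toℚᵘ (i ℚ./ suc a) ℚᵘ.* ℚ.toℚᵘ (j ℚ./ suc b)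
    ≈⟨ ℚᵘ.*-cong (ℚ.toℚᵘ-fromℚᵘ (ℚᵘ.mkℚᵘ i a)) (ℚ.toℚᵘ-fromℚᵘ (ℚᵘ.mkℚᵘ j b)) ⟩
  ℚᵘ.mkℚᵘ i a ℚᵘ.* ℚᵘ.mkℚᵘ j b
    ≈⟨ ℚᵘ.≃-sym (ℚ.toℚᵘ-fromℚᵘ (ℚᵘ.mkℚᵘ (i ℤ.* j) (b ℕ.+ a ℕ.* suc b))) ⟩
  ℚ.toℚᵘ ((i ℤ.* j) ℚ./ (suc a ℕ.* suc b)) ∎≃)
  where open ℚᵘ.≃-Reasoning renaming (begin_ to begin-≃_; _∎ to _∎≃)

fromℤ-+ : ∀ i j → fromℤ (i ℤ.+ j) ≡ fromℤ i + fromℤ j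
fromℤ-+ i j = ℚ.toℚᵘ-injective (begin-≃
  ℚ.toℚᵘ (fromℤ (i ℤ.+ j))
    ≈⟨ ℚ.toℚᵘ-fromℚᵘ (ℚᵘ.mkℚᵘ (i ℤ.+ j) 0) ⟩
  ℚᵘ.mkℚᵘ (i ℤ.+ j) 0
    ≈⟨ ℚᵘ.≃-reflexive (cong₂ (λ a b → ℚᵘ.mkℚᵘ (a ℤ.+ b) 0) (sym (ℤ.*-identityʳ i)) (sym (ℤ.*-identityʳ j))) ⟩
  ℚᵘ.mkℚᵘ i 0 ℚᵘ.+ ℚᵘ.mkℚᵘ j 0
    ≈⟨ ℚᵘ.≃-sym (ℚᵘ.+-cong (ℚ.toℚᵘ-fromℚᵘ (ℚᵘ.mkℚᵘ i 0)) (ℚ.toℚᵘ-fromℚᵘ (ℚᵘ.mkℚᵘ j 0))) ⟩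
  ℚ.toℚᵘ (fromℤ i) ℚᵘ.+ ℚ.toℚᵘ (fromℤ j)
    ≈⟨ ℚᵘ.≃-sym (ℚ.toℚᵘ-homo-+ (fromℤ i) (fromℤ j)) ⟩
  ℚ.toℚᵘ (fromℤ i + fromℤ j) ∎≃)
  where open ℚᵘ.≃-Reasoning renaming (begin_ to begin-≃_; _∎ to _∎≃)

fromℤ-* : ∀ i j → fromℤ (i ℤ.* j) ≡ fromℤ i * fromℤ j
fromℤ-* i j = sym (/-*-/ i j 0 0)

fromℤ-neg : ∀ i → fromℤ (ℤ.- i) ≡ - fromℤ i
fromℤ-neg i = begin
  fromℤ (ℤ.- i)                          ≡⟨ isolate (fromℤ i) (fromℤ (ℤ.- i)) ⟩
  fromℤ i + fromℤ (ℤ.- i) - fromℤ i      ≡⟨ cong (_- fromℤ i) (sym (fromℤ-+ i (ℤ.- i))) ⟩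
  fromℤ (i ℤ.- i) - fromℤ i              ≡⟨ cong (λ j → fromℤ j - fromℤ i) (ℤ.+-inverseʳ i) ⟩
  0ℚ - fromℤ i                           ≡⟨ ℚ.+-identityˡ (- fromℤ i) ⟩
  - fromℤ i                              ∎
  where
  isolate : ∀ a b → b ≡ a + b - a
  isolate = solve-∀ ℚ-ring

fromℤ-sub : ∀ i j → fromℤ (i ℤ.- j) ≡ fromℤ i - fromℤ j
fromℤ-sub i j = trans (fromℤ-+ i (ℤ.- j)) (cong (λ r → fromℤ i + r) (fromℤ-neg j))

fromℕ : ℕ → ℚ
fromℕ n = fromℤ (+ n)

fromℕ-suc : ∀ n → fromℕ (suc n) ≡ 1ℚ + fromℕ n
fromℕ-suc n = fromℤ-+ 1ℤ (+ n)

recip : ℕ → ℚ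
recip d = 1ℤ /′ d

recip-* : ∀ a b → recip (a ℕ.* b) ≡ recip a * recip b
recip-* zero    b       = sym (ℚ.*-zeroˡ (recip b))
recip-* (suc a) zero    = trans (cong recip (ℕ.*-zeroʳ a)) (sym (ℚ.*-zeroʳ (recip (suc a))))
recip-* (suc a) (suc b) = sym (/-*-/ 1ℤ 1ℤ a b)

/′-recip : ∀ i d → i /′ d ≡ fromℤ i * recip d
/′-recip i zero    = sym (ℚ.*-zeroʳ (fromℤ i))
/′-recip i (suc d) = trans (cong₂ (λ j c → j ℚ./ suc c) (sym (ℤ.*-identityʳ i)) (sym (ℕ.+-identityʳ d)))
                           (sym (/-*-/ i 1ℤ 0 d))

fromℕ*recip : ∀ d → fromℕ (suc d) * recip (suc d) ≡ 1ℚ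
fromℕ*recip d = trans (sym (/′-recip (+ suc d) (suc d)))
  (ℚ.fromℚᵘ-cong {ℚᵘ.mkℚᵘ (+ suc d) d} {ℚᵘ.mkℚᵘ 1ℤ 0} (ℚᵘ.*≡* (ℤ.*-comm (+ suc d) 1ℤ)))

double : ℕ → ℕ
double zero    = zero
double (suc j) = suc (suc (double j))

fromℕ-double : ∀ j → fromℕ (double j) ≡ fromℕ j + fromℕ j
fromℕ-double zero    = refl
fromℕ-double (suc j) = begin
  fromℕ (double (suc j))
    ≡⟨ trans (fromℕ-suc (suc (double j))) (cong (λ r → 1ℚ + r) (fromℕ-suc (double j))) ⟩
  1ℚ + (1ℚ + fromℕ (double j))
    ≡⟨ cong (λ r → 1ℚ + (1ℚ + r)) (fromℕ-double j) ⟩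
  1ℚ + (1ℚ + (fromℕ j + fromℕ j))
    ≡⟨ regroup 1ℚ (fromℕ j) ⟩
  (1ℚ + fromℕ j) + (1ℚ + fromℕ j)
    ≡⟨ sym (cong₂ _+_ (fromℕ-suc j) (fromℕ-suc j)) ⟩
  fromℕ (suc j) + fromℕ (suc j)
    ∎
  where
  regroup : ∀ a b → a + (a + (b + b)) ≡ (a + b) + (a + b)
  regroup = solve-∀ ℚ-ring

-- Chosen so that -a(a + 1) - evenNode j = -(a - j)(a + j + 1) and -z² - oddNode j = -(z - j - 1)(z
-- + j + 1): each Newton factor extends a falling factorial by one step at both ends.
evenNode oddNode : ℕ → ℚ
evenNode j = - (fromℕ j * (1ℚ + fromℕ j))
oddNode  j = - ((1ℚ + fromℕ j) * (1ℚ + fromℕ j))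

-- Up to the sign (-1)^j these are the falling factorials (a + j) ⋯ (a - j + 1) and (z + j) ⋯ (z - j),
-- of lengths 2 j and 2 j + 1.
evenPoly oddPoly : ℕ → ℚ → ℚ
evenPoly j a = newton evenNode j (- (a * (1ℚ + a)))
oddPoly  j z = z * newton oddNode j (- (z * z))

evenPoly-suc : ∀ j a → evenPoly (suc j) a ≡
  evenPoly j a * (- (a * (1ℚ + a)) - (- (fromℕ j * (1ℚ + fromℕ j))))
evenPoly-suc j a = newton-last evenNode j (- (a * (1ℚ + a)))

oddPoly-suc : ∀ j z → oddPoly (suc j) z ≡
  oddPoly j z * (- (z * z) - (- ((1ℚ + fromℕ j) * (1ℚ + fromℕ j))))
oddPoly-suc j z = trans (cong (z *_) (newton-last oddNode j (- (z * z)))) (sym (ℚ.*-assoc z _ _))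

-- As falling factorials, `oddPoly j` at a extends `evenPoly j a` by the factor a - j at the lower
-- end, and at 1 + a by the factor 1 + a + j at the upper end (`oddPoly-1+`). These two factors
-- differ by 2 j + 1, the constant of `oddPoly-difference`.
oddPoly-evenPoly : ∀ j a → oddPoly j a ≡ (a - fromℕ j) * evenPoly j a
oddPoly-evenPoly zero    a = cong (_* 1ℚ) (sym (ℚ.+-identityʳ a))
oddPoly-evenPoly (suc j) a = begin
  oddPoly (suc j) a
    ≡⟨ oddPoly-suc j a ⟩
  oddPoly j a * (- (a * a) - (- ((1ℚ + fromℕ j) * (1ℚ + fromℕ j))))
    ≡⟨ cong (_* (- (a * a) - (- ((1ℚ + fromℕ j) * (1ℚ + fromℕ j))))) (oddPoly-evenPoly j a) ⟩
  (a - fromℕ j) * evenPoly j a * (- (a * a) - (- ((1ℚ + fromℕ j) * (1ℚ + fromℕ j))))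
    ≡⟨ identity a (fromℕ j) (evenPoly j a) ⟩
  (a - (1ℚ + fromℕ j)) * (evenPoly j a * (- (a * (1ℚ + a)) - (- (fromℕ j * (1ℚ + fromℕ j)))))
    ≡⟨ sym (cong₂ (λ r s → (a - r) * s) (fromℕ-suc j) (evenPoly-suc j a)) ⟩
  (a - fromℕ (suc j)) * evenPoly (suc j) a
    ∎
  where
  identity : ∀ a r p → (a - r) * p * (- (a * a) - (- ((1ℚ + r) * (1ℚ + r)))) ≡
                       (a - (1ℚ + r)) * (p * (- (a * (1ℚ + a)) - (- (r * (1ℚ + r)))))
  identity = solve-∀ ℚ-ring

oddPoly-1+ : ∀ j a → oddPoly j (1ℚ + a) ≡ (1ℚ + a + fromℕ j) * evenPoly j a
oddPoly-1+ zero    a = cong (_* 1ℚ) (sym (ℚ.+-identityʳ (1ℚ + a)))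
oddPoly-1+ (suc j) a = begin
  oddPoly (suc j) (1ℚ + a)
    ≡⟨ oddPoly-suc j (1ℚ + a) ⟩
  oddPoly j (1ℚ + a) * (- ((1ℚ + a) * (1ℚ + a)) - (- ((1ℚ + fromℕ j) * (1ℚ + fromℕ j))))
    ≡⟨ cong (_* (- ((1ℚ + a) * (1ℚ + a)) - (- ((1ℚ + fromℕ j) * (1ℚ + fromℕ j))))) (oddPoly-1+ j a) ⟩
  (1ℚ + a + fromℕ j) * evenPoly j a * (- ((1ℚ + a) * (1ℚ + a)) - (- ((1ℚ + fromℕ j) * (1ℚ + fromℕ j))))
    ≡⟨ identity a (fromℕ j) (evenPoly j a) ⟩
  (1ℚ + a + (1ℚ + fromℕ j)) * (evenPoly j a * (- (a * (1ℚ + a)) - (- (fromℕ j * (1ℚ + fromℕ j)))))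
    ≡⟨ sym (cong₂ (λ r s → (1ℚ + a + r) * s) (fromℕ-suc j) (evenPoly-suc j a)) ⟩
  (1ℚ + a + fromℕ (suc j)) * evenPoly (suc j) a
    ∎
  where
  identity : ∀ a r p → (1ℚ + a + r) * p * (- ((1ℚ + a) * (1ℚ + a)) - (- ((1ℚ + r) * (1ℚ + r)))) ≡
                       (1ℚ + a + (1ℚ + r)) * (p * (- (a * (1ℚ + a)) - (- (r * (1ℚ + r)))))
  identity = solve-∀ ℚ-ring

oddPoly-difference : ∀ j a → oddPoly j (1ℚ + a) - oddPoly j a ≡ fromℕ (suc (double j)) * evenPoly j a
oddPoly-difference j a = begin
  oddPoly j (1ℚ + a) - oddPoly j a
    ≡⟨ cong₂ _-_ (oddPoly-1+ j a) (oddPoly-evenPoly j a) ⟩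
  (1ℚ + a + fromℕ j) * evenPoly j a - (a - fromℕ j) * evenPoly j a
    ≡⟨ identity a (fromℕ j) (evenPoly j a) ⟩
  (1ℚ + (fromℕ j + fromℕ j)) * evenPoly j a
    ≡⟨ cong (_* evenPoly j a) (sym (trans (fromℕ-suc (double j)) (cong (λ r → 1ℚ + r) (fromℕ-double j)))) ⟩
  fromℕ (suc (double j)) * evenPoly j a
    ∎
  where
  identity : ∀ a r p → (1ℚ + a + r) * p - (a - r) * p ≡ (1ℚ + (r + r)) * p
  identity = solve-∀ ℚ-ring

-- Up to sign, both terms on the left contain the falling factorial of `oddPoly j (1ℚ + a)`; the
-- remaining factors a - j and a + j + 2 differ by 2 j + 2.
evenPoly-difference : ∀ j a → evenPoly (suc j) a - evenPoly (suc j) (1ℚ + a) ≡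
                              fromℕ (double (suc j)) * oddPoly j (1ℚ + a)
evenPoly-difference j a = begin
  evenPoly (suc j) a - evenPoly (suc j) b
    ≡⟨ cong₂ _-_ (evenPoly-suc j a) (evenPoly-suc j b) ⟩
  p * (- (a * (1ℚ + a)) - (- (r * (1ℚ + r)))) - q * (- (b * (1ℚ + b)) - (- (r * (1ℚ + r))))
    ≡⟨ factor a r p q ⟩
  (1ℚ + b + r) * ((b - r) * q) - (a - r) * ((1ℚ + a + r) * p)
    ≡⟨ sym (cong₂ (λ s t → (1ℚ + b + r) * s - (a - r) * t) (oddPoly-evenPoly j b) (oddPoly-1+ j a)) ⟩
  (1ℚ + b + r) * oddPoly j b - (a - r) * oddPoly j b
    ≡⟨ collect a r (oddPoly j b) ⟩
  ((1ℚ + r) + (1ℚ + r)) * oddPoly j b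
    ≡⟨ cong (_* oddPoly j b) (sym (trans (fromℕ-double (suc j)) (cong₂ _+_ (fromℕ-suc j) (fromℕ-suc j)))) ⟩
  fromℕ (double (suc j)) * oddPoly j b
    ∎
  where
  b r p q : ℚ
  b = 1ℚ + a
  r = fromℕ j
  p = evenPoly j a
  q = evenPoly j b
  factor : ∀ a r p q →
    p * (- (a * (1ℚ + a)) - (- (r * (1ℚ + r)))) - q * (- ((1ℚ + a) * (1ℚ + (1ℚ + a))) - (- (r * (1ℚ + r)))) ≡
    (1ℚ + (1ℚ + a) + r) * ((1ℚ + a - r) * q) - (a - r) * ((1ℚ + a + r) * p)
  factor = solve-∀ ℚ-ring
  collect : ∀ a r t → (1ℚ + (1ℚ + a) + r) * t - (a - r) * t ≡ ((1ℚ + r) + (1ℚ + r)) * t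
  collect = solve-∀ ℚ-ring

oddPoly-neg : ∀ j z → oddPoly j (- z) ≡ - oddPoly j z
oddPoly-neg j z = trans (cong (λ y → - z * newton oddNode j (- y)) (square z))
                        (sym (ℚ.neg-distribˡ-* z (newton oddNode j (- (z * z)))))
  where
  square : ∀ z → - z * - z ≡ z * z
  square = solve-∀ ℚ-ring

-- Up to the sign (-1)^j these are the binomial coefficients of x - k + j over 2 j and of x + 1 - k
-- + j over 2 j + 1. Both difference relations between the families are Pascal's rule.
evenColumn oddColumn : ℤ → ℕ → ℤ → ℚ
evenColumn x j k = recip (double j !) * evenPoly j (fromℤ (x ℤ.- k))
oddColumn  x j k = recip (suc (double j) !) * oddPoly j (fromℤ (x ℤ.+ 1ℤ ℤ.- k))

recip-! : ∀ d → fromℕ (suc d) * recip (suc d !) ≡ recip (d !)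
recip-! d = begin
  fromℕ (suc d) * recip (suc d ℕ.* d !)               ≡⟨ cong (fromℕ (suc d) *_) (recip-* (suc d) (d !)) ⟩
  fromℕ (suc d) * (recip (suc d) * recip (d !))       ≡⟨ sym (ℚ.*-assoc (fromℕ (suc d)) _ _) ⟩
  fromℕ (suc d) * recip (suc d) * recip (d !)         ≡⟨ cong (_* recip (d !)) (fromℕ*recip d) ⟩
  1ℚ * recip (d !)                                    ≡⟨ ℚ.*-identityˡ (recip (d !)) ⟩
  recip (d !)                                         ∎

scaled-difference : ∀ d {p q r} → p - q ≡ fromℕ (suc d) * r →
                    recip (suc d !) * p - recip (suc d !) * q ≡ recip (d !) * r
scaled-difference d {p} {q} {r} p-q≡ = begin
  recip (suc d !) * p - recip (suc d !) * q     ≡⟨ factor (recip (suc d !)) p q ⟩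
  recip (suc d !) * (p - q)                     ≡⟨ cong (recip (suc d !) *_) p-q≡ ⟩
  recip (suc d !) * (fromℕ (suc d) * r)         ≡⟨ regroup (recip (suc d !)) (fromℕ (suc d)) r ⟩
  fromℕ (suc d) * recip (suc d !) * r           ≡⟨ cong (_* r) (recip-! d) ⟩
  recip (d !) * r                               ∎
  where
  factor : ∀ c a b → c * a - c * b ≡ c * (a - b)
  factor = solve-∀ ℚ-ring
  regroup : ∀ a b c → a * (b * c) ≡ b * a * c
  regroup = solve-∀ ℚ-ring

fromℤ-1+ : ∀ {i} j → i ≡ 1ℤ ℤ.+ j → fromℤ i ≡ 1ℚ + fromℤ j
fromℤ-1+ j refl = fromℤ-+ 1ℤ j

evenColumn-difference : ∀ x j k → evenColumn x (suc j) k - evenColumn x (suc j) (k ℤ.+ -1ℤ) ≡ oddColumn x j k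
evenColumn-difference x j k = trans
  (cong (λ a → evenColumn x (suc j) k - recip (double (suc j) !) * evenPoly (suc j) a) (fromℤ-1+ (x ℤ.- k) (shift x k)))
  (trans (scaled-difference (suc (double j)) (evenPoly-difference j (fromℤ (x ℤ.- k))))
         (cong (λ a → recip (suc (double j) !) * oddPoly j a) (sym (fromℤ-1+ (x ℤ.- k) (shift₁ x k)))))
  where
  shift : ∀ x k → x ℤ.- (k ℤ.+ -1ℤ) ≡ 1ℤ ℤ.+ (x ℤ.- k)
  shift = ℤ-solve-∀
  shift₁ : ∀ x k → x ℤ.+ 1ℤ ℤ.- k ≡ 1ℤ ℤ.+ (x ℤ.- k)
  shift₁ = ℤ-solve-∀

oddColumn-difference : ∀ x j k → oddColumn x j k - oddColumn x j (k ℤ.+ 1ℤ) ≡ evenColumn x j k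
oddColumn-difference x j k = trans
  (cong₂ (λ a b → recip (suc (double j) !) * oddPoly j a - recip (suc (double j) !) * oddPoly j b)
         (fromℤ-1+ (x ℤ.- k) (shift x k)) (cong fromℤ (shift₁ x k)))
  (scaled-difference (double j) (oddPoly-difference j (fromℤ (x ℤ.- k))))
  where
  shift : ∀ x k → x ℤ.+ 1ℤ ℤ.- k ≡ 1ℤ ℤ.+ (x ℤ.- k)
  shift = ℤ-solve-∀
  shift₁ : ∀ x k → x ℤ.+ 1ℤ ℤ.- (k ℤ.+ 1ℤ) ≡ x ℤ.- k
  shift₁ = ℤ-solve-∀

-- Twice the point x + 1 about which the odd columns are odd, so that k ↦ centre x - k is the
-- reflection there.
centre : ℤ → ℤ
centre x = x ℤ.+ 1ℤ ℤ.+ (x ℤ.+ 1ℤ)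

oddColumn-reflect : ∀ x j k → oddColumn x j (centre x ℤ.- k) ≡ - oddColumn x j k
oddColumn-reflect x j k = begin
  c * oddPoly j (fromℤ (x ℤ.+ 1ℤ ℤ.- (centre x ℤ.- k)))
    ≡⟨ cong (λ i → c * oddPoly j (fromℤ i)) (reflect x k) ⟩
  c * oddPoly j (fromℤ (ℤ.- (x ℤ.+ 1ℤ ℤ.- k)))
    ≡⟨ cong (λ a → c * oddPoly j a) (fromℤ-neg (x ℤ.+ 1ℤ ℤ.- k)) ⟩
  c * oddPoly j (- fromℤ (x ℤ.+ 1ℤ ℤ.- k))
    ≡⟨ cong (c *_) (oddPoly-neg j (fromℤ (x ℤ.+ 1ℤ ℤ.- k))) ⟩
  c * - oddPoly j (fromℤ (x ℤ.+ 1ℤ ℤ.- k))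
    ≡⟨ sym (ℚ.neg-distribʳ-* c _) ⟩
  - oddColumn x j k
    ∎
  where
  c : ℚ
  c = recip (suc (double j) !)
  reflect : ∀ x k → x ℤ.+ 1ℤ ℤ.- (x ℤ.+ 1ℤ ℤ.+ (x ℤ.+ 1ℤ) ℤ.- k) ≡ ℤ.- (x ℤ.+ 1ℤ ℤ.- k)
  reflect = ℤ-solve-∀

oddInLast-slice : {c : ℤ} {g : Vec ℤ (suc m) → ℚ} → OddInLast c g → ∀ a → OddInLast c (g ∘ (a ∷_))
oddInLast-slice {zero}  odd a = _
oddInLast-slice {suc m} odd a (b ∷ v) = odd (a ∷ b ∷ v)

-- The last variable occurs in each term exactly once, either in `φ` or in the minor, and both are
-- odd in it.
laplace-oddInLast : ∀ c (φ : ℤ → ℚ) → (∀ a → φ (c ℤ.- a) ≡ - φ a) →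
                    (g : Vec ℤ m → ℚ) → OddInLast c g → OddInLast c (laplace φ g)
laplace-oddInLast c φ φ-odd g odd (a ∷ []) =
  trans (cong (λ p → p * g [] - 0ℚ) (φ-odd a)) (regroup (φ a) (g []))
  where
  regroup : ∀ p q → - p * q - 0ℚ ≡ - (p * q - 0ℚ)
  regroup = solve-∀ ℚ-ring
laplace-oddInLast c φ φ-odd g odd (a ∷ v@(_ ∷ _)) = begin
  laplace φ g (a ∷ reflectLast c v)
    ≡⟨ laplace-∷ φ g a (reflectLast c v) ⟩
  φ a * g (reflectLast c v) - laplace φ (g ∘ (a ∷_)) (reflectLast c v)
    ≡⟨ cong₂ (λ s t → φ a * s - t) (odd v)
             (laplace-oddInLast c φ φ-odd (g ∘ (a ∷_)) (oddInLast-slice {g = g} odd a) v) ⟩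
  φ a * - g v - - laplace φ (g ∘ (a ∷_)) v
    ≡⟨ regroup (φ a) (g v) (laplace φ (g ∘ (a ∷_)) v) ⟩
  - (φ a * g v - laplace φ (g ∘ (a ∷_)) v)
    ≡⟨ cong -_ (sym (laplace-∷ φ g a v)) ⟩
  - laplace φ g (a ∷ v)
    ∎
  where
  regroup : ∀ p q r → p * - q - - r ≡ - (p * q - r)
  regroup = solve-∀ ℚ-ring

det-oddInLast : ∀ m c (φ : ℕ → ℤ → ℚ) → (∀ j a → φ j (c ℤ.- a) ≡ - φ j a) → OddInLast c (det {m = m} φ)
det-oddInLast zero    c φ φ-odd = _
det-oddInLast (suc m) c φ φ-odd =
  laplace-oddInLast c (φ 0) (φ-odd 0) (det (φ ∘ suc)) (det-oddInLast m c (φ ∘ suc) (φ-odd ∘ suc))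

oddInLast⇒vanishing : ∀ x (g : Vec ℤ (suc m) → ℚ) → OddInLast (centre x) g → ∀ v → g (v Vec.∷ʳ (x ℤ.+ 1ℤ)) ≡ 0ℚ
oddInLast⇒vanishing x g odd v = ≡-neg⇒≡0 _ (trans (cong g (sym (fixed v))) (odd (v Vec.∷ʳ (x ℤ.+ 1ℤ))))
  where
  fixed : ∀ {m} (v : Vec ℤ m) → reflectLast (centre x) (v Vec.∷ʳ (x ℤ.+ 1ℤ)) ≡ v Vec.∷ʳ (x ℤ.+ 1ℤ)
  fixed []          = cong (_∷ []) (i+j-i≡j (x ℤ.+ 1ℤ) (x ℤ.+ 1ℤ))
  fixed (a ∷ [])    = cong (a ∷_) (fixed [])
  fixed (a ∷ b ∷ v) = cong (a ∷_) (fixed (b ∷ v))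

-- The recursion in the number of rows.

interlacingSum-odd : ∀ x b (us : Vec ℤ m) → Ascending b us →
  interlacingSum b us (⟦ 𝒱 m ⟧ (det (oddColumn x))) ≡ ⟦ 𝒱 (suc m) ⟧ (det (evenColumn x)) (b ∷ us)
interlacingSum-odd {m} x b us asc = begin
  interlacingSum b us (⟦ 𝒱 m ⟧ (det (oddColumn x)))
    ≡⟨ interlacingSum-cong b us (⟦⟧-cong (𝒱 m) (λ v → sym (trans
         (differences-det -1ℤ m (evenColumn x ∘ suc) v) (det-cong (evenColumn-difference x) v)))) ⟩
  interlacingSum b us (⟦ 𝒱 m ⟧ (⟦ differences -1ℤ m ⟧ minor))
    ≡⟨ interlacingSum-cong b us (⟦≈⟧ (⊡-comm (𝒱 m) (differences -1ℤ m)) minor) ⟩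
  interlacingSum b us (⟦ differences -1ℤ m ⟧ (⟦ 𝒱 m ⟧ minor))
    ≡⟨ interlacingSum-omission (⟦ 𝒱 m ⟧ minor) (𝒱-contractible minor (det-antisym (evenColumn x ∘ suc))) b us asc ⟩
  omissionSum (⟦ 𝒱 m ⟧ minor) (b ∷ us)
    ≡⟨ sym (𝒱-laplace minor (b ∷ us)) ⟩
  ⟦ 𝒱 (suc m) ⟧ (λ u → altSum (λ j → minor (removeAt u j))) (b ∷ us)
    ≡⟨ ⟦⟧-cong (𝒱 (suc m)) (λ u → altSum-cong (λ j → sym (ℚ.*-identityˡ (minor (removeAt u j))))) (b ∷ us) ⟩
  ⟦ 𝒱 (suc m) ⟧ (det (evenColumn x)) (b ∷ us)
    ∎
  where
  -- This determinant has two roles: its backward differences give the determinant of the odd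
  -- columns, and it is the minor of `det (evenColumn x)` along the first column, which is
  -- constantly 1.
  minor : Vec ℤ m → ℚ
  minor = det (evenColumn x ∘ suc)

interlacingSum-even : ∀ x b (us : Vec ℤ m) → Ascending b (us Vec.∷ʳ (x ℤ.+ 1ℤ)) →
  interlacingSum b (us Vec.∷ʳ x) (⟦ 𝒱 (suc m) ⟧ (det (evenColumn x))) ≡ ⟦ 𝒱 (suc m) ⟧ (det (oddColumn x)) (b ∷ us)
interlacingSum-even {m} x b us asc = begin
  interlacingSum b us′ (⟦ 𝒱 (suc m) ⟧ (det (evenColumn x)))
    ≡⟨ interlacingSum-cong b us′ (⟦⟧-cong (𝒱 (suc m)) (λ v → sym (trans
         (differences-det 1ℤ (suc m) (oddColumn x) v) (det-cong (oddColumn-difference x) v)))) ⟩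
  interlacingSum b us′ (⟦ 𝒱 (suc m) ⟧ (⟦ differences 1ℤ (suc m) ⟧ (det (oddColumn x))))
    ≡⟨ interlacingSum-cong b us′ (⟦≈⟧ (⊡-comm (𝒱 (suc m)) (differences 1ℤ (suc m))) (det (oddColumn x))) ⟩
  interlacingSum b us′ (⟦ differences 1ℤ (suc m) ⟧ (⟦ 𝒱 (suc m) ⟧ (det (oddColumn x))))
    ≡⟨ interlacingSum-lower x (⟦ 𝒱 (suc m) ⟧ (det (oddColumn x)))
         (𝒱-contractible (det (oddColumn x)) (det-antisym (oddColumn x)))
         (oddInLast⇒vanishing x (⟦ 𝒱 (suc m) ⟧ (det (oddColumn x)))
           (𝒱-oddInLast (centre x) (det (oddColumn x))
             (det-oddInLast (suc m) (centre x) (oddColumn x) (oddColumn-reflect x))))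
         b us asc ⟩
  ⟦ 𝒱 (suc m) ⟧ (det (oddColumn x)) (b ∷ us)
    ∎
  where
  us′ : Vec ℤ (suc m)
  us′ = us Vec.∷ʳ x

-- The displayed formulas as determinants

allFin-suc : ∀ m → allFin (suc m) ≡ zero ∷ List.map suc (allFin m)
allFin-suc m = cong (zero ∷_) (sym (List.map-tabulate (λ i → i) suc))

filter-zero<? : (qs : List (Fin m)) → filter (Fin.zero {m} Fin.<?_) (List.map suc qs) ≡ List.map suc qs
filter-zero<? []       = refl
filter-zero<? (q ∷ qs) = cong (suc q ∷_) (filter-zero<? qs)

filter-suc<? : (p : Fin m) (qs : List (Fin m)) →
               filter (suc p Fin.<?_) (List.map suc qs) ≡ List.map suc (filter (p Fin.<?_) qs)
filter-suc<? p []       = refl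
filter-suc<? p (q ∷ qs) with does (p Fin.<? q)
... | true  = cong (suc q ∷_) (filter-suc<? p qs)
... | false = filter-suc<? p qs

-- Pairs containing the first index, then the others: the same splitting as in `𝒱`, which turns the
-- list products of the theorem into recursions on m.
pairs-suc : ∀ m → pairs (suc m) ≡ List.map (λ q → zero , suc q) (allFin m) ++ List.map (Product.map suc suc) (pairs m)
pairs-suc m = cong₂ _++_ first others
  where
  row-of : Fin (suc m) → List (Fin (suc m) × Fin (suc m))
  row-of p = List.map (p ,_) (filter (p Fin.<?_) (allFin (suc m)))
  first : row-of zero ≡ List.map (λ q → zero , suc q) (allFin m)
  first = trans (cong (λ qs → List.map (zero ,_) (filter (Fin.zero {m} Fin.<?_) qs)) (allFin-suc m))
         (trans (cong (List.map (zero ,_)) (filter-zero<? (allFin m)))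
                (sym (List.map-∘ (allFin m))))
  row-of-suc : ∀ p → row-of (suc p) ≡ List.map (Product.map suc suc) (List.map (p ,_) (filter (p Fin.<?_) (allFin m)))
  row-of-suc p = trans (cong (λ qs → List.map (suc p ,_) (filter (suc p Fin.<?_) qs)) (allFin-suc m))
                (trans (cong (List.map (suc p ,_)) (filter-suc<? p (allFin m)))
                (trans (sym (List.map-∘ (filter (p Fin.<?_) (allFin m))))
                       (List.map-∘ (filter (p Fin.<?_) (allFin m)))))
  others : concatMap row-of (tabulate suc) ≡ List.map (Product.map suc suc) (pairs m)
  others = trans (cong (concatMap row-of) (sym (List.map-tabulate (λ i → i) suc)))
          (trans (List.concatMap-map row-of suc (allFin m))
          (trans (List.concatMap-cong row-of-suc (allFin m))
                 (sym (List.map-concatMap (Product.map suc suc)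
                                        (λ p → List.map (p ,_) (filter (p Fin.<?_) (allFin m))) (allFin m)))))

unit : Fin m → ℤ → Vec ℤ m
unit zero    c = c ∷ 0s
unit (suc p) c = 0ℤ ∷ unit p c

factorSh : Fin m × Fin m → Shifts m
factorSh (p , q) = pairSh (unit p 1ℤ) (unit p -1ℤ) (unit q 1ℤ) (unit q -1ℤ)

productSh : List (Fin m × Fin m) → Shifts m
productSh = foldr (λ pq A → factorSh pq ⊡ A) one

productSh-++ : (ps qs : List (Fin m × Fin m)) → productSh (ps ++ qs) ≈ productSh ps ⊡ productSh qs
productSh-++ []       qs = mk≈ (λ _ _ → refl)
productSh-++ (p ∷ ps) qs =
  ≈-trans (⊡-cong ≈-refl (productSh-++ ps qs)) (≈-sym (⊡-assoc (factorSh p) (productSh ps) (productSh qs)))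

productSh-lift : (ps : List (Fin m × Fin m)) → productSh (List.map (Product.map suc suc) ps) ≡ lift (productSh ps)
productSh-lift []       = refl
productSh-lift (p ∷ ps) = cong (factorSh (Product.map suc suc p) ⊡_) (productSh-lift ps)

productSh-skip : (qs : List (Fin m)) → productSh (List.map (λ q → zero , suc (suc q)) qs) ≡
                                       skip (productSh (List.map (λ q → zero , suc q) qs))
productSh-skip []       = refl
productSh-skip (q ∷ qs) = cong (factorSh (zero , suc (suc q)) ⊡_) (productSh-skip qs)

productSh-row : ∀ m → productSh (List.map (λ q → zero , suc q) (allFin m)) ≡ row m
productSh-row zero    = refl
productSh-row (suc m) = begin
  productSh (List.map (λ q → zero , suc q) (allFin (suc m)))
    ≡⟨ cong (productSh ∘ List.map (λ q → zero , suc q)) (allFin-suc m) ⟩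
  pair₀₁ ⊡ productSh (List.map (λ q → zero , suc q) (List.map suc (allFin m)))
    ≡⟨ cong (λ ps → pair₀₁ ⊡ productSh ps) (sym (List.map-∘ (allFin m))) ⟩
  pair₀₁ ⊡ productSh (List.map (λ q → zero , suc (suc q)) (allFin m))
    ≡⟨ cong (pair₀₁ ⊡_) (trans (productSh-skip (allFin m)) (cong skip (productSh-row m))) ⟩
  row (suc m)
    ∎

productSh-pairs : ∀ m → productSh (pairs m) ≈ 𝒱 m
productSh-pairs zero    = ≈-refl
productSh-pairs (suc m) =
  ≈-trans (≈-reflexive (cong productSh (pairs-suc m)))
 (≈-trans (productSh-++ (List.map (λ q → zero , suc q) (allFin m)) (List.map (Product.map suc suc) (pairs m)))
          (⊡-cong (≈-reflexive (productSh-row m))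
                  (≈-trans (≈-reflexive (productSh-lift (pairs m))) (lift-cong (productSh-pairs m)))))

-- Agreement of a function of k : Fin m → ℤ with a function of the vector of its values; it makes
-- up for the missing function extensionality.
Represents : Fn m → (Vec ℤ m → ℚ) → Set
Represents g h = ∀ k v → (∀ i → lookup v i ≡ k i) → g k ≡ h v

lookup-⊹-unit : (p : Fin m) (c : ℤ) (v : Vec ℤ m) (k : Fin m → ℤ) → (∀ i → lookup v i ≡ k i) →
                ∀ i → lookup (v ⊹ unit p c) i ≡ shiftAt p c k i
lookup-⊹-unit zero    c (a ∷ v) k v≗k zero    = cong (λ d → d ℤ.+ c) (v≗k zero)
lookup-⊹-unit zero    c (a ∷ v) k v≗k (suc i) = trans (cong (λ w → lookup w i) (⊹-identityʳ v)) (v≗k (suc i))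
lookup-⊹-unit (suc p) c (a ∷ v) k v≗k zero    = trans (ℤ.+-identityʳ a) (v≗k zero)
lookup-⊹-unit (suc p) c (a ∷ v) k v≗k (suc i) = lookup-⊹-unit p c v (k ∘ suc) (v≗k ∘ suc) i

represents-shift : {g : Fn m} {h : Vec ℤ m → ℚ} (p : Fin m) (c : ℤ) → Represents g h →
                   Represents (λ k → g (shiftAt p c k)) (⟦ sh (unit p c) ⟧ h)
represents-shift p c g≈h k v v≗k = g≈h (shiftAt p c k) (v ⊹ unit p c) (lookup-⊹-unit p c v k v≗k)

represents-factor : {g : Fn m} {h : Vec ℤ m → ℚ} (pq : Fin m × Fin m) → Represents g h →
                    Represents (factorOp pq g) (⟦ factorSh pq ⟧ h)
represents-factor {g = g} {h} (p , q) g≈h =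
  represents-shift p 1ℤ (represents-trinomial -1ℤ (represents-trinomial 1ℤ g≈h))
  where
  represents-trinomial : ∀ {g h} d → Represents g h →
    Represents (λ k → g (shiftAt p -1ℤ k) + g (shiftAt q d k) - g k) (⟦ trinomial (unit p -1ℤ) (unit q d) ⟧ h)
  represents-trinomial d g≈h k v v≗k =
    cong₂ _-_ (cong₂ _+_ (represents-shift p -1ℤ g≈h k v v≗k) (represents-shift q d g≈h k v v≗k)) (g≈h k v v≗k)

theOperator-represents : {g : Fn m} {h : Vec ℤ m → ℚ} → Represents g h → Represents (theOperator m g) (⟦ 𝒱 m ⟧ h)
theOperator-represents {m} {g} {h} g≈h k v v≗k =
  trans (go (pairs m) k v v≗k) (⟦≈⟧ (productSh-pairs m) h v)
  where
  go : (ps : List (Fin m × Fin m)) →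
       Represents (foldr (λ pq A → factorOp pq ∘ₒ A) idOp ps g) (⟦ productSh ps ⟧ h)
  go []       = g≈h
  go (p ∷ ps) = represents-factor p (go ps)

-- The displayed products as Vandermonde products with constants.

prodℚ-++ : ∀ ps qs → prodℚ (ps ++ qs) ≡ prodℚ ps * prodℚ qs
prodℚ-++ []       qs = sym (ℚ.*-identityˡ (prodℚ qs))
prodℚ-++ (p ∷ ps) qs = trans (cong (p *_) (prodℚ-++ ps qs)) (sym (ℚ.*-assoc p (prodℚ ps) (prodℚ qs)))

*-interchange : ∀ a b c d → a * b * (c * d) ≡ a * c * (b * d)
*-interchange = solve-∀ ℚ-ring

prodℚ-* : (f g : X → ℚ) (as : List X) →
          prodℚ (List.map (λ a → f a * g a) as) ≡ prodℚ (List.map f as) * prodℚ (List.map g as)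
prodℚ-* f g []       = refl
prodℚ-* f g (a ∷ as) = trans (cong (f a * g a *_) (prodℚ-* f g as)) (*-interchange (f a) (g a) _ _)

prodℚ-cong : {f g : X → ℚ} (as : List X) → (∀ a → f a ≡ g a) → prodℚ (List.map f as) ≡ prodℚ (List.map g as)
prodℚ-cong as f≗g = cong prodℚ (List.map-cong f≗g as)

prodℚ-pairs-suc : (f : Fin (suc m) × Fin (suc m) → ℚ) → prodℚ (List.map f (pairs (suc m))) ≡
  prodℚ (List.map (λ q → f (zero , suc q)) (allFin m)) * prodℚ (List.map (f ∘ Product.map suc suc) (pairs m))
prodℚ-pairs-suc {m} f = begin
  prodℚ (List.map f (pairs (suc m)))
    ≡⟨ cong (prodℚ ∘ List.map f) (pairs-suc m) ⟩
  prodℚ (List.map f (List.map (λ q → zero , suc q) (allFin m) ++ List.map (Product.map suc suc) (pairs m)))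
    ≡⟨ trans (cong prodℚ (List.map-++ f first others)) (prodℚ-++ (List.map f first) (List.map f others)) ⟩
  prodℚ (List.map f (List.map (λ q → zero , suc q) (allFin m))) *
    prodℚ (List.map f (List.map (Product.map suc suc) (pairs m)))
    ≡⟨ sym (cong₂ (λ ps qs → prodℚ ps * prodℚ qs) (List.map-∘ (allFin m)) (List.map-∘ (pairs m))) ⟩
  prodℚ (List.map (λ q → f (zero , suc q)) (allFin m)) * prodℚ (List.map (f ∘ Product.map suc suc) (pairs m))
    ∎
  where
  first others : List (Fin (suc m) × Fin (suc m))
  first  = List.map (λ q → zero , suc q) (allFin m)
  others = List.map (Product.map suc suc) (pairs m)

prodℚ-allFin-suc : (f : Fin (suc m) → ℚ) →
                   prodℚ (List.map f (allFin (suc m))) ≡ f zero * prodℚ (List.map (f ∘ suc) (allFin m))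
prodℚ-allFin-suc {m} f =
  trans (cong (prodℚ ∘ List.map f) (allFin-suc m)) (cong (λ ps → f zero * prodℚ ps) (sym (List.map-∘ (allFin m))))

prodℚ-lookup : (φ : X → ℚ) (v : Vec X m) → prodℚ (List.map (φ ∘ lookup v) (allFin m)) ≡ prodV φ v
prodℚ-lookup φ []      = refl
prodℚ-lookup φ (a ∷ v) = trans (prodℚ-allFin-suc (φ ∘ lookup (a ∷ v))) (cong (φ a *_) (prodℚ-lookup φ v))

prodℚ-toℕ : ∀ m (α : ℕ → ℚ) → prodℚ (List.map (α ∘ Fin.toℕ) (allFin m)) ≡ prodℕ m α
prodℚ-toℕ zero    α = refl
prodℚ-toℕ (suc m) α = trans (prodℚ-allFin-suc {m} (α ∘ Fin.toℕ)) (cong (α 0 *_) (prodℚ-toℕ m (α ∘ suc)))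

prodℚ-vandermonde : (w : X → ℚ) (v : Vec X m) →
  prodℚ (List.map (λ (i , j) → w (lookup v j) - w (lookup v i)) (pairs m)) ≡ vandermonde (Vec.map w v)
prodℚ-vandermonde w []      = refl
prodℚ-vandermonde w (a ∷ v) =
  trans (prodℚ-pairs-suc (λ (i , j) → w (lookup (a ∷ v) j) - w (lookup (a ∷ v) i)))
        (cong₂ _*_ (trans (prodℚ-lookup (λ b → w b - w a) v) (sym (prodV-map (_- w a) w v)))
                   (prodℚ-vandermonde w v))

prodℕ-* : ∀ m (α β : ℕ → ℚ) → prodℕ m (λ j → α j * β j) ≡ prodℕ m α * prodℕ m β
prodℕ-* zero    α β = refl
prodℕ-* (suc m) α β = trans (cong (α 0 * β 0 *_) (prodℕ-* m (α ∘ suc) (β ∘ suc))) (*-interchange (α 0) (β 0) _ _)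

prodℕ-cong : ∀ m {α β : ℕ → ℚ} → (∀ j → α j ≡ β j) → prodℕ m α ≡ prodℕ m β
prodℕ-cong zero    α≗β = refl
prodℕ-cong (suc m) α≗β = cong₂ _*_ (α≗β 0) (prodℕ-cong m (α≗β ∘ suc))

-- ∏_{i < j} (j - i) (j + i + s)
denominator : ℕ → ℕ → ℕ
denominator s zero    = 1
denominator s (suc j) = suc j ℕ.* (suc j ℕ.+ 0 ℕ.+ s) ℕ.* denominator (2 ℕ.+ s) j

-- The product is regrouped by the larger index. Raising both indices by one keeps j - i and adds 2
-- to j + i, which is absorbed into s.
prodℚ-denominator : ∀ m s →
  prodℚ (List.map (λ (i , j) → recip ((Fin.toℕ j ℕ.∸ Fin.toℕ i) ℕ.* (Fin.toℕ j ℕ.+ Fin.toℕ i ℕ.+ s))) (pairs m)) ≡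
  prodℕ m (recip ∘ denominator s)
prodℚ-denominator zero    s = refl
prodℚ-denominator (suc m) s = begin
  prodℚ (List.map d (pairs (suc m)))
    ≡⟨ prodℚ-pairs-suc d ⟩
  prodℚ (List.map (λ q → d (zero , suc q)) (allFin m)) * prodℚ (List.map (d ∘ Product.map suc suc) (pairs m))
    ≡⟨ cong₂ _*_ (prodℚ-toℕ m (λ j → recip (suc j ℕ.* (suc j ℕ.+ 0 ℕ.+ s))))
                 (trans (prodℚ-cong (pairs m) shift) (prodℚ-denominator m (2 ℕ.+ s))) ⟩
  prodℕ m (λ j → recip (suc j ℕ.* (suc j ℕ.+ 0 ℕ.+ s))) * prodℕ m (recip ∘ denominator (2 ℕ.+ s))
    ≡⟨ sym (prodℕ-* m (λ j → recip (suc j ℕ.* (suc j ℕ.+ 0 ℕ.+ s))) (recip ∘ denominator (2 ℕ.+ s))) ⟩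
  prodℕ m (λ j → recip (suc j ℕ.* (suc j ℕ.+ 0 ℕ.+ s)) * recip (denominator (2 ℕ.+ s) j))
    ≡⟨ prodℕ-cong m (λ j → sym (recip-* (suc j ℕ.* (suc j ℕ.+ 0 ℕ.+ s)) (denominator (2 ℕ.+ s) j))) ⟩
  prodℕ m (recip ∘ denominator s ∘ suc)
    ≡⟨ sym (ℚ.*-identityˡ (prodℕ m (recip ∘ denominator s ∘ suc))) ⟩
  prodℕ (suc m) (recip ∘ denominator s)
    ∎
  where
  d : Fin (suc m) × Fin (suc m) → ℚ
  d (i , j) = recip ((Fin.toℕ j ℕ.∸ Fin.toℕ i) ℕ.* (Fin.toℕ j ℕ.+ Fin.toℕ i ℕ.+ s))
  reassociate : ∀ a b s → suc a ℕ.+ suc b ℕ.+ s ≡ a ℕ.+ b ℕ.+ (2 ℕ.+ s)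
  reassociate = ℕ-solve-∀
  shift : ∀ ij → d (Product.map suc suc ij) ≡ _
  shift (i , j) = cong (λ e → recip ((Fin.toℕ j ℕ.∸ Fin.toℕ i) ℕ.* e)) (reassociate (Fin.toℕ j) (Fin.toℕ i) s)

-- The product of j - i over i < j is j!, and that of j + i + s + 1 is (2 j + s)! / (j + s)!; the
-- identity is cleared of the quotient. The induction splits off i = 0 and raises s by 2.
denominator-! : ∀ s j → denominator (suc s) j ℕ.* (s ℕ.+ j) ! ≡ j ! ℕ.* (double j ℕ.+ s) !
denominator-! s zero    = cong (λ t → t ! ℕ.+ 0) (ℕ.+-identityʳ s)
denominator-! s (suc j) = begin
  suc j ℕ.* (suc j ℕ.+ 0 ℕ.+ suc s) ℕ.* d ℕ.* (s ℕ.+ suc j) !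
    ≡⟨ cong₂ (λ t u → suc j ℕ.* t ℕ.* d ℕ.* u !) (reassociate j s) (ℕ.+-suc s j) ⟩
  suc j ℕ.* suc (suc (s ℕ.+ j)) ℕ.* d ℕ.* suc (s ℕ.+ j) !
    ≡⟨ regroup (suc j) (suc (suc (s ℕ.+ j))) d (suc (s ℕ.+ j) !) ⟩
  suc j ℕ.* (d ℕ.* (suc (suc s) ℕ.+ j) !)
    ≡⟨ cong (suc j ℕ.*_) (denominator-! (suc (suc s)) j) ⟩
  suc j ℕ.* (j ! ℕ.* (double j ℕ.+ suc (suc s)) !)
    ≡⟨ sym (ℕ.*-assoc (suc j) (j !) _) ⟩
  suc j ! ℕ.* (double j ℕ.+ suc (suc s)) !
    ≡⟨ cong (λ t → suc j ! ℕ.* t !) (trans (ℕ.+-suc (double j) (suc s)) (cong suc (ℕ.+-suc (double j) s))) ⟩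
  suc j ! ℕ.* (double (suc j) ℕ.+ s) !
    ∎
  where
  d : ℕ
  d = denominator (suc (suc (suc s))) j
  reassociate : ∀ j s → suc j ℕ.+ 0 ℕ.+ suc s ≡ suc (suc (s ℕ.+ j))
  reassociate = ℕ-solve-∀
  regroup : ∀ a b c e → a ℕ.* b ℕ.* c ℕ.* e ≡ a ℕ.* (c ℕ.* (b ℕ.* e))
  regroup = ℕ-solve-∀

denominator-odd : ∀ j → denominator 1 j ≡ double j !
denominator-odd j = ℕ.*-cancelʳ-≡ _ _ (j !) {{j ℕ.!≢0}}
  (trans (denominator-! 0 j) (trans (cong (λ t → j ! ℕ.* t !) (ℕ.+-identityʳ (double j))) (ℕ.*-comm (j !) _)))

-- The extra factor j + 1 is the denominator of the product over single indices; together they form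
-- the normalisation (2 j + 1)! of the odd column.
denominator-even : ∀ j → denominator 2 j ℕ.* suc j ≡ suc (double j) !
denominator-even j = ℕ.*-cancelʳ-≡ _ _ (j !) {{j ℕ.!≢0}} (begin
  denominator 2 j ℕ.* suc j ℕ.* j !        ≡⟨ ℕ.*-assoc (denominator 2 j) (suc j) (j !) ⟩
  denominator 2 j ℕ.* suc j !              ≡⟨ denominator-! 1 j ⟩
  j ! ℕ.* (double j ℕ.+ 1) !               ≡⟨ cong (λ t → j ! ℕ.* t !) (ℕ.+-comm (double j) 1) ⟩
  j ! ℕ.* suc (double j) !                 ≡⟨ ℕ.*-comm (j !) (suc (double j) !) ⟩
  suc (double j) ! ℕ.* j !                 ∎)

-- The variables of the Newton polynomials: 1/4 - (x + 1/2 - k)² and -(x + 1 - k)². With this sign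
-- their differences are the displayed numerators, so no power of -1 remains.
evenSquare oddSquare : ℤ → ℤ → ℚ
evenSquare x k = - (fromℤ (x ℤ.- k) * (1ℚ + fromℤ (x ℤ.- k)))
oddSquare  x k = - (fromℤ (x ℤ.+ 1ℤ ℤ.- k) * fromℤ (x ℤ.+ 1ℤ ℤ.- k))

fromℤ-evenSquare : ∀ x a b →
  fromℤ ((b ℤ.- a) ℤ.* (+ 2 ℤ.* x ℤ.+ 1ℤ ℤ.- a ℤ.- b)) ≡ evenSquare x b - evenSquare x a
fromℤ-evenSquare x a b = trans (cong fromℤ (identity x a b)) (trans (fromℤ-sub (sq b) (sq a)) (cong₂ _-_ (hom b) (hom a)))
  where
  sq : ℤ → ℤ
  sq k = ℤ.- ((x ℤ.- k) ℤ.* (1ℤ ℤ.+ (x ℤ.- k)))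
  hom : ∀ k → fromℤ (sq k) ≡ evenSquare x k
  hom k = trans (fromℤ-neg ((x ℤ.- k) ℤ.* (1ℤ ℤ.+ (x ℤ.- k))))
    (cong -_ (trans (fromℤ-* (x ℤ.- k) (1ℤ ℤ.+ (x ℤ.- k))) (cong (fromℤ (x ℤ.- k) *_) (fromℤ-+ 1ℤ (x ℤ.- k)))))
  identity : ∀ x a b → (b ℤ.- a) ℤ.* (+ 2 ℤ.* x ℤ.+ 1ℤ ℤ.- a ℤ.- b) ≡
    ℤ.- ((x ℤ.- b) ℤ.* (1ℤ ℤ.+ (x ℤ.- b))) ℤ.- ℤ.- ((x ℤ.- a) ℤ.* (1ℤ ℤ.+ (x ℤ.- a)))
  identity = ℤ-solve-∀

fromℤ-oddSquare : ∀ x a b →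
  fromℤ ((b ℤ.- a) ℤ.* (+ 2 ℤ.* x ℤ.+ + 2 ℤ.- a ℤ.- b)) ≡ oddSquare x b - oddSquare x a
fromℤ-oddSquare x a b = trans (cong fromℤ (identity x a b)) (trans (fromℤ-sub (sq b) (sq a)) (cong₂ _-_ (hom b) (hom a)))
  where
  sq : ℤ → ℤ
  sq k = ℤ.- ((x ℤ.+ 1ℤ ℤ.- k) ℤ.* (x ℤ.+ 1ℤ ℤ.- k))
  hom : ∀ k → fromℤ (sq k) ≡ oddSquare x k
  hom k = trans (fromℤ-neg ((x ℤ.+ 1ℤ ℤ.- k) ℤ.* (x ℤ.+ 1ℤ ℤ.- k)))
                (cong -_ (fromℤ-* (x ℤ.+ 1ℤ ℤ.- k) (x ℤ.+ 1ℤ ℤ.- k)))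
  identity : ∀ x a b → (b ℤ.- a) ℤ.* (+ 2 ℤ.* x ℤ.+ + 2 ℤ.- a ℤ.- b) ≡
    ℤ.- ((x ℤ.+ 1ℤ ℤ.- b) ℤ.* (x ℤ.+ 1ℤ ℤ.- b)) ℤ.- ℤ.- ((x ℤ.+ 1ℤ ℤ.- a) ℤ.* (x ℤ.+ 1ℤ ℤ.- a))
  identity = ℤ-solve-∀

det-evenColumn : ∀ x (v : Vec ℤ m) →
  det (evenColumn x) v ≡ vandermonde (Vec.map (evenSquare x) v) * prodℕ m (recip ∘ denominator 1)
det-evenColumn {m} x v = begin
  det (evenColumn x) v
    ≡⟨ det-columnScale (λ j → recip (double j !)) (λ j k → newton evenNode j (evenSquare x k)) v ⟩
  prodℕ m (λ j → recip (double j !)) * det (λ j k → newton evenNode j (evenSquare x k)) v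
    ≡⟨ cong₂ _*_ (prodℕ-cong m (λ j → cong recip (sym (denominator-odd j)))) (det-newton evenNode (evenSquare x) v) ⟩
  prodℕ m (recip ∘ denominator 1) * vandermonde (Vec.map (evenSquare x) v)
    ≡⟨ ℚ.*-comm (prodℕ m (recip ∘ denominator 1)) _ ⟩
  vandermonde (Vec.map (evenSquare x) v) * prodℕ m (recip ∘ denominator 1)
    ∎

polyOdd-represents : ∀ x → Represents (polyOdd m x) (det (evenColumn x))
polyOdd-represents {m} x k v v≗k = begin
  polyOdd m x k
    ≡⟨ prodℚ-cong (pairs m) factor ⟩
  prodℚ (List.map (λ ij → numerator ij * scale ij) (pairs m))
    ≡⟨ prodℚ-* numerator scale (pairs m) ⟩
  prodℚ (List.map numerator (pairs m)) * prodℚ (List.map scale (pairs m))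
    ≡⟨ cong₂ _*_ (prodℚ-vandermonde (evenSquare x) v) (prodℚ-denominator m 1) ⟩
  vandermonde (Vec.map (evenSquare x) v) * prodℕ m (recip ∘ denominator 1)
    ≡⟨ sym (det-evenColumn x v) ⟩
  det (evenColumn x) v
    ∎
  where
  numerator scale : Fin m × Fin m → ℚ
  numerator (i , j) = evenSquare x (lookup v j) - evenSquare x (lookup v i)
  scale     (i , j) = recip ((Fin.toℕ j ℕ.∸ Fin.toℕ i) ℕ.* (Fin.toℕ j ℕ.+ Fin.toℕ i ℕ.+ 1))
  factor : ∀ ij → _ ≡ numerator ij * scale ij
  factor (i , j) = trans (/′-recip ((k j ℤ.- k i) ℤ.* (+ 2 ℤ.* x ℤ.+ 1ℤ ℤ.- k i ℤ.- k j))
            ((Fin.toℕ j ℕ.∸ Fin.toℕ i) ℕ.* (Fin.toℕ j ℕ.+ Fin.toℕ i ℕ.+ 1)))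
    (cong (_* scale (i , j)) (trans (fromℤ-evenSquare x (k i) (k j))
                                    (sym (cong₂ (λ a b → evenSquare x a - evenSquare x b) (v≗k j) (v≗k i)))))

det-oddColumn : ∀ x (v : Vec ℤ m) → det (oddColumn x) v ≡
  vandermonde (Vec.map (oddSquare x) v) * prodℕ m (recip ∘ denominator 2) *
  (prodV (λ k → fromℤ (x ℤ.+ 1ℤ ℤ.- k)) v * prodℕ m (recip ∘ suc))
det-oddColumn {m} x v = begin
  det (oddColumn x) v
    ≡⟨ det-columnScale (λ j → recip (suc (double j) !)) (λ j k → z k * newton oddNode j (oddSquare x k)) v ⟩
  prodℕ m (λ j → recip (suc (double j) !)) * det (λ j k → z k * newton oddNode j (oddSquare x k)) v
    ≡⟨ cong₂ _*_ (trans (prodℕ-cong m split) (prodℕ-* m (recip ∘ denominator 2) (recip ∘ suc)))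
                 (trans (det-rowScale z (λ j k → newton oddNode j (oddSquare x k)) v)
                        (cong (prodV z v *_) (det-newton oddNode (oddSquare x) v))) ⟩
  prodℕ m (recip ∘ denominator 2) * prodℕ m (recip ∘ suc) * (prodV z v * vandermonde (Vec.map (oddSquare x) v))
    ≡⟨ regroup (prodℕ m (recip ∘ denominator 2)) (prodℕ m (recip ∘ suc)) (prodV z v) _ ⟩
  vandermonde (Vec.map (oddSquare x) v) * prodℕ m (recip ∘ denominator 2) * (prodV z v * prodℕ m (recip ∘ suc))
    ∎
  where
  z : ℤ → ℚ
  z k = fromℤ (x ℤ.+ 1ℤ ℤ.- k)
  split : ∀ j → recip (suc (double j) !) ≡ recip (denominator 2 j) * recip (suc j)
  split j = trans (cong recip (sym (denominator-even j))) (recip-* (denominator 2 j) (suc j))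
  regroup : ∀ a b c d → a * b * (c * d) ≡ d * a * (c * b)
  regroup = solve-∀ ℚ-ring

polyEven-represents : ∀ x → Represents (polyEven m x) (det (oddColumn x))
polyEven-represents {m} x k v v≗k = begin
  polyEven m x k
    ≡⟨ cong₂ _*_ (prodℚ-cong (pairs m) factor) (prodℚ-cong (allFin m) factor₁) ⟩
  prodℚ (List.map (λ ij → numerator ij * scale ij) (pairs m)) *
  prodℚ (List.map (λ i → z (lookup v i) * recip (suc (Fin.toℕ i))) (allFin m))
    ≡⟨ cong₂ _*_ (prodℚ-* numerator scale (pairs m))
                 (prodℚ-* (z ∘ lookup v) (λ i → recip (suc (Fin.toℕ i))) (allFin m)) ⟩
  prodℚ (List.map numerator (pairs m)) * prodℚ (List.map scale (pairs m)) *
  (prodℚ (List.map (z ∘ lookup v) (allFin m)) * prodℚ (List.map (λ i → recip (suc (Fin.toℕ i))) (allFin m)))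
    ≡⟨ cong₂ _*_ (cong₂ _*_ (prodℚ-vandermonde (oddSquare x) v) (prodℚ-denominator m 2))
                 (cong₂ _*_ (prodℚ-lookup z v) (prodℚ-toℕ m (recip ∘ suc))) ⟩
  vandermonde (Vec.map (oddSquare x) v) * prodℕ m (recip ∘ denominator 2) * (prodV z v * prodℕ m (recip ∘ suc))
    ≡⟨ sym (det-oddColumn x v) ⟩
  det (oddColumn x) v
    ∎
  where
  z : ℤ → ℚ
  z a = fromℤ (x ℤ.+ 1ℤ ℤ.- a)
  numerator scale : Fin m × Fin m → ℚ
  numerator (i , j) = oddSquare x (lookup v j) - oddSquare x (lookup v i)
  scale     (i , j) = recip ((Fin.toℕ j ℕ.∸ Fin.toℕ i) ℕ.* (Fin.toℕ j ℕ.+ Fin.toℕ i ℕ.+ 2))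
  factor : ∀ ij → _ ≡ numerator ij * scale ij
  factor (i , j) = trans (/′-recip ((k j ℤ.- k i) ℤ.* (+ 2 ℤ.* x ℤ.+ + 2 ℤ.- k i ℤ.- k j))
            ((Fin.toℕ j ℕ.∸ Fin.toℕ i) ℕ.* (Fin.toℕ j ℕ.+ Fin.toℕ i ℕ.+ 2)))
    (cong (_* scale (i , j)) (trans (fromℤ-oddSquare x (k i) (k j))
                                    (sym (cong₂ (λ a b → oddSquare x a - oddSquare x b) (v≗k j) (v≗k i)))))
  factor₁ : ∀ i → _ ≡ z (lookup v i) * recip (suc (Fin.toℕ i))
  factor₁ i = trans (/′-recip (x ℤ.+ 1ℤ ℤ.- k i) (Fin.toℕ i ℕ.+ 1))
    (cong₂ (λ a d → z a * recip d) (sym (v≗k i)) (ℕ.+-comm (Fin.toℕ i) 1))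

-- Enumeration of the triangles

concatMap-unique : {Y : Set} (f : X → List Y) {as : List X} → Unique as → (∀ {a} → a ∈ as → Unique (f a)) →
  (∀ {a b c} → a ∈ as → b ∈ as → c ∈ f a → c ∈ f b → a ≡ b) → Unique (concatMap f as)
concatMap-unique f {[]}     _ _ _ = []
concatMap-unique f {a ∷ as} (a∉as ∷ uas) uf separated =
  Unique.++⁺ (uf (here refl))
             (concatMap-unique f uas (uf ∘ there) (λ a∈ b∈ → separated (there a∈) (there b∈)))
             disjoint
  where
  disjoint : ∀ {c} → c ∈ f a × c ∈ concatMap f as → ⊥
  disjoint (c∈fa , c∈fas) with find (∈-concatMap⁻ f c∈fas)
  ... | b , b∈as , c∈fb = All.lookup a∉as b∈as (separated (here refl) (there b∈as) c∈fa c∈fb)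

range-unique : ∀ b n → Unique (range b n)
range-unique b zero    = []
range-unique b (suc n) = All.tabulate b∉ ∷ range-unique (b ℤ.+ 1ℤ) n
  where
  b∉ : ∀ {c} → c ∈ range (b ℤ.+ 1ℤ) n → b ≢ c
  b∉ c∈ refl with ∈-range⁻ (b ℤ.+ 1ℤ) n c∈
  ... | i , _ , b≡ = ℤ.<-irrefl b≡ (ℤ.<-≤-trans (subst (ℤ._< b ℤ.+ 1ℤ) (ℤ.+-identityʳ b) (ℤ.+-monoʳ-< b (ℤ.+<+ ℕ.z<s)))
                                                (ℤ.i≤i+j (b ℤ.+ 1ℤ) (+ i)))

interval-unique : ∀ b u → Unique (interval b u)
interval-unique b u = go (u ℤ.- b)
  where
  go : ∀ d → Unique (rangeTo b d)
  go (+ n)        = range-unique b (suc n)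
  go ℤ.-[1+ _ ]   = []

interlacing-unique : ∀ b (us : Vec ℤ m) → Unique (interlacing b us)
interlacing-unique b []       = [] ∷ []
interlacing-unique b (u ∷ us) = concatMap-unique _ (interval-unique b u)
  (λ {l} _ → Unique.map⁺ Vec.∷-injectiveʳ (interlacing-unique (nextBound l u) us)) λ {a} {c} _ _ → separated {a} {c}
  where
  separated : ∀ {a c v} → v ∈ List.map (a ∷_) (interlacing (nextBound a u) us) →
              v ∈ List.map (c ∷_) (interlacing (nextBound c u) us) → a ≡ c
  separated {a} {c} v∈a v∈c with ∈-map⁻ (a ∷_) v∈a | ∈-map⁻ (c ∷_) v∈c
  ... | _ , _ , refl | _ , _ , eq = Vec.∷-injectiveˡ eq

-- The rows that can stand above a given row.

Interlaces : ℤ → Vec ℤ m → Vec ℤ m → Set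
Interlaces b []       []       = ⊤
Interlaces b (u ∷ us) (l ∷ ls) = b ℤ.≤ l × l ℤ.≤ u × Interlaces (nextBound l u) us ls

∈-interlacing⁻ : ∀ b (us ls : Vec ℤ m) → ls ∈ interlacing b us → Interlaces b us ls
∈-interlacing⁻ b []       []       _   = _
∈-interlacing⁻ b (u ∷ us) (l ∷ ls) ls∈ with find (∈-concatMap⁻ (λ l → List.map (l ∷_) (interlacing (nextBound l u) us)) ls∈)
... | l₁ , l₁∈ , l∷ls∈ with ∈-map⁻ (l₁ ∷_) l∷ls∈
... | ls₁ , ls₁∈ , refl = proj₁ (∈-interval⁻ {b} {u} l₁∈) , proj₂ (∈-interval⁻ {b} {u} l₁∈) , ∈-interlacing⁻ (nextBound l₁ u) us ls₁ ls₁∈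

∈-interlacing⁺ : ∀ b (us ls : Vec ℤ m) → Interlaces b us ls → ls ∈ interlacing b us
∈-interlacing⁺ b []       []       _                     = here refl
∈-interlacing⁺ b (u ∷ us) (l ∷ ls) (b≤l , l≤u , inter) =
  ∈-concatMap⁺ (λ l → List.map (l ∷_) (interlacing (nextBound l u) us))
    (lose (∈-interval⁺ b≤l l≤u) (∈-map⁺ (l ∷_) (∈-interlacing⁺ (nextBound l u) us ls inter)))

-- A row that is strictly increasing with entries at most x.
Row : ℤ → Vec ℤ m → Set
Row x []       = ⊤
Row x (b ∷ us) = Ascending (b ℤ.+ 1ℤ) (us Vec.∷ʳ (x ℤ.+ 1ℤ))

ascending-weaken : ∀ {b c} (us : Vec ℤ m) → b ℤ.≤ c → Ascending c us → Ascending b us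
ascending-weaken []       _   _           = _
ascending-weaken (u ∷ us) b≤c (c≤u , asc) = ℤ.≤-trans b≤c c≤u , asc

ascending⇒row : ∀ {b} x (ls : Vec ℤ m) → Ascending b (ls Vec.∷ʳ (x ℤ.+ 1ℤ)) → Row x ls
ascending⇒row x []       _         = _
ascending⇒row x (l ∷ ls) (_ , asc) = asc

ascending-init : ∀ {b x} (us : Vec ℤ m) → Ascending b (us Vec.∷ʳ x) → Ascending b us
ascending-init []       _           = _
ascending-init (u ∷ us) (b≤u , asc) = b≤u , ascending-init us asc

-- The bound by x is inherited from the row below: also after the last entry, the bound handed down
-- is at most x + 1.
interlaces-ascending : ∀ {b} x (us ls : Vec ℤ m) → Ascending b (us Vec.∷ʳ (x ℤ.+ 1ℤ)) → Interlaces b us ls →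
                       Ascending b (ls Vec.∷ʳ (x ℤ.+ 1ℤ))
interlaces-ascending x []       []       asc         _                     = asc
interlaces-ascending x (u ∷ us) (l ∷ ls) (b≤u , asc) (b≤l , l≤u , inter) =
  b≤l , ascending-weaken (ls Vec.∷ʳ (x ℤ.+ 1ℤ)) (ℤ.i≤i⊔j (l ℤ.+ 1ℤ) u)
          (interlaces-ascending x us ls (ascending-nextBound l (us Vec.∷ʳ (x ℤ.+ 1ℤ)) l≤u asc) inter)

interlaces-∷ʳ-ascending : ∀ {b x} (us : Vec ℤ m) (ls : Vec ℤ (suc m)) → Interlaces b (us Vec.∷ʳ x) ls →
                          Ascending b (ls Vec.∷ʳ (x ℤ.+ 1ℤ))
interlaces-∷ʳ-ascending []       (l ∷ [])     (b≤l , l≤x , _)     = b≤l , ℤ.+-monoˡ-≤ 1ℤ l≤x , _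
interlaces-∷ʳ-ascending {x = x} (u ∷ us) (l ∷ ls) (b≤l , _ , inter) =
  b≤l , ascending-weaken (ls Vec.∷ʳ (x ℤ.+ 1ℤ)) (ℤ.i≤i⊔j (l ℤ.+ 1ℤ) u) (interlaces-∷ʳ-ascending us ls inter)

Strict : List ℤ → Set
Strict r = ∀ j a b → at r j ≡ just a → at r (suc j) ≡ just b → a ℤ.< b

AtMost : ℤ → List ℤ → Set
AtMost x r = ∀ j a → at r j ≡ just a → a ℤ.≤ x

-- r is the row below l.
record Adjacent (l r : List ℤ) : Set where
  constructor adjacent
  field
    below-left  : ∀ j a b → at r j ≡ just a → at l j ≡ just b → a ℤ.≤ b
    below-right : ∀ j a b → at l j ≡ just a → at r (suc j) ≡ just b → a ℤ.≤ b

<⇒+1≤ : ∀ {a b} → a ℤ.< b → a ℤ.+ 1ℤ ℤ.≤ b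
<⇒+1≤ {a} {b} a<b = subst (ℤ._≤ b) (ℤ.+-comm 1ℤ a) (ℤ.i<j⇒suc[i]≤j a<b)

+1≤⇒< : ∀ {a b} → a ℤ.+ 1ℤ ℤ.≤ b → a ℤ.< b
+1≤⇒< {a} {b} a+1≤b = ℤ.suc[i]≤j⇒i<j (subst (ℤ._≤ b) (ℤ.+-comm a 1ℤ) a+1≤b)

ascending-≤-last : ∀ {b x} (us : Vec ℤ m) → Ascending b (us Vec.∷ʳ x) → b ℤ.≤ x
ascending-≤-last []       (b≤x , _)   = b≤x
ascending-≤-last (u ∷ us) (b≤u , asc) = ℤ.≤-trans b≤u (ℤ.≤-trans (ℤ.i≤i+j u 1ℤ) (ascending-≤-last us asc))

row⇒strict : ∀ x (v : Vec ℤ m) → Row x v → Strict (Vec.toList v)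
row⇒strict x (a ∷ c ∷ v) (a+1≤c , asc) zero    _ _ refl refl = +1≤⇒< a+1≤c
row⇒strict x (a ∷ c ∷ v) (_ , asc)     (suc j) = row⇒strict x (c ∷ v) asc j

row⇒atMost : ∀ x (v : Vec ℤ m) → Row x v → AtMost x (Vec.toList v)
row⇒atMost x (a ∷ v) asc zero _ refl =
  subst₂ ℤ._≤_ (pred-+1 a) (pred-+1 x) (ℤ.+-monoˡ-≤ -1ℤ (ascending-≤-last v asc))
  where
  pred-+1 : ∀ i → i ℤ.+ 1ℤ ℤ.+ -1ℤ ≡ i
  pred-+1 = ℤ-solve-∀
row⇒atMost x (a ∷ c ∷ v) (_ , asc) (suc j) = row⇒atMost x (c ∷ v) asc j

at-∷ʳ-init : {y : X} (as : List X) (i : ℕ) {a : X} → at as i ≡ just a → at (as List.∷ʳ y) i ≡ just a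
at-∷ʳ-init (a ∷ as) zero    eq = eq
at-∷ʳ-init (a ∷ as) (suc i) eq = at-∷ʳ-init as i eq

at-∷ʳ-last : (as : List X) (y : X) → at (as List.∷ʳ y) (length as) ≡ just y
at-∷ʳ-last []       y = refl
at-∷ʳ-last (a ∷ as) y = at-∷ʳ-last as y

at-∷ʳ⁻ : (as : List X) {y a : X} (i : ℕ) → at (as List.∷ʳ y) i ≡ just a →
         at as i ≡ just a ⊎ (i ≡ length as × y ≡ a)
at-∷ʳ⁻ []       zero    refl = inj₂ (refl , refl)
at-∷ʳ⁻ (a ∷ as) zero    eq   = inj₁ eq
at-∷ʳ⁻ (a ∷ as) (suc i) eq   = Sum.map₂ (Product.map₁ (cong suc)) (at-∷ʳ⁻ as i eq)

at-< : (as : List X) {a : X} (i : ℕ) → at as i ≡ just a → i ℕ.< length as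
at-< (a ∷ as) zero    eq = ℕ.z<s
at-< (a ∷ as) (suc i) eq = ℕ.s<s (at-< as i eq)

at-last : (as : List X) (n : ℕ) → length as ≡ suc n → Σ X λ a → at as n ≡ just a
at-last (a ∷ as) zero    _  = a , refl
at-last (a ∷ as) (suc n) eq = at-last as n (ℕ.suc-injective eq)

interlaces⇒adjacent : ∀ {b} (us ls : Vec ℤ m) → Interlaces b us ls →
                      Adjacent (Vec.toList ls) (b ∷ Vec.toList us)
interlaces⇒adjacent [] [] _ = adjacent (λ { zero _ _ _ () ; (suc _) _ _ () _ }) (λ _ _ _ ())
interlaces⇒adjacent {b = b} (u ∷ us) (l ∷ ls) (b≤l , l≤u , inter)
  with interlaces⇒adjacent us ls inter
... | adjacent left right = adjacent left₁ right₁
  where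
  left₁ : ∀ j a c → at (b ∷ u ∷ Vec.toList us) j ≡ just a → at (l ∷ Vec.toList ls) j ≡ just c → a ℤ.≤ c
  left₁ zero          _ _ refl refl = b≤l
  left₁ (suc zero)    _ c refl eq   = ℤ.≤-trans (ℤ.i≤j⊔i (l ℤ.+ 1ℤ) _) (left zero _ c refl eq)
  left₁ (suc (suc j)) = left (suc j)
  right₁ : ∀ j a c → at (l ∷ Vec.toList ls) j ≡ just a → at (u ∷ Vec.toList us) j ≡ just c → a ℤ.≤ c
  right₁ zero    _ _ refl refl = l≤u
  right₁ (suc j) = right j

-- An entry has two lower bounds, one from strictness of its own row and one from the row below.
-- They merge into `nextBound l u`, which takes the place of u as head of the row below in the
-- recursive call.
adjacent⇒interlaces : ∀ {b} (us ls : Vec ℤ m) → Adjacent (Vec.toList ls) (b ∷ Vec.toList us) →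
                      Strict (Vec.toList ls) → Interlaces b us ls
adjacent⇒interlaces []       []       _ _ = _
adjacent⇒interlaces (u ∷ us) (l ∷ ls) (adjacent left right) strict =
  left zero _ _ refl refl , right zero _ _ refl refl ,
  adjacent⇒interlaces us ls (adjacent left₁ (right ∘ suc)) (strict ∘ suc)
  where
  left₁ : ∀ j a c → at (nextBound l u ∷ Vec.toList us) j ≡ just a → at (Vec.toList ls) j ≡ just c → a ℤ.≤ c
  left₁ zero    _ c refl eq = ℤ.⊔-lub (<⇒+1≤ (strict zero l c refl eq)) (left 1 u c refl eq)
  left₁ (suc j) = left (suc (suc j))

adjacent-∷ʳ⁻ : ∀ {l} r x → Adjacent l (r List.∷ʳ x) → Adjacent l r
adjacent-∷ʳ⁻ r x (adjacent left right) = adjacent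
  (λ j a b eq → left j a b (at-∷ʳ-init r j eq)) (λ j a b eq eq₁ → right j a b eq (at-∷ʳ-init r (suc j) eq₁))

-- With an even number of rows, the last two rows have equal length and the last entry of l has no
-- right neighbour below. Appending x to r supplies one and makes the bound x an interlacing
-- condition.
adjacent-∷ʳ⁺ : ∀ {l} r x → length l ≡ length r → AtMost x l → Adjacent l r → Adjacent l (r List.∷ʳ x)
adjacent-∷ʳ⁺ {l} r x same atMost (adjacent left right) = adjacent left₁ right₁
  where
  left₁ : ∀ j a b → at (r List.∷ʳ x) j ≡ just a → at l j ≡ just b → a ℤ.≤ b
  left₁ j a b eq eq₁ with at-∷ʳ⁻ r j eq
  ... | inj₁ eq₂      = left j a b eq₂ eq₁
  ... | inj₂ (refl , _) = ⊥-elim (ℕ.<-irrefl (sym same) (at-< l j eq₁))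
  right₁ : ∀ j a b → at l j ≡ just a → at (r List.∷ʳ x) (suc j) ≡ just b → a ℤ.≤ b
  right₁ j a b eq eq₁ with at-∷ʳ⁻ r (suc j) eq₁
  ... | inj₁ eq₂       = right j a b eq eq₂
  ... | inj₂ (_ , refl) = atMost j a eq

-- Halved monotone triangles with entries at most x, the inequalities being grouped by rows.
record Triangle (n : ℕ) (x : ℤ) (T : List (List ℤ)) : Set where
  field
    numRows   : length T ≡ n
    rowLength : ∀ i r → at T i ≡ just r → length r ≡ ⌈ suc i /2⌉
    strict    : ∀ i r → at T i ≡ just r → Strict r
    atMost    : ∀ i r → at T i ≡ just r → AtMost x r
    adj       : ∀ i l r → at T i ≡ just l → at T (suc i) ≡ just r → Adjacent l r

entry⁺ : ∀ T i j {r a} → at T i ≡ just r → at r j ≡ just a → entry T i j ≡ just a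
entry⁺ T i j eq eq₁ with at T i | eq
... | just r | refl = eq₁

entry⁻ : ∀ T i j {a} → entry T i j ≡ just a → Σ (List ℤ) λ r → at T i ≡ just r × at r j ≡ just a
entry⁻ T i j eq with at T i
... | just r = r , refl , eq

triangle⇔ : ∀ n x T → Triangle n x T ⇔ (IsHalvedMonotoneTriangle n T × EntriesAtMost x T)
triangle⇔ n x T = mk⇔ to from
  where
  to : Triangle n x T → IsHalvedMonotoneTriangle n T × EntriesAtMost x T
  to t = record
    { numRows   = numRows
    ; rowLength = rowLength
    ; ineq₁ = λ i j a b eq eq₁ → let r , r≡ , a≡ = entry⁻ T (suc i) j eq ; l , l≡ , b≡ = entry⁻ T i j eq₁
                                 in Adjacent.below-left (adj i l r l≡ r≡) j a b a≡ b≡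
    ; ineq₂ = λ i j a b eq eq₁ → let l , l≡ , a≡ = entry⁻ T i j eq ; r , r≡ , b≡ = entry⁻ T (suc i) (suc j) eq₁
                                 in Adjacent.below-right (adj i l r l≡ r≡) j a b a≡ b≡
    ; ineq₃ = ineq₃
    } , λ i j a eq → let r , r≡ , a≡ = entry⁻ T i j eq in atMost i r r≡ j a a≡
    where
    open Triangle t
    ineq₃ : ∀ i j a b → entry T i j ≡ just a → entry T i (suc j) ≡ just b → a ℤ.< b
    ineq₃ i j a b eq eq₁ with at T i in r≡
    ... | just r = strict i r r≡ j a b eq eq₁
  from : IsHalvedMonotoneTriangle n T × EntriesAtMost x T → Triangle n x T
  from (h , bounded) = record
    { numRows   = numRows
    ; rowLength = rowLength
    ; strict    = λ i r r≡ j a b a≡ b≡ → ineq₃ i j a b (entry⁺ T i j r≡ a≡) (entry⁺ T i (suc j) r≡ b≡)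
    ; atMost    = λ i r r≡ j a a≡ → bounded i j a (entry⁺ T i j r≡ a≡)
    ; adj       = λ i l r l≡ r≡ → adjacent
        (λ j a b a≡ b≡ → ineq₁ i j a b (entry⁺ T (suc i) j r≡ a≡) (entry⁺ T i j l≡ b≡))
        (λ j a b a≡ b≡ → ineq₂ i j a b (entry⁺ T i j l≡ a≡) (entry⁺ T (suc i) (suc j) r≡ b≡))
    }
    where open IsHalvedMonotoneTriangle h

-- Adding and removing the bottom row.

triangle-∷ʳ⁺ : ∀ {n x T l r} → Triangle (suc n) x T → at T n ≡ just l → length r ≡ ⌈ suc (suc n) /2⌉ →
               Strict r → AtMost x r → Adjacent l r → Triangle (suc (suc n)) x (T List.∷ʳ r)
triangle-∷ʳ⁺ {n} {x} {T} {l} {r} t l≡ len str atm adjlr = record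
  { numRows   = trans (List.length-++ T) (trans (ℕ.+-comm (length T) 1) (cong suc numRows))
  ; rowLength = λ i s s≡ → cases i s s≡ (rowLength i s)
                  (λ { refl refl → trans len (cong (λ p → ⌈ suc p /2⌉) (sym numRows)) })
  ; strict    = λ i s s≡ → cases i s s≡ (strict i s) (λ { _ refl → str })
  ; atMost    = λ i s s≡ → cases i s s≡ (atMost i s) (λ { _ refl → atm })
  ; adj       = adj₁
  }
  where
  open Triangle t
  cases : ∀ {P : Set} i s → at (T List.∷ʳ r) i ≡ just s → (at T i ≡ just s → P) → (i ≡ length T → r ≡ s → P) → P
  cases i s s≡ old new with at-∷ʳ⁻ T i s≡
  ... | inj₁ s≡₁       = old s≡₁
  ... | inj₂ (i≡ , r≡) = new i≡ r≡
  adj₁ : ∀ i k s → at (T List.∷ʳ r) i ≡ just k → at (T List.∷ʳ r) (suc i) ≡ just s → Adjacent k s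
  adj₁ i k s k≡ s≡ with at-∷ʳ⁻ T i k≡ | at-∷ʳ⁻ T (suc i) s≡
  ... | inj₁ k≡₁ | inj₁ s≡₁ = adj i k s k≡₁ s≡₁
  ... | inj₁ k≡₁ | inj₂ (1+i≡ , refl) with ℕ.suc-injective (trans 1+i≡ numRows)
  ...   | refl with trans (sym k≡₁) l≡
  ...     | refl = adjlr
  adj₁ i k s k≡ s≡ | inj₂ (refl , _) | inj₁ s≡₁ = ⊥-elim (ℕ.<-irrefl refl (ℕ.<-trans (ℕ.n<1+n _) (at-< T _ s≡₁)))
  adj₁ i k s k≡ s≡ | inj₂ (refl , _) | inj₂ (1+i≡ , _) = ⊥-elim (ℕ.1+n≢n 1+i≡)

triangle-∷ʳ⁻ : ∀ {n x r} T → Triangle (suc n) x (T List.∷ʳ r) → Triangle n x T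
triangle-∷ʳ⁻ {r = r} T t = record
  { numRows   = ℕ.suc-injective (trans (sym (trans (List.length-++ T) (ℕ.+-comm (length T) 1))) numRows)
  ; rowLength = λ i s s≡ → rowLength i s (at-∷ʳ-init T i s≡)
  ; strict    = λ i s s≡ → strict i s (at-∷ʳ-init T i s≡)
  ; atMost    = λ i s s≡ → atMost i s (at-∷ʳ-init T i s≡)
  ; adj       = λ i k s k≡ s≡ → adj i k s (at-∷ʳ-init T i k≡) (at-∷ʳ-init T (suc i) s≡)
  }
  where open Triangle t

toList-injective : {v w : Vec X m} → Vec.toList v ≡ Vec.toList w → v ≡ w
toList-injective {v = v} {w} eq = trans (sym (Vec.cast-is-id refl v)) (Vec.toList-injective refl v w eq)

vec-of : (r : List X) → length r ≡ m → Σ (Vec X m) λ v → Vec.toList v ≡ r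
vec-of r refl = Vec.fromList r , Vec.toList∘fromList r

-- The triangles have n + 1 rows, so that n is the position of the bottom row counted from zero.
record Enumerates (n : ℕ) (x : ℤ) (k : Vec ℤ m) (L : List (List (List ℤ))) : Set where
  field
    unique : Unique L
    spec   : ∀ T → T ∈ L ⇔ (Triangle (suc n) x T × at T n ≡ just (Vec.toList k))

extend : Vec ℤ m → (Vec ℤ n → List (List (List ℤ))) → List (Vec ℤ n) → List (List (List ℤ))
extend k triangles = concatMap (λ l → List.map (List._∷ʳ Vec.toList k) (triangles l))

-- One construction serves both parities, which differ only in the list `rows`. Soundness and
-- completeness of that list carry over because a triangle is a smaller triangle with one adjacent
-- row appended.
extend-enumerates : ∀ {n p q x} (k : Vec ℤ p) (triangles : Vec ℤ q → List (List (List ℤ))) (rows : List (Vec ℤ q)) →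
  p ≡ ⌈ suc (suc n) /2⌉ → q ≡ ⌈ suc n /2⌉ → Row x k → Unique rows →
  (∀ l → l ∈ rows → Row x l × Adjacent (Vec.toList l) (Vec.toList k)) →
  (∀ l → Adjacent (Vec.toList l) (Vec.toList k) → Strict (Vec.toList l) → AtMost x (Vec.toList l) → l ∈ rows) →
  (∀ l → Row x l → Enumerates n x l (triangles l)) →
  Enumerates (suc n) x k (extend k triangles rows)
extend-enumerates {n} {x = x} k triangles rows p≡ q≡ row uniqueRows rows⁻ rows⁺ enum = record
  { unique = concatMap-unique step uniqueRows
      (λ l∈ → Unique.map⁺ (List.∷ʳ-injectiveˡ _ _) (Enumerates.unique (enum _ (proj₁ (rows⁻ _ l∈)))))
      separated
  ; spec = λ T → mk⇔ (to T) (from T)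
  }
  where
  step : Vec ℤ _ → List (List (List ℤ))
  step l = List.map (List._∷ʳ Vec.toList k) (triangles l)
  bottom : ∀ {l T} → l ∈ rows → T ∈ triangles l → Triangle (suc n) x T × at T n ≡ just (Vec.toList l)
  bottom {l} {T} l∈ T∈ = Equivalence.to (Enumerates.spec (enum l (proj₁ (rows⁻ l l∈))) T) T∈
  -- The row l can be read off T: it is the bottom row of what remains after k is removed.
  separated : ∀ {l l₁ T} → l ∈ rows → l₁ ∈ rows → T ∈ step l → T ∈ step l₁ → l ≡ l₁
  separated l∈ l₁∈ T∈ T∈₁ with ∈-map⁻ (List._∷ʳ Vec.toList k) T∈ | ∈-map⁻ (List._∷ʳ Vec.toList k) T∈₁
  ... | S , S∈ , refl | S₁ , S₁∈ , eq with List.∷ʳ-injectiveˡ S S₁ eq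
  ... | refl = toList-injective (just-injective (trans (sym (proj₂ (bottom l∈ S∈))) (proj₂ (bottom l₁∈ S₁∈))))
  to : ∀ T → T ∈ extend k triangles rows → Triangle (suc (suc n)) x T × at T (suc n) ≡ just (Vec.toList k)
  to T T∈ with find (∈-concatMap⁻ step T∈)
  ... | l , l∈ , T∈l with ∈-map⁻ (List._∷ʳ Vec.toList k) T∈l
  ... | S , S∈ , refl =
    triangle-∷ʳ⁺ t (proj₂ (bottom l∈ S∈)) (trans (Vec.length-toList k) p≡) (row⇒strict x k row) (row⇒atMost x k row)
                 (proj₂ (rows⁻ l l∈)) ,
    subst (λ i → at (S List.∷ʳ Vec.toList k) i ≡ just (Vec.toList k)) (Triangle.numRows t) (at-∷ʳ-last S (Vec.toList k))
    where
    t : Triangle (suc n) x S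
    t = proj₁ (bottom l∈ S∈)
  from : ∀ T → Triangle (suc (suc n)) x T × at T (suc n) ≡ just (Vec.toList k) → T ∈ extend k triangles rows
  from T (t , k≡) with List.initLast T
  ... | S List.∷ʳ′ r with triangle-∷ʳ⁻ S t
  -- The row split off stands at position n + 1, the length of S, and is therefore k.
  ... | s with trans (sym (subst (λ i → at (S List.∷ʳ r) i ≡ just r) (Triangle.numRows s) (at-∷ʳ-last S r))) k≡
  ... | refl with at-last S n (Triangle.numRows s)
  ... | r₁ , r₁≡ with vec-of r₁ (trans (Triangle.rowLength s n r₁ r₁≡) (sym q≡))
  ... | l , refl = ∈-concatMap⁺ step (lose l∈
          (∈-map⁺ (List._∷ʳ Vec.toList k) (Equivalence.from (Enumerates.spec (enum l (proj₁ (rows⁻ l l∈))) S) (s , r₁≡))))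
    where
    l∈ : l ∈ rows
    l∈ = rows⁺ l (Triangle.adj t n (Vec.toList l) (Vec.toList k) (at-∷ʳ-init S n r₁≡) k≡)
                 (Triangle.strict s n (Vec.toList l) r₁≡) (Triangle.atMost s n (Vec.toList l) r₁≡)

⌊double/2⌋ : ∀ m → ⌊ double m /2⌋ ≡ m
⌊double/2⌋ zero    = refl
⌊double/2⌋ (suc m) = cong suc (⌊double/2⌋ m)

⌊1+double/2⌋ : ∀ m → ⌊ suc (double m) /2⌋ ≡ m
⌊1+double/2⌋ zero    = refl
⌊1+double/2⌋ (suc m) = cong suc (⌊1+double/2⌋ m)

-- The triangles with 2 m + 1, respectively 2 m + 2, rows.
oddTriangles evenTriangles : ℤ → ∀ m → Vec ℤ (suc m) → List (List (List ℤ))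
oddTriangles x zero    k        = (Vec.toList k ∷ []) ∷ []
oddTriangles x (suc m) (b ∷ us) = extend (b ∷ us) (evenTriangles x m) (interlacing b us)
evenTriangles x m      (b ∷ us) = extend (b ∷ us) (oddTriangles x m) (interlacing b (us Vec.∷ʳ x))

oddTriangles-enumerates : ∀ x m (k : Vec ℤ (suc m)) → Row x k → Enumerates (double m) x k (oddTriangles x m k)
evenTriangles-enumerates : ∀ x m (k : Vec ℤ (suc m)) → Row x k → Enumerates (suc (double m)) x k (evenTriangles x m k)

oddTriangles-enumerates x zero (a ∷ []) row = record
  { unique = [] ∷ []
  ; spec   = λ T → mk⇔ (λ { (here refl) → single , refl }) (from T)
  }
  where
  single : Triangle 1 x ((a ∷ []) ∷ [])
  single = record
    { numRows   = refl
    ; rowLength = λ { zero _ refl → refl }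
    ; strict    = λ { zero _ refl → row⇒strict x (a ∷ []) row }
    ; atMost    = λ { zero _ refl → row⇒atMost x (a ∷ []) row }
    ; adj       = λ { zero _ _ _ () ; (suc _) _ _ () _ }
    }
  from : ∀ T → Triangle 1 x T × at T 0 ≡ just (a ∷ []) → T ∈ ((a ∷ []) ∷ []) ∷ []
  from (r ∷ [])    (_ , refl) = here refl
  from (r ∷ s ∷ T) (t , _)    with () ← Triangle.numRows t
  from []          (_ , ())
oddTriangles-enumerates x (suc m) k@(b ∷ us) row =
  extend-enumerates k (evenTriangles x m) (interlacing b us)
    (cong (λ p → suc (suc p)) (sym (⌊double/2⌋ m))) (cong suc (sym (⌊1+double/2⌋ m))) row (interlacing-unique b us)
    (λ l l∈ → let inter = ∈-interlacing⁻ b us l l∈ in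
       ascending⇒row x l (interlaces-ascending x us l (ascending-pred (us Vec.∷ʳ (x ℤ.+ 1ℤ)) row) inter) ,
       interlaces⇒adjacent us l inter)
    (λ l adj str _ → ∈-interlacing⁺ b us l (adjacent⇒interlaces us l adj str))
    (evenTriangles-enumerates x m)

evenTriangles-enumerates x m k@(b ∷ us) row =
  extend-enumerates k (oddTriangles x m) (interlacing b us′)
    (cong suc (sym (⌊1+double/2⌋ m))) (cong suc (sym (⌊double/2⌋ m))) row (interlacing-unique b us′)
    (λ l l∈ → let inter = ∈-interlacing⁻ b us′ l l∈ in
       ascending⇒row x l (interlaces-∷ʳ-ascending us l inter) ,
       adjacent-∷ʳ⁻ (Vec.toList k) x (subst (Adjacent (Vec.toList l)) (cong (b ∷_) toList-us′)
                                            (interlaces⇒adjacent us′ l inter)))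
    (λ l adj str atMost → ∈-interlacing⁺ b us′ l (adjacent⇒interlaces us′ l
       (subst (Adjacent (Vec.toList l)) (cong (b ∷_) (sym toList-us′))
              (adjacent-∷ʳ⁺ (Vec.toList k) x (trans (Vec.length-toList l) (sym (Vec.length-toList k))) atMost adj)) str))
    (oddTriangles-enumerates x m)
  where
  us′ : Vec ℤ (suc m)
  us′ = us Vec.∷ʳ x
  toList-us′ : Vec.toList us′ ≡ Vec.toList us List.∷ʳ x
  toList-us′ = Vec.toList-∷ʳ x us

fromℕ-length-++ : (as bs : List X) → fromℕ (length (as ++ bs)) ≡ fromℕ (length as) + fromℕ (length bs)
fromℕ-length-++ as bs = trans (cong fromℕ (List.length-++ as)) (fromℤ-+ (+ length as) (+ length bs))

length-extend : (k : Vec ℤ m) (triangles : Vec ℤ n → List (List (List ℤ))) (rows : List (Vec ℤ n)) →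
                fromℕ (length (extend k triangles rows)) ≡ sumOver rows (fromℕ ∘ length ∘ triangles)
length-extend k triangles []         = refl
length-extend k triangles (l ∷ rows) =
  trans (fromℕ-length-++ (List.map (List._∷ʳ Vec.toList k) (triangles l)) (extend k triangles rows))
        (cong₂ _+_ (cong fromℕ (List.length-map (List._∷ʳ Vec.toList k) (triangles l))) (length-extend k triangles rows))

length-oddTriangles : ∀ x m (k : Vec ℤ (suc m)) → Row x k →
  fromℕ (length (oddTriangles x m k)) ≡ ⟦ 𝒱 (suc m) ⟧ (det (evenColumn x)) k
length-evenTriangles : ∀ x m (k : Vec ℤ (suc m)) → Row x k →
  fromℕ (length (evenTriangles x m k)) ≡ ⟦ 𝒱 (suc m) ⟧ (det (oddColumn x)) k

-- There are no factors to apply and the determinant is the single entry 1, so both sides compute to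
-- 1.
length-oddTriangles x zero    (a ∷ [])   row = refl
length-oddTriangles x (suc m) (b ∷ us) row = begin
  fromℕ (length (oddTriangles x (suc m) (b ∷ us)))
    ≡⟨ length-extend (b ∷ us) (evenTriangles x m) (interlacing b us) ⟩
  sumOver (interlacing b us) (fromℕ ∘ length ∘ evenTriangles x m)
    ≡⟨ sumOver-cong-∈ (interlacing b us) (λ {l} l∈ → length-evenTriangles x m l
         (ascending⇒row x l (interlaces-ascending x us l asc (∈-interlacing⁻ b us l l∈)))) ⟩
  sumOver (interlacing b us) (⟦ 𝒱 (suc m) ⟧ (det (oddColumn x)))
    ≡⟨ sumOver-interlacing b us (⟦ 𝒱 (suc m) ⟧ (det (oddColumn x))) ⟩
  interlacingSum b us (⟦ 𝒱 (suc m) ⟧ (det (oddColumn x)))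
    ≡⟨ interlacingSum-odd x b us (ascending-init us asc) ⟩
  ⟦ 𝒱 (suc (suc m)) ⟧ (det (evenColumn x)) (b ∷ us)
    ∎
  where
  asc : Ascending b (us Vec.∷ʳ (x ℤ.+ 1ℤ))
  asc = ascending-pred (us Vec.∷ʳ (x ℤ.+ 1ℤ)) row

length-evenTriangles x m (b ∷ us) row = begin
  fromℕ (length (evenTriangles x m (b ∷ us)))
    ≡⟨ length-extend (b ∷ us) (oddTriangles x m) (interlacing b (us Vec.∷ʳ x)) ⟩
  sumOver (interlacing b (us Vec.∷ʳ x)) (fromℕ ∘ length ∘ oddTriangles x m)
    ≡⟨ sumOver-cong-∈ (interlacing b (us Vec.∷ʳ x)) (λ {l} l∈ → length-oddTriangles x m l
         (ascending⇒row x l (interlaces-∷ʳ-ascending us l (∈-interlacing⁻ b (us Vec.∷ʳ x) l l∈)))) ⟩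
  sumOver (interlacing b (us Vec.∷ʳ x)) (⟦ 𝒱 (suc m) ⟧ (det (evenColumn x)))
    ≡⟨ sumOver-interlacing b (us Vec.∷ʳ x) (⟦ 𝒱 (suc m) ⟧ (det (evenColumn x))) ⟩
  interlacingSum b (us Vec.∷ʳ x) (⟦ 𝒱 (suc m) ⟧ (det (evenColumn x)))
    ≡⟨ interlacingSum-even x b us (ascending-pred (us Vec.∷ʳ (x ℤ.+ 1ℤ)) row) ⟩
  ⟦ 𝒱 (suc m) ⟧ (det (oddColumn x)) (b ∷ us)
    ∎

toList-tabulate : (k : Fin m → X) → Vec.toList (Vec.tabulate k) ≡ tabulate k
toList-tabulate {zero}  k = refl
toList-tabulate {suc m} k = cong (k zero ∷_) (toList-tabulate (k ∘ suc))

row-tabulate : ∀ x (k : Fin (suc m) → ℤ) → (∀ i j → i Fin.< j → k i ℤ.< k j) → (∀ i → k i ℤ.≤ x) →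
               Row x (Vec.tabulate k)
row-tabulate {zero}  x k increasing bounded = ℤ.+-monoˡ-≤ 1ℤ (bounded zero) , _
row-tabulate {suc m} x k increasing bounded =
  <⇒+1≤ (increasing zero (suc zero) ℕ.z<s) ,
  row-tabulate x (k ∘ suc) (λ i j i<j → increasing (suc i) (suc j) (ℕ.s<s i<j)) (bounded ∘ suc)

-- The two parities of the number of rows.

double%2 : ∀ m → double m % 2 ≡ 0
double%2 zero    = refl
double%2 (suc m) = double%2 m

1+double%2 : ∀ m → suc (double m) % 2 ≡ 1
1+double%2 zero    = refl
1+double%2 (suc m) = 1+double%2 m

data Parity : ℕ → Set where
  even : ∀ m → Parity (double m)
  odd  : ∀ m → Parity (suc (double m))

parity : ∀ n → Parity n
parity zero          = even zero
parity (suc zero)    = odd zero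
parity (suc (suc n)) with parity n
... | even m = even (suc m)
... | odd m  = odd (suc m)

-- The length M of the bottom row is decoupled from n so that ⌈ n /2⌉ can be rewritten.
Counted : (n M : ℕ) → ℤ → Set
Counted n M x = (k : Fin M → ℤ) → (∀ i j → i Fin.< j → k i ℤ.< k j) → (∀ i → k i ℤ.≤ x) →
  Σ (List (List (List ℤ))) λ L → Unique L
    × (∀ (T : List (List ℤ)) → (T ∈ L) ⇔ (IsHalvedMonotoneTriangle n T × BottomRow n T (tabulate k) × EntriesAtMost x T))
    × (n % 2 ≡ 1 → ((+ length L) ℚ./ 1) ≡ theOperator M (polyOdd M x) k)
    × (n % 2 ≡ 0 → ((+ length L) ℚ./ 1) ≡ theOperator M (polyEven M x) k)

enumerates⇒spec : ∀ {n x L} (k : Fin m → ℤ) → Enumerates n x (Vec.tabulate k) L → ∀ T →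
  (T ∈ L) ⇔ (IsHalvedMonotoneTriangle (suc n) T × BottomRow (suc n) T (tabulate k) × EntriesAtMost x T)
enumerates⇒spec {n = n} {x} k enum T = mk⇔
  (λ T∈ → let t , bottom = Equivalence.to (Enumerates.spec enum T) T∈
              h , bounded = Equivalence.to (triangle⇔ (suc n) x T) t
          in h , trans bottom (cong just (toList-tabulate k)) , bounded)
  (λ (h , bottom , bounded) → Equivalence.from (Enumerates.spec enum T)
    (Equivalence.from (triangle⇔ (suc n) x T) (h , bounded) , trans bottom (cong just (sym (toList-tabulate k)))))

counted-odd : ∀ m x → Counted (suc (double m)) (suc m) x
counted-odd m x k increasing bounded =
  oddTriangles x m v , Enumerates.unique enum , enumerates⇒spec k enum ,
  (λ _ → trans (length-oddTriangles x m v valid)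
               (sym (theOperator-represents (polyOdd-represents x) k v (Vec.lookup∘tabulate k)))) ,
  (λ n%2≡0 → ⊥-elim (ℕ.1+n≢0 (trans (sym (1+double%2 m)) n%2≡0)))
  where
  v : Vec ℤ (suc m)
  v = Vec.tabulate k
  valid : Row x v
  valid = row-tabulate x k increasing bounded
  enum : Enumerates (double m) x v (oddTriangles x m v)
  enum = oddTriangles-enumerates x m v valid

counted-even : ∀ m x → Counted (suc (suc (double m))) (suc m) x
counted-even m x k increasing bounded =
  evenTriangles x m v , Enumerates.unique enum , enumerates⇒spec k enum ,
  (λ n%2≡1 → ⊥-elim (ℕ.1+n≢0 (trans (sym n%2≡1) (double%2 m)))) ,
  (λ _ → trans (length-evenTriangles x m v valid)
               (sym (theOperator-represents (polyEven-represents x) k v (Vec.lookup∘tabulate k))))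
  where
  v : Vec ℤ (suc m)
  v = Vec.tabulate k
  valid : Row x v
  valid = row-tabulate x k increasing bounded
  enum : Enumerates (suc (double m)) x v (evenTriangles x m v)
  enum = evenTriangles-enumerates x m v valid

theorem1 : (n : ℕ) → 1 ℕ.≤ n → (x : ℤ) → (k : Fin ⌈ n /2⌉ → ℤ) →
    (∀ i j → i Fin.< j → k i ℤ.< k j) → (∀ i → k i ℤ.≤ x) →
    Σ (List (List (List ℤ))) λ L → Unique L
    × (∀ (T : List (List ℤ)) → (T ∈ L) ⇔ (IsHalvedMonotoneTriangle n T × BottomRow n T (tabulate k) × EntriesAtMost x T))
    × (n % 2 ≡ 1 → ((+ length L) ℚ./ 1) ≡ theOperator ⌈ n /2⌉ (polyOdd ⌈ n /2⌉ x) k)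
    × (n % 2 ≡ 0 → ((+ length L) ℚ./ 1) ≡ theOperator ⌈ n /2⌉ (polyEven ⌈ n /2⌉ x) k)
theorem1 (suc n) _ x with parity n
-- The parity is that of the number of rows minus one, so the even case is the formula for odd n.
-- The length of the bottom row computes to `suc ⌊ n /2⌋`, leaving only the half to be rewritten.
... | even m = subst (λ p → Counted (suc (double m)) (suc p) x) (sym (⌊double/2⌋ m)) (counted-odd m x)
... | odd m  = subst (λ p → Counted (suc (suc (double m))) (suc p) x) (sym (⌊1+double/2⌋ m)) (counted-even m x)
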